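{- Let $G\subseteq\mathsf{S}_\ell$ with $G\in\operatorname{Fix}(\ell^2)$. (a) If $\ell\ge3$, then one of $\alpha$, $\gamma$, $f$ is trivial on $G$; i.e. there are no counterexamples $G\subseteq\mathsf{S}_\ell$ when $\ell\ge3$. (b) Let $\ell=2$ and let $G\subseteq\mathsf{S}_2$ be a counterexample. Then either $\overline{G}=\overline{\mathsf{S}}_2\cong C_2\times D_4$ or $\overline{G}\cong D_4$. In either case, for every subgroup $H\subseteq\Gamma(2)\cap\ker(f)$, the subgroup of $\operatorname{Sp}(\mathcal{T})$ generated by $G$ and $H$ is also a counterexample. In particular, if $G$ is a maximal counterexample, then $\overline{G}\cong D_4\times C_2$ and $G\cap\Gamma(2)=\Gamma(2)\cap\ker(f)$. Moreover, there exist counterexamples $G\subseteq\mathsf{S}_2$ with $\overline{G}=\overline{\mathsf{S}}_2$, and for every subgroup $D\subseteq\overline{\mathsf{S}}_2$ isomorphic to $D_4$ there exist counterexamples $G\subseteq\mathsf{S}_2$ with $\overline{G}=D$.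
   Context: $\ell$ is a prime; $\mathcal{T}$ is a free $\mathbf{Z}_\ell$-module of rank $4$ with a nondegenerate alternating form $\langle\cdot,\cdot\rangle$; $\operatorname{Sp}(\mathcal{T})$ is its group of form-preserving automorphisms; $\pi_\ell$ is reduction mod $\ell$, $\Gamma(\ell)=\ker\pi_\ell$, $\overline{G}=\pi_\ell(G)$. $\operatorname{Fix}(\ell^2)$: subgroups $G\subseteq\operatorname{Sp}(\mathcal{T})$ with $\det(g-1)\equiv0\pmod{\ell^2}$ for all $g\in G$. A lattice is a finite-index $\mathbf{Z}_\ell$-submodule of $\mathcal{T}$; $G\in\operatorname{Fix}(\ell^2)$ is a counterexample if there are no $G$-stable lattices $\mathcal{L}'\subseteq\mathcal{L}\subseteq\mathcal{T}$ with $[\mathcal{L}:\mathcal{L}']=\ell^2$ and trivial $G$-action on $\mathcal{L}/\mathcal{L}'$; a maximal counterexample is one not properly contained in another counterexample. Fix a symplectic basis $e_1,\dots,e_4$ ($\langle e_1,e_4\rangle=\langle e_2,e_3\rangle=1$, $\langle e_1,e_2\rangle=\langle e_1,e_3\rangle=\langle e_4,e_2\rangle=\langle e_4,e_3\rangle=0$); matrices use $g(e_j)=\sum_i g_{ij}e_i$. $\mathsf{S}_\ell$: all $g\in\operatorname{Sp}(\mathcal{T})$ with $\pi_\ell(g)$ lower triangular with all diagonal entries $1$; $\overline{\mathsf{S}}_\ell=\pi_\ell(\mathsf{S}_\ell)$. For $g\in\mathsf{S}_\ell$: $\alpha(g),\gamma(g)$ are the $(2,1)$ and $(3,2)$ entries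 of $\pi_\ell(g)$; $g_{14}\in\ell\mathbf{Z}_\ell$ and $f(g)$ is the reduction mod $\ell$ of $g_{14}/\ell$; $\alpha,\gamma,f:\mathsf{S}_\ell\to\mathbf{Z}/\ell$ are homomorphisms. $D_4$ is the dihedral group of order $8$, $C_2$ the cyclic group of order $2$. -}

module Defs where

open import Data.Nat as ℕ using (ℕ; zero; suc; _<_)
open import Data.Nat.DivMod using (_mod_)
open import Data.Integer as ℤ using (ℤ; +_; -[1+_]; _+_; _*_; _-_; -_)
open import Data.Integer.Divisibility using (_∣_)
open import Data.Fin using (Fin; zero; suc; toℕ; punchIn)
open import Data.Bool using (Bool; true; false; not; _∧_; _xor_)
open import Data.Product using (Σ; ∃; _×_; _,_)
open import Relation.Binary.PropositionalEquality using (_≡_)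
open import Relation.Nullary using (¬_)

_≡_[mod_] : ℤ → ℤ → ℤ → Set
a ≡ b [mod m ] = m ∣ (a - b)

pw : ℕ → ℕ → ℤ
pw ℓ n = + (ℓ ℕ.^ n)

Vec4 : Set
Vec4 = Fin 4 → ℤ

Mat : ℕ → Set
Mat n = Fin n → Fin n → ℤ

Mat4 : Set
Mat4 = Mat 4

sumFin : (n : ℕ) → (Fin n → ℤ) → ℤ
sumFin zero    f = + 0
sumFin (suc n) f = f zero + sumFin n (λ i → f (suc i))

δ : Fin 4 → Fin 4 → ℤ
δ i j with toℕ i ℕ.≟ toℕ j
... | Relation.Nullary.yes _ = + 1
... | Relation.Nullary.no  _ = + 0

I4 : Mat4
I4 = δ

_⊗_ : Mat4 → Mat4 → Mat4
(A ⊗ B) i j = sumFin 4 (λ k → A i k * B k j)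

_·v_ : Mat4 → Vec4 → Vec4
(A ·v x) i = sumFin 4 (λ k → A i k * x k)

transpose : Mat4 → Mat4
transpose A i j = A j i

det : (n : ℕ) → Mat n → ℤ
det zero    M = + 1
det (suc n) M =
  sumFin (suc n) (λ j → ((- (+ 1)) ℤ.^ toℕ j) * M zero j
                         * det n (λ a b → M (suc a) (punchIn j b)))

-- Gram matrix of the symplectic form in the basis e1..e4 (indices 0..3):
-- <e1,e4> = <e2,e3> = 1, alternating.
J : Mat4
J zero                         (suc (suc (suc zero))) = + 1
J (suc (suc (suc zero)))       zero                   = - (+ 1)
J (suc zero)                   (suc (suc zero))       = + 1
J (suc (suc zero))             (suc zero)             = - (+ 1)
J _ _ = + 0

-- ℓ-adic integers, vectors, matrices: as compatible sequences of integer
-- approximations; the n-th term is the reduction modulo ℓ^n.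

ZSeq : Set
ZSeq = ℕ → ℤ

VSeq : Set
VSeq = ℕ → Vec4

MSeq : Set
MSeq = ℕ → Mat4

module _ (ℓ : ℕ) where

  CompatZ : ZSeq → Set
  CompatZ a = ∀ n → a (suc n) ≡ a n [mod pw ℓ n ]

  CompatV : VSeq → Set
  CompatV x = ∀ n i → x (suc n) i ≡ x n i [mod pw ℓ n ]

  CompatM : MSeq → Set
  CompatM g = ∀ n i j → g (suc n) i j ≡ g n i j [mod pw ℓ n ]

  _≈V_ : VSeq → VSeq → Set
  x ≈V y = ∀ n i → x n i ≡ y n i [mod pw ℓ n ]

  _≈M_ : MSeq → MSeq → Set
  g ≈M h = ∀ n i j → g n i j ≡ h n i j [mod pw ℓ n ]

  IsSp : MSeq → Set
  IsSp g = CompatM g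
         × (∀ n i j → (transpose (g n) ⊗ (J ⊗ g n)) i j ≡ J i j [mod pw ℓ n ])

  idS : MSeq
  idS n = I4

  _⊗S_ : MSeq → MSeq → MSeq
  (g ⊗S h) n = g n ⊗ h n

  -- subgroups of Sp(T), given as predicates on representatives
  record Subgroup (G : MSeq → Set) : Set where
    field
      sp   : ∀ g → G g → IsSp g
      resp : ∀ g h → G g → IsSp h → g ≈M h → G h
      one  : G idS
      mul  : ∀ g h → G g → G h → G (g ⊗S h)
      inv  : ∀ g → G g → ∃ λ h → G h × ((g ⊗S h) ≈M idS)

  Fix2 : (MSeq → Set) → Set
  Fix2 G = ∀ g → G g → pw ℓ 2 ∣ det 4 (λ i j → g 2 i j - I4 i j)

  InS : MSeq → Set
  InS g = IsSp g
        × (∀ i j → toℕ i < toℕ j → g 1 i j ≡ + 0 [mod pw ℓ 1 ])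
        × (∀ i → g 1 i i ≡ + 1 [mod pw ℓ 1 ])

  -- α(g), γ(g): (2,1) and (3,2) entries of π_ℓ(g);  f(g) = (g₁₄/ℓ) mod ℓ.
  αTrivial : (MSeq → Set) → Set
  αTrivial G = ∀ g → G g → g 1 (suc zero) zero ≡ + 0 [mod pw ℓ 1 ]

  γTrivial : (MSeq → Set) → Set
  γTrivial G = ∀ g → G g → g 1 (suc (suc zero)) (suc zero) ≡ + 0 [mod pw ℓ 1 ]

  -- for g ∈ S_ℓ, g₁₄ ∈ ℓZ_ℓ, and f(g) = 0 iff g₁₄ ≡ 0 mod ℓ²
  fTrivial : (MSeq → Set) → Set
  fTrivial G = ∀ g → G g → g 2 zero (suc (suc (suc zero))) ≡ + 0 [mod pw ℓ 2 ]

  -- lattices: Z_ℓ-submodules of T = Z_ℓ⁴ of finite index (⇔ containing ℓ^k T)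
  record Lattice (L : VSeq → Set) : Set where
    field
      compat : ∀ x → L x → CompatV x
      resp   : ∀ x y → L x → CompatV y → x ≈V y → L y
      zero∈  : L (λ n i → + 0)
      add    : ∀ x y → L x → L y → L (λ n i → x n i + y n i)
      smul   : ∀ a x → CompatZ a → L x → L (λ n i → a n * x n i)
      finiteIndex : ∃ λ k → ∀ x → CompatV x → L (λ n i → pw ℓ k * x n i)

  Stable : (MSeq → Set) → (VSeq → Set) → Set
  Stable G L = ∀ g x → G g → L x → L (λ n → g n ·v x n)

  Index : (VSeq → Set) → (VSeq → Set) → ℕ → Set
  Index L L' m =
    Σ (Fin m → VSeq) λ r →
        (∀ i → L (r i))
      × (∀ i j → L' (λ n k → r i n k - r j n k) → i ≡ j)
      × (∀ x → L x → ∃ λ i → L' (λ n k → x n k - r i n k))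

  TrivialOnQuot : (MSeq → Set) → (VSeq → Set) → (VSeq → Set) → Set
  TrivialOnQuot G L L' = ∀ g x → G g → L x → L' (λ n k → (g n ·v x n) k - x n k)

  GoodPair : (MSeq → Set) → Set₁
  GoodPair G =
    Σ (VSeq → Set) λ L → Σ (VSeq → Set) λ L' →
        Lattice L × Lattice L' × (∀ x → L' x → L x)
      × Stable G L × Stable G L'
      × Index L L' (ℓ ℕ.^ 2)
      × TrivialOnQuot G L L'

  Counterexample : (MSeq → Set) → Set₁
  Counterexample G = Subgroup G × Fix2 G × ¬ GoodPair G

  MaximalCounterexample : (MSeq → Set) → Set₁
  MaximalCounterexample G =
    Counterexample G
    × ((G' : MSeq → Set) → Counterexample G' → (∀ g → G g → G' g) → (∀ g → G' g → G g))

  data Gen (G H : MSeq → Set) : MSeq → Set where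
    gen-inG  : ∀ {g} → G g → Gen G H g
    gen-inH  : ∀ {g} → H g → Gen G H g
    gen-one  : Gen G H idS
    gen-mul  : ∀ {g h} → Gen G H g → Gen G H h → Gen G H (g ⊗S h)
    gen-inv  : ∀ {g h} → Gen G H g → IsSp h → (g ⊗S h) ≈M idS → Gen G H h
    gen-resp : ∀ {g h} → Gen G H g → IsSp h → g ≈M h → Gen G H h

Γ2 : MSeq → Set
Γ2 g = IsSp 2 g × (∀ i j → g 1 i j ≡ I4 i j [mod pw 2 1 ])

Γ2kerf : MSeq → Set
Γ2kerf g = Γ2 g × (g 2 zero (suc (suc (suc zero))) ≡ + 0 [mod pw 2 2 ])

M2 : Set
M2 = Fin 4 → Fin 4 → Bool

b2z : Bool → ℤ
b2z true  = + 1
b2z false = + 0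

_≗₂_ : M2 → M2 → Set
A ≗₂ B = ∀ i j → A i j ≡ B i j

xor4 : (Fin 4 → Bool) → Bool
xor4 f = f zero xor (f (suc zero) xor (f (suc (suc zero)) xor f (suc (suc (suc zero)))))

_⊗₂_ : M2 → M2 → M2
(A ⊗₂ B) i j = xor4 (λ k → A i k ∧ B k j)

I₂ : M2
I₂ i j with toℕ i ℕ.≟ toℕ j
... | Relation.Nullary.yes _ = true
... | Relation.Nullary.no  _ = false

Reduces : MSeq → M2 → Set
Reduces g m = ∀ i j → g 1 i j ≡ b2z (m i j) [mod pw 2 1 ]

Gbar : (MSeq → Set) → M2 → Set
Gbar G m = ∃ λ g → G g × Reduces g m

Sbar2 : M2 → Set
Sbar2 = Gbar (InS 2)

_≐_ : (M2 → Set) → (M2 → Set) → Set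
P ≐ Q = ∀ m → (P m → Q m) × (Q m → P m)

record Subgroup₂ (D : M2 → Set) : Set where
  field
    resp : ∀ m m' → D m → m ≗₂ m' → D m'
    one  : D I₂
    mul  : ∀ m m' → D m → D m' → D (m ⊗₂ m')
    inv  : ∀ m → D m → ∃ λ m' → D m' × ((m ⊗₂ m') ≗₂ I₂)

-- the abstract groups D₄ = ⟨r,s | r⁴, s², srs⁻¹ = r⁻¹⟩ and C₂ × D₄.
-- (k , b) stands for r^k s^b.
D4 : Set
D4 = Fin 4 × Bool

_⊕₄_ : Fin 4 → Fin 4 → Fin 4
a ⊕₄ c = (toℕ a ℕ.+ toℕ c) mod 4

_⊖₄_ : Fin 4 → Fin 4 → Fin 4
a ⊖₄ c = (toℕ a ℕ.+ (4 ℕ.∸ toℕ c)) mod 4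

_·D4_ : D4 → D4 → D4
(a , false) ·D4 (c , d) = (a ⊕₄ c , d)
(a , true)  ·D4 (c , d) = (a ⊖₄ c , not d)

C2×D4 : Set
C2×D4 = Bool × D4

_·C2D4_ : C2×D4 → C2×D4 → C2×D4
(b , x) ·C2D4 (b' , y) = (b xor b' , x ·D4 y)

IsoOnto : {X : Set} → (X → X → X) → (M2 → Set) → Set
IsoOnto {X} _∙_ S =
  Σ (X → M2) λ φ →
      (∀ x → S (φ x))
    × (∀ x y → φ x ≗₂ φ y → x ≡ y)
    × (∀ m → S m → ∃ λ x → φ x ≗₂ m)
    × (∀ x y → φ (x ∙ y) ≗₂ (φ x ⊗₂ φ y))

{-# OPTIONS --safe #-}

-- On S_ℓ one has det(g - 1) ≡ g₁₄ α(g)² γ(g) mod ℓ², so G ⊆ S_ℓ lies in Fix(ℓ²)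
-- exactly when α γ f vanishes on G.  If one of the three characters is trivial on
-- G, then explicit diagonal lattices ℒ' ⊆ ℒ show that G is not a counterexample.
-- For ℓ ≥ 3 a group is not the union of three kernels of characters to F_ℓ; for
-- ℓ = 2 the product of three nontrivial characters can vanish only if f = α + γ.
--
-- Conversely let α, γ, f be nontrivial on G ∋ -1 with ℓ = 2.  G lies in the pro-2
-- Iwahori subgroup, which stabilises the chain T ⊃ ρT ⊃ ρ²T ⊃ ... with ρ⁴ = 2.
-- If x lies in ℒ ⊆ ρ^i T but not in ρ^(i+1) T, applying g - 1 three times, with g
-- odd for three cyclically consecutive characters among α, γ, α, f, completes x to a
-- basis of ρ^i T whose other vectors lie in ℒ' as soon as G acts trivially on ℒ/ℒ';
-- since -1 ∈ G, also 2x ∈ ℒ', so ℒ' has index at most 2 in ℒ = ρ^i T.  Hence the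
-- preimages in ker(α + γ + f) of the subgroups of S̄₂ on which α, γ, α + γ are
-- nontrivial are counterexamples, and overgroups of a counterexample inside
-- ker(α + γ + f) are counterexamples as well.
module Submission where

open import Defs
open import Level using (Lift; lift; lower)
open import Data.Bool using (Bool; true; false; _∧_; _xor_)
import Data.Bool.Properties as Boolₚ
open import Data.Empty using (⊥; ⊥-elim)
open import Data.Fin using (Fin; zero; suc; toℕ; fromℕ<; punchIn; remQuot; combine)
open import Data.Fin.Patterns using (0F; 1F; 2F; 3F)
open import Data.Fin.Properties using (all?; any?; toℕ-injective; toℕ<n; toℕ-fromℕ<; remQuot-combine; combine-remQuot) renaming (_≟_ to _≟ᶠ_)
open import Data.Integer as ℤ using (ℤ; +_; -[1+_]; _+_; _*_; _-_; -_; ∣_∣)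
import Data.Integer.Divisibility as ℤ∣
import Data.Integer.Divisibility.Signed as ℤ∣ₛ
import Data.Integer.DivMod as ℤ/
import Data.Integer.Properties as ℤₚ
open import Data.Integer.Tactic.RingSolver using (solve-∀)
open import Data.Nat as ℕ using (ℕ; zero; suc; _≤_; z≤n; s≤s)
import Data.Nat.Divisibility as ℕ∣
open import Data.Nat.Primality using (Prime; euclidsLemma; prime⇒nonZero)
import Data.Nat.Properties as ℕₚ
open import Data.Product using (Σ; ∃; _×_; _,_; proj₁; proj₂)
open import Data.Product.Properties using (≡-dec)
open import Data.Sum using (_⊎_; inj₁; inj₂; [_,_]′)
open import Data.Unit using (tt)
open import Relation.Binary.Bundles using (Setoid)
open import Relation.Binary.PropositionalEquality using (_≡_; _≢_; refl; sym; trans; cong; cong₂; subst; subst₂)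
import Relation.Binary.Reasoning.Setoid as SetoidReasoning
open import Relation.Nullary using (¬_; Dec; yes; no)
open import Relation.Nullary.Decidable using (toWitness; map′; decidable-stable; _×-dec_; _⊎-dec_; _→-dec_)

-- Elements are given by integer representatives at every level, so the lattice argument is carried
-- out in ℤ⁴. A lattice contains 2^N T for some N, hence is known from its integer vectors, and on
-- these g - 1 may be replaced by the integer matrix that it has at level N. Conjugation by ρ shifts
-- the matrix indices cyclically, so the case of ρ^i T reduces to i = 0 with the characters
-- permuted. The explicit lattices for a trivial character come from the same chain with ℓ in place
-- of 2: on ρ^i T / ρ^(i+2) T the group acts by unipotent 2 × 2 matrices whose off-diagonal entry
-- is, up to sign, one of the characters. The group theory modulo 2 is finite: a lower unitriangular
-- symplectic matrix over F₂ amounts to four bits, and identities in this group of order 16 are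
-- decided by exhaustion. A subgroup on which (α, γ) takes all values in F₂² is everything or
-- dihedral, according to whether it contains one particular central involution.

-- Congruences of integers.

infix 4 _≅_⟦_⟧

-- Equivalent to the _≡_[mod_] of Defs, which unfolds to an equation of
-- absolute values from which Agda cannot infer the two sides.
record _≅_⟦_⟧ (a b m : ℤ) : Set where
  constructor by
  field
    quot  : ℤ
    equal : a ≡ b + quot * m

open _≅_⟦_⟧ public

from-mod : ∀ {a b m} → a ≡ b [mod m ] → a ≅ b ⟦ m ⟧
from-mod {a} {b} {m} d with ℤ∣ₛ.∣ᵤ⇒∣ {m} {a - b} d
... | ℤ∣ₛ.divides q eq = by q (trans (shift a b) (cong (λ z → b + z) eq))
  where
  shift : ∀ a b → a ≡ b + (a - b)
  shift = solve-∀

to-mod : ∀ {a b m} → a ≅ b ⟦ m ⟧ → a ≡ b [mod m ]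
to-mod {a} {b} {m} (by q eq) =
  ℤ∣ₛ.∣⇒∣ᵤ (ℤ∣ₛ.divides q (trans (cong (_- b) eq) (shift b (q * m))))
  where
  shift : ∀ b c → b + c - b ≡ c
  shift = solve-∀

from-∣ : ∀ {a m} → m ℤ∣.∣ a → a ≅ + 0 ⟦ m ⟧
from-∣ {a} {m} d = from-mod (subst (m ℤ∣.∣_) (sym (ℤₚ.+-identityʳ a)) d)

to-∣ : ∀ {a m} → a ≅ + 0 ⟦ m ⟧ → m ℤ∣.∣ a
to-∣ {a} {m} c = subst (m ℤ∣.∣_) (ℤₚ.+-identityʳ a) (to-mod c)

module _ {m : ℤ} where

  ≡⇒≅ : ∀ {a b} → a ≡ b → a ≅ b ⟦ m ⟧
  ≡⇒≅ {a} refl = by (+ 0) (eq a m)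
    where
    eq : ∀ a m → a ≡ a + + 0 * m
    eq = solve-∀

  ≅-refl : ∀ {a} → a ≅ a ⟦ m ⟧
  ≅-refl = ≡⇒≅ refl

  ≅-sym : ∀ {a b} → a ≅ b ⟦ m ⟧ → b ≅ a ⟦ m ⟧
  ≅-sym {b = b} (by q refl) = by (- q) (eq b q m)
    where
    eq : ∀ b q m → b ≡ (b + q * m) + - q * m
    eq = solve-∀

  ≅-trans : ∀ {a b c} → a ≅ b ⟦ m ⟧ → b ≅ c ⟦ m ⟧ → a ≅ c ⟦ m ⟧
  ≅-trans {c = c} (by q refl) (by r refl) = by (q + r) (eq c q r m)
    where
    eq : ∀ c q r m → c + r * m + q * m ≡ c + (q + r) * m
    eq = solve-∀

  ≅-+ : ∀ {a b c d} → a ≅ b ⟦ m ⟧ → c ≅ d ⟦ m ⟧ → a + c ≅ b + d ⟦ m ⟧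
  ≅-+ {b = b} {d = d} (by q refl) (by r refl) = by (q + r) (eq b d q r m)
    where
    eq : ∀ b d q r m → b + q * m + (d + r * m) ≡ b + d + (q + r) * m
    eq = solve-∀

  ≅-* : ∀ {a b c d} → a ≅ b ⟦ m ⟧ → c ≅ d ⟦ m ⟧ → a * c ≅ b * d ⟦ m ⟧
  ≅-* {b = b} {d = d} (by q refl) (by r refl) =
    by (q * d + b * r + q * r * m) (eq b d q r m)
    where
    eq : ∀ b d q r m → (b + q * m) * (d + r * m) ≡ b * d + (q * d + b * r + q * r * m) * m
    eq = solve-∀

  ≅-neg : ∀ {a b} → a ≅ b ⟦ m ⟧ → - a ≅ - b ⟦ m ⟧
  ≅-neg {b = b} (by q refl) = by (- q) (eq b q m)
    where
    eq : ∀ b q m → - (b + q * m) ≡ - b + - q * m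
    eq = solve-∀

  ≅-minus : ∀ {a b c d} → a ≅ b ⟦ m ⟧ → c ≅ d ⟦ m ⟧ → a - c ≅ b - d ⟦ m ⟧
  ≅-minus p q = ≅-+ p (≅-neg q)

  ≅⇒minus≅0 : ∀ {a b} → a ≅ b ⟦ m ⟧ → a - b ≅ + 0 ⟦ m ⟧
  ≅⇒minus≅0 {b = b} p = ≅-trans (≅-minus p (≅-refl {b})) (≡⇒≅ (ℤₚ.+-inverseʳ b))

  minus≅0⇒≅ : ∀ {a b} → a - b ≅ + 0 ⟦ m ⟧ → a ≅ b ⟦ m ⟧
  minus≅0⇒≅ {a} {b} p =
    ≅-trans (≡⇒≅ (eq₁ a b)) (≅-trans (≅-+ p (≅-refl {b})) (≡⇒≅ (ℤₚ.+-identityˡ b)))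
    where
    eq₁ : ∀ a b → a ≡ a - b + b
    eq₁ = solve-∀

  multiple≅0 : ∀ q → q * m ≅ + 0 ⟦ m ⟧
  multiple≅0 q = by q (sym (ℤₚ.+-identityˡ (q * m)))

  ≅0-quot : ∀ {a} (p : a ≅ + 0 ⟦ m ⟧) → a ≡ quot p * m
  ≅0-quot (by q e) = trans e (ℤₚ.+-identityˡ (q * m))

  ≅0-*ˡ : ∀ {a} c → a ≅ + 0 ⟦ m ⟧ → c * a ≅ + 0 ⟦ m ⟧
  ≅0-*ˡ c p = ≅-trans (≅-* (≅-refl {c}) p) (≡⇒≅ (ℤₚ.*-zeroʳ c))

  ≅0-*ʳ : ∀ {a} c → a ≅ + 0 ⟦ m ⟧ → a * c ≅ + 0 ⟦ m ⟧
  ≅0-*ʳ c p = ≅-trans (≅-* p (≅-refl {c})) (≡⇒≅ (ℤₚ.*-zeroˡ c))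

*-unitʳ : ∀ {m a} c → a ≅ + 1 ⟦ m ⟧ → c * a ≅ c ⟦ m ⟧
*-unitʳ c p = ≅-trans (≅-* (≅-refl {a = c}) p) (≡⇒≅ (ℤₚ.*-identityʳ c))

*-unitˡ : ∀ {m a} c → a ≅ + 1 ⟦ m ⟧ → a * c ≅ c ⟦ m ⟧
*-unitˡ c p = ≅-trans (≅-* p (≅-refl {a = c})) (≡⇒≅ (ℤₚ.*-identityˡ c))

≅-weaken : ∀ {a b m} k → a ≅ b ⟦ k * m ⟧ → a ≅ b ⟦ m ⟧
≅-weaken {b = b} {m} k (by q refl) = by (q * k) (cong (λ z → b + z) (sym (ℤₚ.*-assoc q k m)))

≅-scale : ∀ {a b m} k → a ≅ b ⟦ m ⟧ → k * a ≅ k * b ⟦ k * m ⟧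
≅-scale {b = b} {m} k (by q refl) = by q (eq k b q m)
  where
  eq : ∀ k b q m → k * (b + q * m) ≡ k * b + q * (k * m)
  eq = solve-∀

≅-cancel : ∀ {a b m} k .{{_ : ℤ.NonZero k}} → k * a ≅ k * b ⟦ k * m ⟧ → a ≅ b ⟦ m ⟧
≅-cancel {a} {b} {m} k (by q e) =
  by q (ℤₚ.*-cancelˡ-≡ k a (b + q * m) (trans e (eq k b q m)))
  where
  eq : ∀ k b q m → k * b + q * (k * m) ≡ k * (b + q * m)
  eq = solve-∀

≅0-*-* : ∀ {a b m n} → a ≅ + 0 ⟦ m ⟧ → b ≅ + 0 ⟦ n ⟧ → a * b ≅ + 0 ⟦ m * n ⟧
≅0-*-* {m = m} {n} (by q refl) (by r refl) = by (q * r) (eq q r m n)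
  where
  eq : ∀ q r m n → (+ 0 + q * m) * (+ 0 + r * n) ≡ + 0 + q * r * (m * n)
  eq = solve-∀

-- Powers of ℓ and compatible sequences.

pw-suc : ∀ ℓ n → pw ℓ (suc n) ≡ + ℓ * pw ℓ n
pw-suc ℓ n = ℤₚ.pos-* ℓ (ℓ ℕ.^ n)

pw-+ : ∀ ℓ m n → pw ℓ (m ℕ.+ n) ≡ pw ℓ m * pw ℓ n
pw-+ ℓ m n = trans (cong +_ (ℕₚ.^-distribˡ-+-* ℓ m n)) (ℤₚ.pos-* (ℓ ℕ.^ m) (ℓ ℕ.^ n))

pw-1 : ∀ ℓ → pw ℓ 1 ≡ + ℓ
pw-1 ℓ = cong +_ (ℕₚ.^-identityʳ ℓ)

pw-nonZero : ∀ ℓ .{{_ : ℕ.NonZero ℓ}} n → ℤ.NonZero (pw ℓ n)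
pw-nonZero ℓ n = ℕₚ.m^n≢0 ℓ n

module _ {ℓ : ℕ} where

  ≅-pw-≤ : ∀ {a b m n} → m ≤ n → a ≅ b ⟦ pw ℓ n ⟧ → a ≅ b ⟦ pw ℓ m ⟧
  ≅-pw-≤ {a} {b} {m} {n} m≤n p =
    ≅-weaken (pw ℓ (n ℕ.∸ m))
      (subst (a ≅ b ⟦_⟧) (trans (cong (pw ℓ) (sym (ℕₚ.m∸n+n≡m m≤n))) (pw-+ ℓ (n ℕ.∸ m) m)) p)

  ≅-pw-0 : ∀ {a b} → a ≅ b ⟦ pw ℓ 0 ⟧
  ≅-pw-0 {a} {b} = by (a - b) (eq a b)
    where
    eq : ∀ a b → a ≡ b + (a - b) * + 1
    eq = solve-∀

  compat-≤ : ∀ {a : ZSeq} → CompatZ ℓ a → ∀ {m n} → m ≤ n → a n ≅ a m ⟦ pw ℓ m ⟧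
  compat-≤ {a} c {m} m≤n = go (ℕₚ.≤⇒≤′ m≤n)
    where
    go : ∀ {n} → m ℕ.≤′ n → a n ≅ a m ⟦ pw ℓ m ⟧
    go ℕ.≤′-refl = ≅-refl
    go (ℕ.≤′-step {n} m≤′n) = ≅-trans (≅-pw-≤ (ℕₚ.≤′⇒≤ m≤′n) (from-mod (c n))) (go m≤′n)

-- Parity as a ring homomorphism to F₂.

par : ℤ → Bool
par a with a ℤ/.%ℕ 2
... | zero  = false
... | suc _ = true

≅-par : ∀ a → a ≅ b2z (par a) ⟦ + 2 ⟧
≅-par a with a ℤ/.%ℕ 2 | ℤ/.n%ℕd<d a 2 | ℤ/.a≡a%ℕn+[a/ℕn]*n a 2
... | 0 | _ | eq = by (a ℤ/./ℕ 2) eq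
... | 1 | _ | eq = by (a ℤ/./ℕ 2) eq
... | suc (suc _) | s≤s (s≤s ()) | _

2∤1 : ¬ (2 ℕ∣.∣ 1)
2∤1 d with ℕ∣.∣⇒≤ d
... | s≤s ()

b2z-injective : ∀ x y → b2z x ≅ b2z y ⟦ + 2 ⟧ → x ≡ y
b2z-injective false false _ = refl
b2z-injective false true  p = ⊥-elim (2∤1 (to-mod p))
b2z-injective true  false p = ⊥-elim (2∤1 (to-mod p))
b2z-injective true  true  _ = refl

par-unique : ∀ {a} b → a ≅ b2z b ⟦ + 2 ⟧ → par a ≡ b
par-unique {a} b p = b2z-injective (par a) b (≅-trans (≅-sym (≅-par a)) p)

par-cong : ∀ {a b} → a ≅ b ⟦ + 2 ⟧ → par a ≡ par b
par-cong {b = b} p = par-unique _ (≅-trans p (≅-par b))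

par-injective : ∀ {a b} → par a ≡ par b → a ≅ b ⟦ + 2 ⟧
par-injective {a} {b} e = ≅-trans (≅-par a) (≅-trans (≡⇒≅ (cong b2z e)) (≅-sym (≅-par b)))

b2z-+ : ∀ x y → b2z x + b2z y ≅ b2z (x xor y) ⟦ + 2 ⟧
b2z-+ false false = ≅-refl
b2z-+ false true  = ≅-refl
b2z-+ true  false = ≅-refl
b2z-+ true  true  = by (+ 1) refl

b2z-* : ∀ x y → b2z x * b2z y ≡ b2z (x ∧ y)
b2z-* false false = refl
b2z-* false true  = refl
b2z-* true  false = refl
b2z-* true  true  = refl

par-+ : ∀ a b → par (a + b) ≡ par a xor par b
par-+ a b = par-unique _ (≅-trans (≅-+ (≅-par a) (≅-par b)) (b2z-+ (par a) (par b)))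

par-* : ∀ a b → par (a * b) ≡ par a ∧ par b
par-* a b = par-unique _ (≅-trans (≅-* (≅-par a) (≅-par b)) (≡⇒≅ (b2z-* (par a) (par b))))

-- Integer vectors, the chain of `ρ`, and the radical of the Iwahori order.

record ℤ⁴ : Set where
  constructor ⟨_,_,_,_⟩
  field
    x₁ x₂ x₃ x₄ : ℤ

open ℤ⁴ public

⟨⟩-cong : ∀ {a b c d a' b' c' d'} → a ≡ a' → b ≡ b' → c ≡ c' → d ≡ d'
        → ⟨ a , b , c , d ⟩ ≡ ⟨ a' , b' , c' , d' ⟩
⟨⟩-cong refl refl refl refl = refl

infixl 6 _⊞_
infixr 7 _⊡_

_⊞_ : ℤ⁴ → ℤ⁴ → ℤ⁴
⟨ a , b , c , d ⟩ ⊞ ⟨ a' , b' , c' , d' ⟩ = ⟨ a + a' , b + b' , c + c' , d + d' ⟩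

_⊡_ : ℤ → ℤ⁴ → ℤ⁴
k ⊡ ⟨ a , b , c , d ⟩ = ⟨ k * a , k * b , k * c , k * d ⟩

-- T ⊃ ρT ⊃ ρ²T ⊃ ρ³T ⊃ ρ⁴T = 2T is the chain of lattices stable under the
-- pro-2 Iwahori subgroup.
ρ : ℤ⁴ → ℤ⁴
ρ ⟨ a , b , c , d ⟩ = ⟨ + 2 * d , a , b , c ⟩

ρ^ : ℕ → ℤ⁴ → ℤ⁴
ρ^ zero    v = v
ρ^ (suc m) v = ρ (ρ^ m v)

ρ-⊞ : ∀ u v → ρ (u ⊞ v) ≡ ρ u ⊞ ρ v
ρ-⊞ u v = ⟨⟩-cong (ℤₚ.*-distribˡ-+ (+ 2) (x₄ u) (x₄ v)) refl refl refl

ρ-⊡ : ∀ k v → ρ (k ⊡ v) ≡ k ⊡ ρ v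
ρ-⊡ k v = ⟨⟩-cong (swap k (x₄ v)) refl refl refl
  where
  swap : ∀ k d → + 2 * (k * d) ≡ k * (+ 2 * d)
  swap = solve-∀

succ₄ : Fin 4 → Fin 4
succ₄ 0F = 1F
succ₄ 1F = 2F
succ₄ 2F = 3F
succ₄ 3F = 0F

-- The matrix with entries a_ij below the diagonal and 2a_ij elsewhere: the
-- general element of the radical of the Iwahori order.
act : Mat4 → ℤ⁴ → ℤ⁴
act a ⟨ x , y , z , w ⟩ =
  ⟨ + 2 * (a 0F 0F * x + a 0F 1F * y + a 0F 2F * z + a 0F 3F * w)
  , a 1F 0F * x + + 2 * (a 1F 1F * y + a 1F 2F * z + a 1F 3F * w)
  , a 2F 0F * x + a 2F 1F * y + + 2 * (a 2F 2F * z + a 2F 3F * w)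
  , a 3F 0F * x + a 3F 1F * y + a 3F 2F * z + + 2 * (a 3F 3F * w) ⟩

rotate : Mat4 → Mat4
rotate a i j = a (succ₄ i) (succ₄ j)

-- `ρ` moves the basis vectors cyclically, e₄ going to 2e₁, so conjugation by it shifts both indices
-- by one. Because the entries on and above the diagonal are stored halved, the parameters move
-- without rescaling: the factor 2 of the wrap-around is exactly the one that the new position calls
-- for.
act-rotate : ∀ a v → act a (ρ v) ≡ ρ (act (rotate a) v)
act-rotate a ⟨ x , y , z , w ⟩ =
  ⟨⟩-cong (e₁ (a 0F 0F) (a 0F 1F) (a 0F 2F) (a 0F 3F) x y z w)
          (e₂ (a 1F 0F) (a 1F 1F) (a 1F 2F) (a 1F 3F) x y z w)
          (e₃ (a 2F 0F) (a 2F 1F) (a 2F 2F) (a 2F 3F) x y z w)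
          (e₄ (a 3F 0F) (a 3F 1F) (a 3F 2F) (a 3F 3F) x y z w)
  where
  e₁ : ∀ p q r s x y z w → + 2 * (p * (+ 2 * w) + q * x + r * y + s * z)
                         ≡ + 2 * (q * x + r * y + s * z + + 2 * (p * w))
  e₁ = solve-∀
  e₂ : ∀ p q r s x y z w → p * (+ 2 * w) + + 2 * (q * x + r * y + s * z)
                         ≡ + 2 * (q * x + r * y + s * z + p * w)
  e₂ = solve-∀
  e₃ : ∀ p q r s x y z w → p * (+ 2 * w) + q * x + + 2 * (r * y + s * z)
                         ≡ q * x + + 2 * (r * y + s * z + p * w)
  e₃ = solve-∀
  e₄ : ∀ p q r s x y z w → p * (+ 2 * w) + q * x + r * y + + 2 * (s * z)
                         ≡ q * x + r * y + + 2 * (s * z + p * w)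
  e₄ = solve-∀

Odd : ℤ → Set
Odd a = a ≅ + 1 ⟦ + 2 ⟧

Even : ℤ → Set
Even a = a ≅ + 0 ⟦ + 2 ⟧

double-even : ∀ a → Even (+ 2 * a)
double-even a = by a (eq a)
  where
  eq : ∀ a → + 2 * a ≡ + 0 + a * + 2
  eq = solve-∀

odd-* : ∀ {a b} → Odd a → Odd b → Odd (a * b)
odd-* p q = ≅-* p q

act₁ : ∀ a v → Even (x₁ (act a v))
act₁ a v = double-even _

act₂ : ∀ a v → x₂ (act a v) ≅ a 1F 0F * x₁ v ⟦ + 2 ⟧
act₂ a v = ≅-trans (≅-+ (≅-refl {a = a 1F 0F * x₁ v}) (double-even _)) (≡⇒≅ (ℤₚ.+-identityʳ _))

act₃ : ∀ a v → x₃ (act a v) ≅ a 2F 0F * x₁ v + a 2F 1F * x₂ v ⟦ + 2 ⟧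
act₃ a v = ≅-trans (≅-+ (≅-refl {a = a 2F 0F * x₁ v + a 2F 1F * x₂ v}) (double-even _)) (≡⇒≅ (ℤₚ.+-identityʳ _))

act₄ : ∀ a v → x₄ (act a v) ≅ a 3F 0F * x₁ v + a 3F 1F * x₂ v + a 3F 2F * x₃ v ⟦ + 2 ⟧
act₄ a v = ≅-trans (≅-+ (≅-refl {a = a 3F 0F * x₁ v + a 3F 1F * x₂ v + a 3F 2F * x₃ v}) (double-even _)) (≡⇒≅ (ℤₚ.+-identityʳ _))

-- Forward substitution modulo 2. The coefficients of `y`, `z`, `w` may be any integers, since these
-- vectors will lie in Λ'; that of `x` is what survives modulo Λ', so it is normalised to depend on
-- the parity of `x₁ u` alone.
span-mod-2 : ∀ x y z w → Odd (x₁ x)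
  → Even (x₁ y) → Odd (x₂ y)
  → Even (x₁ z) → Even (x₂ z) → Odd (x₃ z)
  → Even (x₁ w) → Even (x₂ w) → Even (x₃ w) → Odd (x₄ w)
  → ∀ u → ∃ λ d → ∃ λ e → ∃ λ h → ∃ λ u' →
      u ≡ b2z (par (x₁ u)) ⊡ x ⊞ (d ⊡ y ⊞ e ⊡ z ⊞ h ⊡ w ⊞ + 2 ⊡ u')
span-mod-2 x y z w x1 y1 y2 z1 z2 z3 w1 w2 w3 w4 u =
  d , e , h , ⟨ quot q₁ , quot q₂ , quot q₃ , quot q₄ ⟩ ,
  ⟨⟩-cong (use (x₁ u) (x₁ x) (x₁ y) (x₁ z) (x₁ w) q₁) (use (x₂ u) (x₂ x) (x₂ y) (x₂ z) (x₂ w) q₂)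
          (use (x₃ u) (x₃ x) (x₃ y) (x₃ z) (x₃ w) q₃) (use (x₄ u) (x₄ x) (x₄ y) (x₄ z) (x₄ w) q₄)
  where
  c = b2z (par (x₁ u))
  d = x₂ u - c * x₂ x
  e = x₃ u - c * x₃ x - d * x₃ y
  h = x₄ u - c * x₄ x - d * x₄ y - e * x₄ z

  comb : ∀ {a a' b b' p p' q q' t t'} → a ≅ a' ⟦ + 2 ⟧ → b ≅ b' ⟦ + 2 ⟧ → p ≅ p' ⟦ + 2 ⟧
       → q ≅ q' ⟦ + 2 ⟧ → t ≅ t' ⟦ + 2 ⟧
       → a - (c * b + (d * p + e * q + h * t)) ≅ a' - (c * b' + (d * p' + e * q' + h * t')) ⟦ + 2 ⟧
  comb pa pb pp pq pt =
    ≅-minus pa (≅-+ (≅-* (≅-refl {a = c}) pb)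
      (≅-+ (≅-+ (≅-* (≅-refl {a = d}) pp) (≅-* (≅-refl {a = e}) pq)) (≅-* (≅-refl {a = h}) pt)))

  s₁ : ∀ c d e h → c - (c * + 1 + (d * + 0 + e * + 0 + h * + 0)) ≡ + 0
  s₁ = solve-∀
  s₂ : ∀ u c b e h → u - (c * b + ((u - c * b) * + 1 + e * + 0 + h * + 0)) ≡ + 0
  s₂ = solve-∀
  s₃ : ∀ u c b d p h → u - (c * b + (d * p + (u - c * b - d * p) * + 1 + h * + 0)) ≡ + 0
  s₃ = solve-∀
  s₄ : ∀ u c b d p e q → u - (c * b + (d * p + e * q + (u - c * b - d * p - e * q) * + 1)) ≡ + 0
  s₄ = solve-∀

  q₁ = ≅-trans (comb (≅-par (x₁ u)) x1 y1 z1 w1) (≡⇒≅ (s₁ c d e h))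
  q₂ = ≅-trans (comb (≅-refl {a = x₂ u}) (≅-refl {a = x₂ x}) y2 z2 w2) (≡⇒≅ (s₂ (x₂ u) c (x₂ x) e h))
  q₃ = ≅-trans (comb (≅-refl {a = x₃ u}) (≅-refl {a = x₃ x}) (≅-refl {a = x₃ y}) z3 w3)
               (≡⇒≅ (s₃ (x₃ u) c (x₃ x) d (x₃ y) h))
  q₄ = ≅-trans (comb (≅-refl {a = x₄ u}) (≅-refl {a = x₄ x}) (≅-refl {a = x₄ y}) (≅-refl {a = x₄ z}) w4)
               (≡⇒≅ (s₄ (x₄ u) c (x₄ x) d (x₄ y) e (x₄ z)))

  use : ∀ a b p q t → (r : a - (c * b + (d * p + e * q + h * t)) ≅ + 0 ⟦ + 2 ⟧)
      → a ≡ c * b + (d * p + e * q + h * t + + 2 * quot r)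
  use a b p q t r =
    trans (move a (c * b) (d * p + e * q + h * t))
          (trans (cong (λ s → c * b + (d * p + e * q + h * t + s)) (≅0-quot r))
                 (cong (λ s → c * b + (d * p + e * q + h * t + s)) (ℤₚ.*-comm (quot r) (+ 2))))
    where
    move : ∀ a m n → a ≡ m + (n + (a - (m + n)))
    move = solve-∀

-- A trivial action leaves at most two classes.

record IsSubmodule (Λ : ℤ⁴ → Set) : Set where
  field
    add  : ∀ {u v} → Λ u → Λ v → Λ (u ⊞ v)
    smul : ∀ k {u} → Λ u → Λ (k ⊡ u)

open IsSubmodule

-- s₁, s₂, s₃, s₀ are the characters of the Iwahori subgroup read off the
-- positions (2,1), (3,2), (4,3) and (1,4)/2; conjugation by ρ permutes them cyclically.
record ActsTrivially (Λ Λ' : ℤ⁴ → Set) (A₁ A₂ A₃ A₀ : Mat4) : Set where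
  field
    submodule : IsSubmodule Λ'
    inclusion : ∀ {v} → Λ' v → Λ v
    act-A₁ : ∀ {v} → Λ v → Λ' (act A₁ v)
    act-A₂ : ∀ {v} → Λ v → Λ' (act A₂ v)
    act-A₃ : ∀ {v} → Λ v → Λ' (act A₃ v)
    act-A₀ : ∀ {v} → Λ v → Λ' (act A₀ v)
    double : ∀ {v} → Λ v → Λ' (+ 2 ⊡ v)
    s₁-odd : Odd (A₁ 1F 0F)
    s₂-odd : Odd (A₂ 2F 1F)
    s₃-odd : Odd (A₃ 3F 2F)
    s₀-odd : Odd (A₀ 0F 3F)

-- The shift of indices brings the odd entry of `A₂` from position (3,2) to (2,1), that of `A₃` from
-- (4,3) to (3,2), that of `A₀` from (1,4) to (4,3) and that of `A₁` from (2,1) to (1,4). Hence the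
-- four matrices are passed on in cyclic order.
rotate-ActsTrivially : ∀ {Λ Λ' A₁ A₂ A₃ A₀} → ActsTrivially Λ Λ' A₁ A₂ A₃ A₀
  → ActsTrivially (λ v → Λ (ρ v)) (λ v → Λ' (ρ v)) (rotate A₂) (rotate A₃) (rotate A₀) (rotate A₁)
rotate-ActsTrivially {Λ} {Λ'} {A₁} {A₂} {A₃} {A₀} t = record
  { submodule = record
      { add  = λ {u} {v} p q → subst Λ' (sym (ρ-⊞ u v)) (add submodule p q)
      ; smul = λ k {u} p → subst Λ' (sym (ρ-⊡ k u)) (smul submodule k p) }
  ; inclusion = inclusion
  ; act-A₁ = λ {v} p → subst Λ' (act-rotate A₂ v) (act-A₂ p)
  ; act-A₂ = λ {v} p → subst Λ' (act-rotate A₃ v) (act-A₃ p)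
  ; act-A₃ = λ {v} p → subst Λ' (act-rotate A₀ v) (act-A₀ p)
  ; act-A₀ = λ {v} p → subst Λ' (act-rotate A₁ v) (act-A₁ p)
  ; double = λ {v} p → subst Λ' (sym (ρ-⊡ (+ 2) v)) (double p)
  ; s₁-odd = s₂-odd
  ; s₂-odd = s₃-odd
  ; s₃-odd = s₀-odd
  ; s₀-odd = s₁-odd
  }
  where open ActsTrivially t

-- By Nakayama's lemma, Λ' contains ρℤ⁴ as soon as it contains 2x, y, z, w for
-- vectors x, y, z, w that are unitriangular mod 2.
module _ {Λ' : ℤ⁴ → Set} (submodule : IsSubmodule Λ') {x y z w : ℤ⁴}
         (2x∈Λ' : Λ' (+ 2 ⊡ x)) (y∈Λ' : Λ' y) (z∈Λ' : Λ' z) (w∈Λ' : Λ' w)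
         (x₁-odd : Odd (x₁ x))
         (y₁-even : Even (x₁ y)) (y₂-odd : Odd (x₂ y))
         (z₁-even : Even (x₁ z)) (z₂-even : Even (x₂ z)) (z₃-odd : Odd (x₃ z))
         (w₁-even : Even (x₁ w)) (w₂-even : Even (x₂ w)) (w₃-even : Even (x₃ w)) (w₄-odd : Odd (x₄ w)) where

  decompose : ∀ u → ∃ λ v → ∃ λ u' → Λ' v × (u ≡ b2z (par (x₁ u)) ⊡ x ⊞ (v ⊞ + 2 ⊡ u'))
  decompose u =
    let d , e , h , u' , eq = span-mod-2 x y z w x₁-odd y₁-even y₂-odd z₁-even z₂-even z₃-odd
                                         w₁-even w₂-even w₃-even w₄-odd u
    in d ⊡ y ⊞ e ⊡ z ⊞ h ⊡ w , u' ,
       add submodule (add submodule (smul submodule d y∈Λ') (smul submodule e z∈Λ'))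
                     (smul submodule h w∈Λ') , eq

  private
    distrib : ∀ k c x v u → k ⊡ (c ⊡ x ⊞ (v ⊞ + 2 ⊡ u)) ≡ (k * c) ⊡ x ⊞ (k ⊡ v ⊞ (k * + 2) ⊡ u)
    distrib k c ⟨ a₁ , a₂ , a₃ , a₄ ⟩ ⟨ b₁ , b₂ , b₃ , b₄ ⟩ ⟨ d₁ , d₂ , d₃ , d₄ ⟩ =
      ⟨⟩-cong (s k c a₁ b₁ d₁) (s k c a₂ b₂ d₂) (s k c a₃ b₃ d₃) (s k c a₄ b₄ d₄)
      where
      s : ∀ k c x v u → k * (c * x + (v + + 2 * u)) ≡ k * c * x + (k * v + k * + 2 * u)
      s = solve-∀

    reassoc : ∀ k c x → (+ 2 * k * c) ⊡ x ≡ (k * c) ⊡ (+ 2 ⊡ x)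
    reassoc k c x = ⟨⟩-cong (s k c (x₁ x)) (s k c (x₂ x)) (s k c (x₃ x)) (s k c (x₄ x))
      where
      s : ∀ k c x → + 2 * k * c * x ≡ k * c * (+ 2 * x)
      s = solve-∀

  -- After substitution of the decomposition of `v`, the first term is a multiple of 2x, the second
  -- lies in Λ', and the remainder carries a further factor 2, so that the hypothesis applies to it.
  double∈-step : ∀ k → (∀ v → Λ' ((+ 2 * k * + 2) ⊡ v)) → ∀ v → Λ' ((+ 2 * k) ⊡ v)
  double∈-step k p v =
    let l , v' , l∈Λ' , eq = decompose v
        c = b2z (par (x₁ v))
    in subst Λ' (sym (trans (cong ((+ 2 * k) ⊡_) eq) (distrib (+ 2 * k) c x l v')))
         (add submodule {(+ 2 * k * c) ⊡ x}
           (subst Λ' (sym (reassoc k c x)) (smul submodule (k * c) 2x∈Λ'))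
           (add submodule {(+ 2 * k) ⊡ l} (smul submodule (+ 2 * k) l∈Λ') (p v')))

  -- Downward induction from 2^n to 2. It cannot go on to 1: without the factor 2 the term in `x` is
  -- no longer a multiple of 2x.
  double∈ : ∀ n → (∀ v → Λ' (pw 2 n ⊡ v)) → ∀ v → Λ' (+ 2 ⊡ v)
  double∈ zero p v = subst (λ c → Λ' (+ 2 ⊡ c)) (unit v) (smul submodule (+ 2) (p v))
    where
    unit : ∀ v → + 1 ⊡ v ≡ v
    unit v = ⟨⟩-cong (ℤₚ.*-identityˡ _) (ℤₚ.*-identityˡ _) (ℤₚ.*-identityˡ _) (ℤₚ.*-identityˡ _)
  double∈ (suc zero) p = p
  double∈ (suc (suc n)) p = double∈ (suc n) λ v →
    subst (λ k → Λ' (k ⊡ v)) (sym (pw-suc 2 n))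
      (double∈-step (pw 2 n) (λ u → subst (λ k → Λ' (k ⊡ u)) pw-suc-suc (p u)) v)
    where
    pw-suc-suc : pw 2 (suc (suc n)) ≡ + 2 * pw 2 n * + 2
    pw-suc-suc = trans (pw-suc 2 (suc n)) (trans (ℤₚ.*-comm (+ 2) (pw 2 (suc n))) (cong (_* + 2) (pw-suc 2 n)))

  private
    cancel : ∀ c x l u' m v' → (c ⊡ x ⊞ (l ⊞ + 2 ⊡ u')) ⊞ - (+ 1) ⊡ (c ⊡ x ⊞ (m ⊞ + 2 ⊡ v'))
           ≡ (l ⊞ + 2 ⊡ u') ⊞ - (+ 1) ⊡ (m ⊞ + 2 ⊡ v')
    cancel c ⟨ a₁ , a₂ , a₃ , a₄ ⟩ ⟨ l₁ , l₂ , l₃ , l₄ ⟩ ⟨ u₁ , u₂ , u₃ , u₄ ⟩ ⟨ m₁ , m₂ , m₃ , m₄ ⟩ ⟨ v₁ , v₂ , v₃ , v₄ ⟩ =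
      ⟨⟩-cong (s c a₁ l₁ u₁ m₁ v₁) (s c a₂ l₂ u₂ m₂ v₂) (s c a₃ l₃ u₃ m₃ v₃) (s c a₄ l₄ u₄ m₄ v₄)
      where
      s : ∀ c x l u m v → (c * x + (l + + 2 * u)) + - (+ 1) * (c * x + (m + + 2 * v))
                        ≡ (l + + 2 * u) + - (+ 1) * (m + + 2 * v)
      s = solve-∀

    difference : ∀ {u v c c' l u' m v'} → (∀ v → Λ' (+ 2 ⊡ v)) → c ≡ c'
      → u ≡ c ⊡ x ⊞ (l ⊞ + 2 ⊡ u') → v ≡ c' ⊡ x ⊞ (m ⊞ + 2 ⊡ v') → Λ' l → Λ' m
      → Λ' (u ⊞ - (+ 1) ⊡ v)
    difference {c = c} {l = l} {u'} {m} {v'} 2∈Λ' refl refl refl l∈Λ' m∈Λ' =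
      subst Λ' (sym (cancel c x l u' m v'))
        (add submodule {l ⊞ + 2 ⊡ u'} (add submodule l∈Λ' (2∈Λ' u'))
          (smul submodule (- (+ 1)) {m ⊞ + 2 ⊡ v'} (add submodule m∈Λ' (2∈Λ' v'))))

  same-parity : ∀ n → (∀ v → Λ' (pw 2 n ⊡ v))
    → ∀ u v → par (x₁ u) ≡ par (x₁ v) → Λ' (u ⊞ - (+ 1) ⊡ v)
  same-parity n p u v same =
    let _ , _ , l∈Λ' , eq  = decompose u
        _ , _ , m∈Λ' , eq' = decompose v
    in difference (double∈ n p) (cong b2z same) eq eq' l∈Λ' m∈Λ'

module _ {Λ Λ' : ℤ⁴ → Set} {A₁ A₂ A₃ A₀ : Mat4} (t : ActsTrivially Λ Λ' A₁ A₂ A₃ A₀)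
         {x : ℤ⁴} (x∈Λ : Λ x) (x-odd : Odd (x₁ x)) where

  open ActsTrivially t

  private
    y = act A₁ x
    z = act A₂ y
    w = act A₃ z

    y₂-odd : Odd (x₂ y)
    y₂-odd = ≅-trans (act₂ A₁ x) (odd-* s₁-odd x-odd)
    z₂-even : Even (x₂ z)
    z₂-even = ≅-trans (act₂ A₂ y) (≅0-*ˡ (A₂ 1F 0F) (act₁ A₁ x))
    z₃-odd : Odd (x₃ z)
    z₃-odd = ≅-trans (act₃ A₂ y) (≅-+ (≅0-*ˡ (A₂ 2F 0F) (act₁ A₁ x)) (odd-* s₂-odd y₂-odd))
    w₂-even : Even (x₂ w)
    w₂-even = ≅-trans (act₂ A₃ z) (≅0-*ˡ (A₃ 1F 0F) (act₁ A₂ y))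
    w₃-even : Even (x₃ w)
    w₃-even = ≅-trans (act₃ A₃ z) (≅-+ (≅0-*ˡ (A₃ 2F 0F) (act₁ A₂ y)) (≅0-*ˡ (A₃ 2F 1F) z₂-even))
    w₄-odd : Odd (x₄ w)
    w₄-odd = ≅-trans (act₄ A₃ z)
      (≅-+ (≅-+ (≅0-*ˡ (A₃ 3F 0F) (act₁ A₂ y)) (≅0-*ˡ (A₃ 3F 1F) z₂-even)) (odd-* s₃-odd z₃-odd))

  -- Each application of an `act` pushes the leading odd coordinate down by one place, which gives
  -- the triangular shape required by `same-parity`. Every image lies in Λ', and `inclusion` returns
  -- it to Λ so that the next matrix can be applied.
  congruent-mod-Λ' : ∀ n → (∀ v → Λ' (pw 2 n ⊡ v))
    → ∀ u v → par (x₁ u) ≡ par (x₁ v) → Λ' (u ⊞ - (+ 1) ⊡ v)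
  congruent-mod-Λ' =
    same-parity submodule {x} {y} {z} {w} (double x∈Λ)
      (act-A₁ x∈Λ) (act-A₂ (inclusion (act-A₁ x∈Λ))) (act-A₃ (inclusion (act-A₂ (inclusion (act-A₁ x∈Λ)))))
      x-odd (act₁ A₁ x) y₂-odd (act₁ A₂ y) z₂-even z₃-odd (act₁ A₃ z) w₂-even w₃-even w₄-odd

pigeonhole : ∀ (a b c : Bool) → (a ≡ b) ⊎ (a ≡ c) ⊎ (b ≡ c)
pigeonhole false false _     = inj₁ refl
pigeonhole true  true  _     = inj₁ refl
pigeonhole false true  false = inj₂ (inj₁ refl)
pigeonhole true  false true  = inj₂ (inj₁ refl)
pigeonhole false true  true  = inj₂ (inj₂ refl)
pigeonhole true  false false = inj₂ (inj₂ refl)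

even-or-odd : ∀ a → Even a ⊎ Odd a
even-or-odd a with par a | ≅-par a
... | false | p = inj₁ p
... | true  | p = inj₂ p

ρ-surjective-on-even : ∀ u → Even (x₁ u) → ∃ λ v → u ≡ ρ v
ρ-surjective-on-even ⟨ a , b , c , d ⟩ p =
  ⟨ b , c , d , quot p ⟩ , cong (λ z → ⟨ z , b , c , d ⟩) (trans (≅0-quot p) (ℤₚ.*-comm (quot p) (+ 2)))

ρ-minus : ∀ u v → ρ (u ⊞ - (+ 1) ⊡ v) ≡ ρ u ⊞ - (+ 1) ⊡ ρ v
ρ-minus u v = trans (ρ-⊞ u (- (+ 1) ⊡ v)) (cong (ρ u ⊞_) (ρ-⊡ (- (+ 1)) v))

-- A quotient of order at most 2, in the form that contradicts four distinct representatives.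
TwoCongruent : (ℤ⁴ → Set) → ℤ⁴ → ℤ⁴ → ℤ⁴ → Set
TwoCongruent Λ' u v w = Λ' (u ⊞ - (+ 1) ⊡ v) ⊎ Λ' (u ⊞ - (+ 1) ⊡ w) ⊎ Λ' (v ⊞ - (+ 1) ⊡ w)

TwoCongruent-ρ : ∀ {Λ'} u v w → TwoCongruent (λ v → Λ' (ρ v)) u v w → TwoCongruent Λ' (ρ u) (ρ v) (ρ w)
TwoCongruent-ρ {Λ'} u v w (inj₁ r)        = inj₁ (subst Λ' (ρ-minus u v) r)
TwoCongruent-ρ {Λ'} u v w (inj₂ (inj₁ r)) = inj₂ (inj₁ (subst Λ' (ρ-minus u w) r))
TwoCongruent-ρ {Λ'} u v w (inj₂ (inj₂ r)) = inj₂ (inj₂ (subst Λ' (ρ-minus v w) r))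

-- Induction along the chain. If Λ has a vector with odd first coordinate, only two classes remain.
-- Otherwise Λ lies in ρℤ⁴, and pulling back along `ρ` lowers the bound `m`. At `m` = 0 the second
-- case is impossible, as Λ' is then all of ℤ⁴ and contains e₁. The case distinction asks for a
-- vector in an arbitrary predicate, which is why it goes through `lem`.
no-three-classes : ((P : Set) → Dec P) → ∀ {Λ Λ' A₁ A₂ A₃ A₀} → ActsTrivially Λ Λ' A₁ A₂ A₃ A₀
  → ∀ n → (∀ v → Λ' (pw 2 n ⊡ v)) → ∀ m → (∀ v → Λ' (ρ^ m v))
  → ∀ u v w → Λ u → Λ v → Λ w → TwoCongruent Λ' u v w
no-three-classes lem {Λ} {Λ'} t n p m q u v w u∈ v∈ w∈ = split (lem (∃ λ x → Λ x × Odd (x₁ x))) m q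
  where
  split : Dec (∃ λ x → Λ x × Odd (x₁ x)) → ∀ m → (∀ v → Λ' (ρ^ m v)) → TwoCongruent Λ' u v w
  split (yes (x , x∈ , x-odd)) _ _ =
    [ (λ e → inj₁ (congruent-mod-Λ' t x∈ x-odd n p u v e))
    , [ (λ e → inj₂ (inj₁ (congruent-mod-Λ' t x∈ x-odd n p u w e)))
      , (λ e → inj₂ (inj₂ (congruent-mod-Λ' t x∈ x-odd n p v w e))) ]′ ]′
    (pigeonhole (par (x₁ u)) (par (x₁ v)) (par (x₁ w)))
  split (no none) zero q =
    ⊥-elim (none (⟨ + 1 , + 0 , + 0 , + 0 ⟩ , ActsTrivially.inclusion t (q _) , ≅-refl))
  split (no none) (suc m) q =
    let u' , eu = halve u u∈
        v' , ev = halve v v∈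
        w' , ew = halve w w∈
    in subst (λ u → TwoCongruent Λ' u v w) (sym eu) (subst (λ v → TwoCongruent Λ' (ρ u') v w) (sym ev)
         (subst (TwoCongruent Λ' (ρ u') (ρ v')) (sym ew) (TwoCongruent-ρ {Λ'} u' v' w'
           (no-three-classes lem (rotate-ActsTrivially t) n
             (λ v → subst Λ' (sym (ρ-⊡ (pw 2 n) v)) (p (ρ v))) m q u' v' w'
             (subst Λ eu u∈) (subst Λ ev v∈) (subst Λ ew w∈)))))
    where
    halve : ∀ u → Λ u → ∃ λ v → u ≡ ρ v
    halve u u∈ = [ ρ-surjective-on-even u , (λ o → ⊥-elim (none (u , u∈ , o))) ]′ (even-or-odd (x₁ u))

-- Four steps of the chain are multiplication by 2. This turns the inclusion of 2^N ℤ⁴ in Λ' into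
-- the bound on which `no-three-classes` recurses.
ρ^-pw : ∀ n v → ρ^ (n ℕ.* 4) v ≡ pw 2 n ⊡ v
ρ^-pw zero    v = sym (⟨⟩-cong (ℤₚ.*-identityˡ _) (ℤₚ.*-identityˡ _) (ℤₚ.*-identityˡ _) (ℤₚ.*-identityˡ _))
ρ^-pw (suc n) v =
  trans (cong (+ 2 ⊡_) (ρ^-pw n v))
        (trans (⟨⟩-cong (assoc _) (assoc _) (assoc _) (assoc _)) (cong (_⊡ v) (sym (pw-suc 2 n))))
  where
  assoc : ∀ a → + 2 * (pw 2 n * a) ≡ + 2 * pw 2 n * a
  assoc a = sym (ℤₚ.*-assoc (+ 2) (pw 2 n) a)

-- Finite sums and matrix algebra modulo m.

sumFin-≡ : ∀ n {f g : Fin n → ℤ} → (∀ i → f i ≡ g i) → sumFin n f ≡ sumFin n g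
sumFin-≡ zero    p = refl
sumFin-≡ (suc n) p = cong₂ _+_ (p zero) (sumFin-≡ n (λ i → p (suc i)))

sumFin-≅ : ∀ {m} n {f g : Fin n → ℤ} → (∀ i → f i ≅ g i ⟦ m ⟧) → sumFin n f ≅ sumFin n g ⟦ m ⟧
sumFin-≅ zero    p = ≅-refl
sumFin-≅ (suc n) p = ≅-+ (p zero) (sumFin-≅ n (λ i → p (suc i)))

sumFin-≅0 : ∀ {m} n {f : Fin n → ℤ} → (∀ i → f i ≅ + 0 ⟦ m ⟧) → sumFin n f ≅ + 0 ⟦ m ⟧
sumFin-≅0 zero    p = ≅-refl
sumFin-≅0 (suc n) p = ≅-+ (p zero) (sumFin-≅0 n (λ i → p (suc i)))

sumFin-zero : ∀ n → sumFin n (λ _ → + 0) ≡ + 0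
sumFin-zero zero    = refl
sumFin-zero (suc n) = trans (ℤₚ.+-identityˡ _) (sumFin-zero n)

sumFin-+ : ∀ n (f g : Fin n → ℤ) → sumFin n (λ i → f i + g i) ≡ sumFin n f + sumFin n g
sumFin-+ zero    f g = refl
sumFin-+ (suc n) f g =
  trans (cong (λ z → f zero + g zero + z) (sumFin-+ n (λ i → f (suc i)) (λ i → g (suc i))))
        (swap (f zero) (g zero) (sumFin n (λ i → f (suc i))) (sumFin n (λ i → g (suc i))))
  where
  swap : ∀ a b c d → a + b + (c + d) ≡ a + c + (b + d)
  swap = solve-∀

sumFin-*ˡ : ∀ n c (f : Fin n → ℤ) → c * sumFin n f ≡ sumFin n (λ i → c * f i)
sumFin-*ˡ zero    c f = ℤₚ.*-zeroʳ c
sumFin-*ˡ (suc n) c f =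
  trans (ℤₚ.*-distribˡ-+ c (f zero) (sumFin n (λ i → f (suc i))))
        (cong (λ z → c * f zero + z) (sumFin-*ˡ n c (λ i → f (suc i))))

sumFin-*ʳ : ∀ n c (f : Fin n → ℤ) → sumFin n f * c ≡ sumFin n (λ i → f i * c)
sumFin-*ʳ n c f =
  trans (ℤₚ.*-comm (sumFin n f) c) (trans (sumFin-*ˡ n c f) (sumFin-≡ n (λ i → ℤₚ.*-comm c (f i))))

sumFin-swap : ∀ m n (f : Fin m → Fin n → ℤ)
            → sumFin m (λ i → sumFin n (f i)) ≡ sumFin n (λ j → sumFin m (λ i → f i j))
sumFin-swap zero    n f = sym (sumFin-zero n)
sumFin-swap (suc m) n f =
  trans (cong (λ z → sumFin n (f zero) + z) (sumFin-swap m n (λ i → f (suc i))))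
        (sym (sumFin-+ n (f zero) (λ j → sumFin m (λ i → f (suc i) j))))

infix 4 _≊_⟦_⟧

record _≊_⟦_⟧ (A B : Mat4) (m : ℤ) : Set where
  constructor entries
  field
    entry : ∀ i j → A i j ≅ B i j ⟦ m ⟧

open _≊_⟦_⟧ public

I4-symmetric : ∀ i j → I4 i j ≡ I4 j i
I4-symmetric = toWitness {a? = all? λ i → all? λ j → I4 i j ℤ.≟ I4 j i} tt

module _ {m : ℤ} where

  ≡⇒≊ : ∀ {A B} → (∀ i j → A i j ≡ B i j) → A ≊ B ⟦ m ⟧
  ≡⇒≊ p = entries (λ i j → ≡⇒≅ (p i j))

  ≊-refl : ∀ {A} → A ≊ A ⟦ m ⟧
  ≊-refl = entries (λ i j → ≅-refl)

  ≊-sym : ∀ {A B} → A ≊ B ⟦ m ⟧ → B ≊ A ⟦ m ⟧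
  ≊-sym p = entries (λ i j → ≅-sym (entry p i j))

  ≊-trans : ∀ {A B C} → A ≊ B ⟦ m ⟧ → B ≊ C ⟦ m ⟧ → A ≊ C ⟦ m ⟧
  ≊-trans p q = entries (λ i j → ≅-trans (entry p i j) (entry q i j))

  ⊗-cong : ∀ {A A' B B'} → A ≊ A' ⟦ m ⟧ → B ≊ B' ⟦ m ⟧ → A ⊗ B ≊ A' ⊗ B' ⟦ m ⟧
  ⊗-cong {A} {A'} {B} {B'} p q =
    entries (λ i j → sumFin-≅ 4 {λ k → A i k * B k j} {λ k → A' i k * B' k j}
                       (λ k → ≅-* (entry p i k) (entry q k j)))

  ⊗-congˡ : ∀ A {B B'} → B ≊ B' ⟦ m ⟧ → A ⊗ B ≊ A ⊗ B' ⟦ m ⟧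
  ⊗-congˡ A {B} {B'} q = ⊗-cong {A} {A} {B} {B'} ≊-refl q

  ⊗-congʳ : ∀ B {A A'} → A ≊ A' ⟦ m ⟧ → A ⊗ B ≊ A' ⊗ B ⟦ m ⟧
  ⊗-congʳ B {A} {A'} p = ⊗-cong {A} {A'} {B} {B} p ≊-refl

  transpose-cong : ∀ {A B} → A ≊ B ⟦ m ⟧ → transpose A ≊ transpose B ⟦ m ⟧
  transpose-cong p = entries (λ i j → entry p j i)

  ⊗-assoc : ∀ A B C → (A ⊗ B) ⊗ C ≊ A ⊗ (B ⊗ C) ⟦ m ⟧
  ⊗-assoc A B C = ≡⇒≊ λ i j →
    trans (sumFin-≡ 4 {λ k → sumFin 4 (λ l → A i l * B l k) * C k j}
                      {λ k → sumFin 4 (λ l → A i l * B l k * C k j)}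
             (λ k → sumFin-*ʳ 4 (C k j) (λ l → A i l * B l k)))
    (trans (sumFin-swap 4 4 (λ k l → A i l * B l k * C k j))
      (sumFin-≡ 4 {λ l → sumFin 4 (λ k → A i l * B l k * C k j)}
                  {λ l → A i l * sumFin 4 (λ k → B l k * C k j)}
        (λ l → trans (sumFin-≡ 4 {λ k → A i l * B l k * C k j} {λ k → A i l * (B l k * C k j)}
                        (λ k → ℤₚ.*-assoc (A i l) (B l k) (C k j)))
                     (sym (sumFin-*ˡ 4 (A i l) (λ k → B l k * C k j))))))

  transpose-⊗ : ∀ A B → transpose (A ⊗ B) ≊ transpose B ⊗ transpose A ⟦ m ⟧
  transpose-⊗ A B = ≡⇒≊ λ i j →
    sumFin-≡ 4 {λ k → A j k * B k i} {λ k → B k i * A j k} (λ k → ℤₚ.*-comm (A j k) (B k i))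

  ⊗-identityʳ : ∀ A → A ⊗ I4 ≊ A ⟦ m ⟧
  ⊗-identityʳ A = ≡⇒≊ λ
    { i 0F → e₀ (A i 0F) (A i 1F) (A i 2F) (A i 3F)
    ; i 1F → e₁ (A i 0F) (A i 1F) (A i 2F) (A i 3F)
    ; i 2F → e₂ (A i 0F) (A i 1F) (A i 2F) (A i 3F)
    ; i 3F → e₃ (A i 0F) (A i 1F) (A i 2F) (A i 3F) }
    where
    e₀ : ∀ a b c d → a * + 1 + (b * + 0 + (c * + 0 + (d * + 0 + + 0))) ≡ a
    e₀ = solve-∀
    e₁ : ∀ a b c d → a * + 0 + (b * + 1 + (c * + 0 + (d * + 0 + + 0))) ≡ b
    e₁ = solve-∀
    e₂ : ∀ a b c d → a * + 0 + (b * + 0 + (c * + 1 + (d * + 0 + + 0))) ≡ c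
    e₂ = solve-∀
    e₃ : ∀ a b c d → a * + 0 + (b * + 0 + (c * + 0 + (d * + 1 + + 0))) ≡ d
    e₃ = solve-∀

  ⊗-identityˡ : ∀ A → I4 ⊗ A ≊ A ⟦ m ⟧
  ⊗-identityˡ A =
    ≊-trans (≡⇒≊ (λ i j → sumFin-≡ 4 {λ k → I4 i k * A k j} {λ k → A k j * I4 k i} (λ k →
               trans (ℤₚ.*-comm (I4 i k) (A k j)) (cong (A k j *_) (I4-symmetric i k)))))
            (transpose-cong (⊗-identityʳ (transpose A)))

  J⊗Jᵀ : J ⊗ transpose J ≊ I4 ⟦ m ⟧
  J⊗Jᵀ = ≡⇒≊ (toWitness {a? = all? λ i → all? λ j → (J ⊗ transpose J) i j ℤ.≟ I4 i j} tt)

  Jᵀ⊗J : transpose J ⊗ J ≊ I4 ⟦ m ⟧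
  Jᵀ⊗J = ≡⇒≊ (toWitness {a? = all? λ i → all? λ j → (transpose J ⊗ J) i j ℤ.≟ I4 i j} tt)

Mat-setoid : ℤ → Setoid _ _
Mat-setoid m = record
  { Carrier = Mat4
  ; _≈_ = λ A B → A ≊ B ⟦ m ⟧
  ; isEquivalence = record { refl = ≊-refl ; sym = ≊-sym ; trans = ≊-trans }
  }

-- The symplectic form and its adjoint.

form : Mat4 → Mat4
form A = transpose A ⊗ (J ⊗ A)

module _ {m : ℤ} where

  open SetoidReasoning (Mat-setoid m)

  form-⊗ : ∀ A B → form A ≊ J ⟦ m ⟧ → form B ≊ J ⟦ m ⟧ → form (A ⊗ B) ≊ J ⟦ m ⟧
  form-⊗ A B p q = begin
    transpose (A ⊗ B) ⊗ (J ⊗ (A ⊗ B))          ≈⟨ ⊗-cong (transpose-⊗ A B) (≊-sym (⊗-assoc J A B)) ⟩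
    (transpose B ⊗ transpose A) ⊗ ((J ⊗ A) ⊗ B) ≈⟨ ⊗-assoc (transpose B) (transpose A) ((J ⊗ A) ⊗ B) ⟩
    transpose B ⊗ (transpose A ⊗ ((J ⊗ A) ⊗ B)) ≈⟨ ⊗-congˡ (transpose B) (≊-sym (⊗-assoc (transpose A) (J ⊗ A) B)) ⟩
    transpose B ⊗ (form A ⊗ B)                  ≈⟨ ⊗-congˡ (transpose B) (⊗-congʳ B p) ⟩
    transpose B ⊗ (J ⊗ B)                       ≈⟨ q ⟩
    J                                           ∎

  form-I4 : form I4 ≊ J ⟦ m ⟧
  form-I4 = ≊-trans (⊗-congʳ (J ⊗ I4) (≡⇒≊ (λ i j → I4-symmetric j i))) (≊-trans (⊗-identityˡ (J ⊗ I4)) (⊗-identityʳ J))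

-- J⁻¹AᵀJ, because `transpose J` is the inverse of `J`: the adjoint for the symplectic form, hence
-- the inverse of a symplectic matrix.
adjoint : Mat4 → Mat4
adjoint A = transpose J ⊗ (transpose A ⊗ J)

module _ {m : ℤ} where

  open SetoidReasoning (Mat-setoid m)

  adjoint-cong : ∀ {A B} → A ≊ B ⟦ m ⟧ → adjoint A ≊ adjoint B ⟦ m ⟧
  adjoint-cong p = ⊗-congˡ (transpose J) (⊗-congʳ J (transpose-cong p))

  adjoint-inverseˡ : ∀ A → form A ≊ J ⟦ m ⟧ → adjoint A ⊗ A ≊ I4 ⟦ m ⟧
  adjoint-inverseˡ A p = begin
    (transpose J ⊗ (transpose A ⊗ J)) ⊗ A ≈⟨ ⊗-assoc (transpose J) (transpose A ⊗ J) A ⟩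
    transpose J ⊗ ((transpose A ⊗ J) ⊗ A) ≈⟨ ⊗-congˡ (transpose J) (⊗-assoc (transpose A) J A) ⟩
    transpose J ⊗ form A                  ≈⟨ ⊗-congˡ (transpose J) p ⟩
    transpose J ⊗ J                       ≈⟨ Jᵀ⊗J ⟩
    I4                                    ∎

  inverse-unique : ∀ {A B C} → B ⊗ A ≊ I4 ⟦ m ⟧ → A ⊗ C ≊ I4 ⟦ m ⟧ → C ≊ B ⟦ m ⟧
  inverse-unique {A} {B} {C} p q = begin
    C           ≈⟨ ≊-sym (⊗-identityˡ C) ⟩
    I4 ⊗ C      ≈⟨ ⊗-congʳ C (≊-sym p) ⟩
    (B ⊗ A) ⊗ C ≈⟨ ⊗-assoc B A C ⟩
    B ⊗ (A ⊗ C) ≈⟨ ⊗-congˡ B q ⟩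
    B ⊗ I4      ≈⟨ ⊗-identityʳ B ⟩
    B           ∎

  -- The form of the adjoint is Jᵀ(AJAᵀ)J, so it suffices that AJAᵀ = J. This is the right inverse
  -- property in another guise: multiply it by Jᵀ on the right and transpose.
  form-adjoint : ∀ A → A ⊗ adjoint A ≊ I4 ⟦ m ⟧ → form (adjoint A) ≊ J ⟦ m ⟧
  form-adjoint A p = begin
    transpose (adjoint A) ⊗ (J ⊗ adjoint A)      ≈⟨ ⊗-cong adjointᵀ Jadjoint ⟩
    (transpose J ⊗ (A ⊗ J)) ⊗ (transpose A ⊗ J)  ≈⟨ ⊗-assoc (transpose J) (A ⊗ J) (transpose A ⊗ J) ⟩
    transpose J ⊗ ((A ⊗ J) ⊗ (transpose A ⊗ J))  ≈⟨ ⊗-congˡ (transpose J) (≊-sym (⊗-assoc (A ⊗ J) (transpose A) J)) ⟩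
    transpose J ⊗ (((A ⊗ J) ⊗ transpose A) ⊗ J)  ≈⟨ ⊗-congˡ (transpose J) (⊗-congʳ J AJAᵀ) ⟩
    transpose J ⊗ (J ⊗ J)                        ≈⟨ ≊-sym (⊗-assoc (transpose J) J J) ⟩
    (transpose J ⊗ J) ⊗ J                        ≈⟨ ⊗-congʳ J Jᵀ⊗J ⟩
    I4 ⊗ J                                       ≈⟨ ⊗-identityˡ J ⟩
    J                                            ∎
    where
    adjointᵀ : transpose (adjoint A) ≊ transpose J ⊗ (A ⊗ J) ⟦ m ⟧
    adjointᵀ = begin
      transpose (transpose J ⊗ (transpose A ⊗ J)) ≈⟨ transpose-⊗ (transpose J) (transpose A ⊗ J) ⟩
      transpose (transpose A ⊗ J) ⊗ J             ≈⟨ ⊗-congʳ J (transpose-⊗ (transpose A) J) ⟩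
      (transpose J ⊗ A) ⊗ J                       ≈⟨ ⊗-assoc (transpose J) A J ⟩
      transpose J ⊗ (A ⊗ J)                       ∎
    Jadjoint : J ⊗ adjoint A ≊ transpose A ⊗ J ⟦ m ⟧
    Jadjoint = begin
      J ⊗ (transpose J ⊗ (transpose A ⊗ J)) ≈⟨ ≊-sym (⊗-assoc J (transpose J) (transpose A ⊗ J)) ⟩
      (J ⊗ transpose J) ⊗ (transpose A ⊗ J) ≈⟨ ⊗-congʳ (transpose A ⊗ J) J⊗Jᵀ ⟩
      I4 ⊗ (transpose A ⊗ J)                ≈⟨ ⊗-identityˡ (transpose A ⊗ J) ⟩
      transpose A ⊗ J                       ∎
    AJᵀAᵀ : A ⊗ (transpose J ⊗ transpose A) ≊ transpose J ⟦ m ⟧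
    AJᵀAᵀ = begin
      A ⊗ (transpose J ⊗ transpose A)                      ≈⟨ ⊗-congˡ A (≊-sym (⊗-identityʳ (transpose J ⊗ transpose A))) ⟩
      A ⊗ ((transpose J ⊗ transpose A) ⊗ I4)               ≈⟨ ⊗-congˡ A (⊗-congˡ (transpose J ⊗ transpose A) (≊-sym J⊗Jᵀ)) ⟩
      A ⊗ ((transpose J ⊗ transpose A) ⊗ (J ⊗ transpose J)) ≈⟨ ⊗-congˡ A (≊-sym (⊗-assoc (transpose J ⊗ transpose A) J (transpose J))) ⟩
      A ⊗ (((transpose J ⊗ transpose A) ⊗ J) ⊗ transpose J) ≈⟨ ⊗-congˡ A (⊗-congʳ (transpose J) (⊗-assoc (transpose J) (transpose A) J)) ⟩
      A ⊗ (adjoint A ⊗ transpose J)                        ≈⟨ ≊-sym (⊗-assoc A (adjoint A) (transpose J)) ⟩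
      (A ⊗ adjoint A) ⊗ transpose J                        ≈⟨ ⊗-congʳ (transpose J) p ⟩
      I4 ⊗ transpose J                                     ≈⟨ ⊗-identityˡ (transpose J) ⟩
      transpose J                                          ∎
    AJAᵀ : (A ⊗ J) ⊗ transpose A ≊ J ⟦ m ⟧
    AJAᵀ = begin
      (A ⊗ J) ⊗ transpose A                       ≈⟨ ⊗-congʳ (transpose A) (≊-sym (transpose-⊗ (transpose J) (transpose A))) ⟩
      transpose (transpose J ⊗ transpose A) ⊗ transpose A ≈⟨ ≊-sym (transpose-⊗ A (transpose J ⊗ transpose A)) ⟩
      transpose (A ⊗ (transpose J ⊗ transpose A)) ≈⟨ transpose-cong AJᵀAᵀ ⟩
      J                                           ∎

-- Matrices that are lower unitriangular modulo ℓ, and their characters.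

record LowerUnitriangular (ℓ : ℕ) (A : Mat4) : Set where
  field
    upper    : ∀ i j → toℕ i ℕ.< toℕ j → A i j ≅ + 0 ⟦ + ℓ ⟧
    diagonal : ∀ i → A i i ≅ + 1 ⟦ + ℓ ⟧

open LowerUnitriangular public

sum₄-≅ : ∀ {m a a' b b' c c' d d'} → a ≅ a' ⟦ m ⟧ → b ≅ b' ⟦ m ⟧ → c ≅ c' ⟦ m ⟧ → d ≅ d' ⟦ m ⟧
       → a + (b + (c + (d + + 0))) ≅ a' + (b' + (c' + (d' + + 0))) ⟦ m ⟧
sum₄-≅ p q r s = ≅-+ p (≅-+ q (≅-+ r (≅-+ s ≅-refl)))

single-term₀ : ∀ a → a + (+ 0 + (+ 0 + (+ 0 + + 0))) ≡ a
single-term₀ = solve-∀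

single-term₁ : ∀ a → + 0 + (a + (+ 0 + (+ 0 + + 0))) ≡ a
single-term₁ = solve-∀

single-term₂ : ∀ a → + 0 + (+ 0 + (a + (+ 0 + + 0))) ≡ a
single-term₂ = solve-∀

single-term₃ : ∀ a → + 0 + (+ 0 + (+ 0 + (a + + 0))) ≡ a
single-term₃ = solve-∀

module _ {ℓ : ℕ} {A : Mat4} (lt : LowerUnitriangular ℓ A) where

  private
    zero-entry : ∀ {i j} c → toℕ i ℕ.< toℕ j → c * A i j ≅ + 0 ⟦ + ℓ ⟧
    zero-entry {i} {j} c i<j = ≅0-*ˡ c (upper lt i j i<j)

    0<1 : 0 ℕ.< 1
    0<1 = s≤s z≤n
    1<2 : 1 ℕ.< 2
    1<2 = s≤s 0<1
    2<3 : 2 ℕ.< 3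
    2<3 = s≤s 1<2

  -- Back substitution from the last column: modulo ℓ column j has 1 in row j and zeros above it, so
  -- it isolates `x j` once the later coordinates are known to vanish.
  row-cancel : ∀ (x : Vec4) → (∀ j → sumFin 4 (λ k → x k * A k j) ≅ + 0 ⟦ + ℓ ⟧) → ∀ k → x k ≅ + 0 ⟦ + ℓ ⟧
  row-cancel x p = λ { 0F → x0 ; 1F → x1 ; 2F → x2 ; 3F → x3 }
    where
    x3 : x 3F ≅ + 0 ⟦ + ℓ ⟧
    x3 = ≅-trans (≅-sym (≅-trans (sum₄-≅ (zero-entry {0F} {3F} (x 0F) (s≤s z≤n)) (zero-entry {1F} {3F} (x 1F) (s≤s (s≤s z≤n)))
                                        (zero-entry {2F} {3F} (x 2F) 2<3) (*-unitʳ (x 3F) (diagonal lt 3F))) (≡⇒≅ (single-term₃ (x 3F))))) (p 3F)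
    x2 : x 2F ≅ + 0 ⟦ + ℓ ⟧
    x2 = ≅-trans (≅-sym (≅-trans (sum₄-≅ (zero-entry {0F} {2F} (x 0F) (s≤s z≤n)) (zero-entry {1F} {2F} (x 1F) 1<2)
                                        (*-unitʳ (x 2F) (diagonal lt 2F)) (≅0-*ʳ (A 3F 2F) x3)) (≡⇒≅ (single-term₂ (x 2F))))) (p 2F)
    x1 : x 1F ≅ + 0 ⟦ + ℓ ⟧
    x1 = ≅-trans (≅-sym (≅-trans (sum₄-≅ (zero-entry {0F} {1F} (x 0F) 0<1) (*-unitʳ (x 1F) (diagonal lt 1F))
                                        (≅0-*ʳ (A 2F 1F) x2) (≅0-*ʳ (A 3F 1F) x3)) (≡⇒≅ (single-term₁ (x 1F))))) (p 1F)
    x0 : x 0F ≅ + 0 ⟦ + ℓ ⟧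
    x0 = ≅-trans (≅-sym (≅-trans (sum₄-≅ (*-unitʳ (x 0F) (diagonal lt 0F)) (≅0-*ʳ (A 1F 0F) x1)
                                        (≅0-*ʳ (A 2F 0F) x2) (≅0-*ʳ (A 3F 0F) x3)) (≡⇒≅ (single-term₀ (x 0F))))) (p 0F)

  -- Induction on the exponent. Once `x` is `pw ℓ m` times some `y`, dividing the relation modulo
  -- `pw ℓ (suc m)` by `pw ℓ m` leaves a relation modulo ℓ for `y`, to which `row-cancel` applies.
  row-cancel-pw : .{{_ : ℕ.NonZero ℓ}} → ∀ (x : Vec4) n → (∀ j → sumFin 4 (λ k → x k * A k j) ≅ + 0 ⟦ pw ℓ n ⟧)
                → ∀ k → x k ≅ + 0 ⟦ pw ℓ n ⟧
  row-cancel-pw x n p = go n ℕₚ.≤-refl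
    where
    go : ∀ m → m ≤ n → ∀ k → x k ≅ + 0 ⟦ pw ℓ m ⟧
    go zero    _   k = ≅-pw-0 {ℓ}
    go (suc m) m<n k =
      subst (x k ≅ + 0 ⟦_⟧) (trans (ℤₚ.*-comm (pw ℓ m) (+ ℓ)) (sym (pw-suc ℓ m)))
        (≅-trans (≡⇒≅ (x≡ k)) (≅-trans (≅-scale (pw ℓ m) (row-cancel y yA≅0 k)) (≡⇒≅ (ℤₚ.*-zeroʳ (pw ℓ m)))))
      where
      x≅0 : ∀ i → x i ≅ + 0 ⟦ pw ℓ m ⟧
      x≅0 = go m (ℕₚ.<⇒≤ m<n)
      y : Vec4
      y i = quot (x≅0 i)
      x≡ : ∀ i → x i ≡ pw ℓ m * y i
      x≡ i = trans (≅0-quot (x≅0 i)) (ℤₚ.*-comm (y i) (pw ℓ m))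
      scale : ∀ j → pw ℓ m * sumFin 4 (λ i → y i * A i j) ≡ sumFin 4 (λ i → x i * A i j)
      scale j = trans (sumFin-*ˡ 4 (pw ℓ m) (λ i → y i * A i j))
        (sumFin-≡ 4 {λ i → pw ℓ m * (y i * A i j)} {λ i → x i * A i j}
          (λ i → trans (sym (ℤₚ.*-assoc (pw ℓ m) (y i) (A i j))) (cong (_* A i j) (sym (x≡ i)))))
      yA≅0 : ∀ j → sumFin 4 (λ i → y i * A i j) ≅ + 0 ⟦ + ℓ ⟧
      yA≅0 j = ≅-cancel (pw ℓ m) {{pw-nonZero ℓ m}}
        (≅-trans (≡⇒≅ (scale j)) (≅-trans
          (subst (sumFin 4 (λ i → x i * A i j) ≅ + 0 ⟦_⟧) (trans (pw-suc ℓ m) (ℤₚ.*-comm (+ ℓ) (pw ℓ m)))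
            (≅-pw-≤ {ℓ} m<n (p j)))
          (≡⇒≅ (sym (ℤₚ.*-zeroʳ (pw ℓ m))))))

  ⊗-cancelʳ : .{{_ : ℕ.NonZero ℓ}} → ∀ {B C} n → B ⊗ A ≊ C ⊗ A ⟦ pw ℓ n ⟧ → B ≊ C ⟦ pw ℓ n ⟧
  ⊗-cancelʳ {B} {C} n p = entries λ i j → minus≅0⇒≅ (row-cancel-pw (λ k → B i k - C i k) n
    (λ j → ≅-trans (≡⇒≅ (difference i j)) (≅⇒minus≅0 (entry p i j))) j)
    where
    distrib : ∀ b c a → (b - c) * a ≡ b * a + - (+ 1) * (c * a)
    distrib = solve-∀
    neg : ∀ a b → a + - (+ 1) * b ≡ a - b
    neg = solve-∀
    difference : ∀ i j → sumFin 4 (λ k → (B i k - C i k) * A k j) ≡ (B ⊗ A) i j - (C ⊗ A) i j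
    difference i j =
      trans (sumFin-≡ 4 {λ k → (B i k - C i k) * A k j} {λ k → B i k * A k j + - (+ 1) * (C i k * A k j)}
               (λ k → distrib (B i k) (C i k) (A k j)))
      (trans (sumFin-+ 4 (λ k → B i k * A k j) (λ k → - (+ 1) * (C i k * A k j)))
      (trans (cong (λ z → (B ⊗ A) i j + z) (sym (sumFin-*ˡ 4 (- (+ 1)) (λ k → C i k * A k j))))
             (neg ((B ⊗ A) i j) ((C ⊗ A) i j))))

  -- The symplectic condition directly makes the adjoint a left inverse. Multiplied by `A` on the
  -- right, both `A ⊗ adjoint A` and `I4` become `A`, and `A` may be cancelled by triangularity.
  adjoint-inverseʳ : .{{_ : ℕ.NonZero ℓ}} → ∀ n → form A ≊ J ⟦ pw ℓ n ⟧ → A ⊗ adjoint A ≊ I4 ⟦ pw ℓ n ⟧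
  adjoint-inverseʳ n p = ⊗-cancelʳ {A ⊗ adjoint A} {I4} n
    (≊-trans (⊗-assoc A (adjoint A) A)
    (≊-trans (⊗-congˡ A (adjoint-inverseˡ A p))
    (≊-trans (⊗-identityʳ A) (≊-sym (⊗-identityˡ A)))))

form-entry : ∀ A i j → form A i j ≡ A 0F i * A 3F j + A 1F i * A 2F j - A 2F i * A 1F j - A 3F i * A 0F j
form-entry A i j = e (A 0F i) (A 1F i) (A 2F i) (A 3F i) (A 0F j) (A 1F j) (A 2F j) (A 3F j)
  where
  e : ∀ a b c d a' b' c' d'
    → a * (+ 0 * a' + (+ 0 * b' + (+ 0 * c' + (+ 1 * d' + + 0))))
    + (b * (+ 0 * a' + (+ 0 * b' + (+ 1 * c' + (+ 0 * d' + + 0))))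
    + (c * (+ 0 * a' + (-[1+ 0 ] * b' + (+ 0 * c' + (+ 0 * d' + + 0))))
    + (d * (-[1+ 0 ] * a' + (+ 0 * b' + (+ 0 * c' + (+ 0 * d' + + 0)))) + + 0)))
    ≡ a * d' + b * c' - c * b' - d * a'
  e = solve-∀

module _ {ℓ : ℕ} {A : Mat4} (lt : LowerUnitriangular ℓ A) where

  -- Modulo ℓ row i of `A` stops at its diagonal 1, and the coordinates of `x` before i vanish.
  -- Applied to columns of a matrix, this serves for products and, in `LowerUnitriangular-inverse`,
  -- for forward substitution.
  leading-term : ∀ (x : Vec4) i → (∀ k → toℕ k ℕ.< toℕ i → x k ≅ + 0 ⟦ + ℓ ⟧)
               → sumFin 4 (λ k → A i k * x k) ≅ x i ⟦ + ℓ ⟧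
  leading-term x 0F p =
    ≅-trans (sum₄-≅ (*-unitˡ (x 0F) (diagonal lt 0F)) (≅0-*ʳ (x 1F) (upper lt 0F 1F (s≤s z≤n)))
                    (≅0-*ʳ (x 2F) (upper lt 0F 2F (s≤s z≤n))) (≅0-*ʳ (x 3F) (upper lt 0F 3F (s≤s z≤n))))
            (≡⇒≅ (single-term₀ (x 0F)))
  leading-term x 1F p =
    ≅-trans (sum₄-≅ (≅0-*ˡ (A 1F 0F) (p 0F (s≤s z≤n))) (*-unitˡ (x 1F) (diagonal lt 1F))
                    (≅0-*ʳ (x 2F) (upper lt 1F 2F (s≤s (s≤s z≤n)))) (≅0-*ʳ (x 3F) (upper lt 1F 3F (s≤s (s≤s z≤n)))))
            (≡⇒≅ (single-term₁ (x 1F)))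
  leading-term x 2F p =
    ≅-trans (sum₄-≅ (≅0-*ˡ (A 2F 0F) (p 0F (s≤s z≤n))) (≅0-*ˡ (A 2F 1F) (p 1F (s≤s (s≤s z≤n))))
                    (*-unitˡ (x 2F) (diagonal lt 2F)) (≅0-*ʳ (x 3F) (upper lt 2F 3F (s≤s (s≤s (s≤s z≤n))))))
            (≡⇒≅ (single-term₂ (x 2F)))
  leading-term x 3F p =
    ≅-trans (sum₄-≅ (≅0-*ˡ (A 3F 0F) (p 0F (s≤s z≤n))) (≅0-*ˡ (A 3F 1F) (p 1F (s≤s (s≤s z≤n))))
                    (≅0-*ˡ (A 3F 2F) (p 2F (s≤s (s≤s (s≤s z≤n))))) (*-unitˡ (x 3F) (diagonal lt 3F)))
            (≡⇒≅ (single-term₃ (x 3F)))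

  module _ {B : Mat4} (lt' : LowerUnitriangular ℓ B) where

    LowerUnitriangular-⊗ : LowerUnitriangular ℓ (A ⊗ B)
    LowerUnitriangular-⊗ = record
      { upper = λ i j i<j → ≅-trans (leading-term (λ k → B k j) i (λ k k<i → upper lt' k j (ℕₚ.<-trans k<i i<j)))
                                    (upper lt' i j i<j)
      ; diagonal = λ i → ≅-trans (leading-term (λ k → B k i) i (λ k k<i → upper lt' k i k<i)) (diagonal lt' i) }

    α-⊗ : (A ⊗ B) 1F 0F ≅ A 1F 0F + B 1F 0F ⟦ + ℓ ⟧
    α-⊗ = ≅-trans (sum₄-≅ (*-unitʳ (A 1F 0F) (diagonal lt' 0F)) (*-unitˡ (B 1F 0F) (diagonal lt 1F))
                          (≅0-*ʳ (B 2F 0F) (upper lt 1F 2F (s≤s (s≤s z≤n))))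
                          (≅0-*ʳ (B 3F 0F) (upper lt 1F 3F (s≤s (s≤s z≤n)))))
                  (≡⇒≅ (e (A 1F 0F) (B 1F 0F)))
      where
      e : ∀ a b → a + (b + (+ 0 + (+ 0 + + 0))) ≡ a + b
      e = solve-∀

    γ-⊗ : (A ⊗ B) 2F 1F ≅ A 2F 1F + B 2F 1F ⟦ + ℓ ⟧
    γ-⊗ = ≅-trans (sum₄-≅ (≅0-*ˡ (A 2F 0F) (upper lt' 0F 1F (s≤s z≤n))) (*-unitʳ (A 2F 1F) (diagonal lt' 1F))
                          (*-unitˡ (B 2F 1F) (diagonal lt 2F))
                          (≅0-*ʳ (B 3F 1F) (upper lt 2F 3F (s≤s (s≤s (s≤s z≤n))))))
                  (≡⇒≅ (e (A 2F 1F) (B 2F 1F)))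
      where
      e : ∀ a b → + 0 + (a + (b + (+ 0 + + 0))) ≡ a + b
      e = solve-∀

    -- The two middle terms are products of two multiples of ℓ. In the outer ones a multiple of ℓ is
    -- multiplied by a diagonal entry that is 1 modulo ℓ, which changes nothing modulo ℓ².
    f-⊗ : (A ⊗ B) 0F 3F ≅ A 0F 3F + B 0F 3F ⟦ + ℓ * + ℓ ⟧
    f-⊗ = ≅-trans (sum₄-≅ (unit (diagonal lt 0F) (upper lt' 0F 3F (s≤s z≤n)))
                          (≅0-*-* (upper lt 0F 1F (s≤s z≤n)) (upper lt' 1F 3F (s≤s (s≤s z≤n))))
                          (≅0-*-* (upper lt 0F 2F (s≤s z≤n)) (upper lt' 2F 3F (s≤s (s≤s (s≤s z≤n)))))
                          (≅-trans (≡⇒≅ (ℤₚ.*-comm (A 0F 3F) (B 3F 3F)))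
                                   (unit (diagonal lt' 3F) (upper lt 0F 3F (s≤s z≤n)))))
                  (≡⇒≅ (e (A 0F 3F) (B 0F 3F)))
      where
      e : ∀ a b → b + (+ 0 + (+ 0 + (a + + 0))) ≡ a + b
      e = solve-∀
      unit : ∀ {u a} → u ≅ + 1 ⟦ + ℓ ⟧ → a ≅ + 0 ⟦ + ℓ ⟧ → u * a ≅ a ⟦ + ℓ * + ℓ ⟧
      unit {u} {a} p q = minus≅0⇒≅ (≅-trans (≡⇒≅ (d u a)) (≅0-*-* (≅⇒minus≅0 p) q))
        where
        d : ∀ u a → u * a - a ≡ (u - + 1) * a
        d = solve-∀

  LowerUnitriangular-inverse : ∀ {B} → A ⊗ B ≊ I4 ⟦ + ℓ ⟧ → LowerUnitriangular ℓ B
  LowerUnitriangular-inverse {B} p = record { upper = up ; diagonal = di }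
    where
    solved : ∀ i j → (∀ k → toℕ k ℕ.< toℕ i → B k j ≅ + 0 ⟦ + ℓ ⟧) → B i j ≅ I4 i j ⟦ + ℓ ⟧
    solved i j z = ≅-trans (≅-sym (leading-term (λ k → B k j) i z)) (entry p i j)
    b01 = solved 0F 1F λ _ ()
    b02 = solved 0F 2F λ _ ()
    b03 = solved 0F 3F λ _ ()
    b12 = solved 1F 2F λ { 0F _ → b02 ; (suc _) (s≤s ()) }
    b13 = solved 1F 3F λ { 0F _ → b03 ; (suc _) (s≤s ()) }
    b23 = solved 2F 3F λ { 0F _ → b03 ; 1F _ → b13 ; (suc (suc _)) (s≤s (s≤s ())) }
    up : ∀ i j → toℕ i ℕ.< toℕ j → B i j ≅ + 0 ⟦ + ℓ ⟧
    up 0F 1F _ = b01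
    up 0F 2F _ = b02
    up 0F 3F _ = b03
    up 1F 1F (s≤s ())
    up 1F 2F _ = b12
    up 1F 3F _ = b13
    up 2F 1F (s≤s ())
    up 2F 2F (s≤s (s≤s ()))
    up 2F 3F _ = b23
    up 3F 1F (s≤s ())
    up 3F 2F (s≤s (s≤s ()))
    up 3F 3F (s≤s (s≤s (s≤s ())))
    di : ∀ i → B i i ≅ + 1 ⟦ + ℓ ⟧
    di 0F = solved 0F 0F λ _ ()
    di 1F = solved 1F 1F λ { 0F _ → b01 ; (suc _) (s≤s ()) }
    di 2F = solved 2F 2F λ { 0F _ → b02 ; 1F _ → b12 ; (suc (suc _)) (s≤s (s≤s ())) }
    di 3F = solved 3F 3F λ { 0F _ → b03 ; 1F _ → b13 ; 2F _ → b23 ; 3F (s≤s (s≤s (s≤s ()))) }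

  module _ (sp : form A ≊ J ⟦ + ℓ ⟧) where

    private
      form-≅ : ∀ i j → A 0F i * A 3F j + A 1F i * A 2F j - A 2F i * A 1F j - A 3F i * A 0F j ≅ J i j ⟦ + ℓ ⟧
      form-≅ i j = ≅-trans (≡⇒≅ (sym (form-entry A i j))) (entry sp i j)

      four : ∀ {a a' b b' c c' d d'} → a ≅ a' ⟦ + ℓ ⟧ → b ≅ b' ⟦ + ℓ ⟧ → c ≅ c' ⟦ + ℓ ⟧ → d ≅ d' ⟦ + ℓ ⟧
           → a + b - c - d ≅ a' + b' - c' - d' ⟦ + ℓ ⟧
      four p q r s = ≅-minus (≅-minus (≅-+ p q) r) s

    -- From ⟨Ae₁, Ae₃⟩ = 0. This is why α enters the determinant squared, and why one element with α
    -- odd serves two of the four positions in the cycle.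
    entry-32 : A 3F 2F ≅ - A 1F 0F ⟦ + ℓ ⟧
    entry-32 = minus≅0⇒≅ (≅-trans (≡⇒≅ (e (A 3F 2F) (A 1F 0F))) (≅-trans (≅-sym
      (four (*-unitˡ (A 3F 2F) (diagonal lt 0F)) (*-unitʳ (A 1F 0F) (diagonal lt 2F))
            (≅0-*ˡ (A 2F 0F) (upper lt 1F 2F (s≤s (s≤s z≤n)))) (≅0-*ˡ (A 3F 0F) (upper lt 0F 2F (s≤s z≤n)))))
      (form-≅ 0F 2F)))
      where
      e : ∀ a b → a - - b ≡ a + b - + 0 - + 0
      e = solve-∀

    -- From ⟨Ae₁, Ae₂⟩ = 0; its reduction is the bit `p xor (a ∧ c)` of `unipotent`.
    entry-31 : A 3F 1F ≅ A 2F 0F - A 1F 0F * A 2F 1F ⟦ + ℓ ⟧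
    entry-31 = minus≅0⇒≅ (≅-trans (≡⇒≅ (e (A 3F 1F) (A 2F 0F) (A 1F 0F * A 2F 1F))) (≅-trans (≅-sym
      (four (*-unitˡ (A 3F 1F) (diagonal lt 0F)) (≅-refl {a = A 1F 0F * A 2F 1F})
            (*-unitʳ (A 2F 0F) (diagonal lt 1F)) (≅0-*ˡ (A 3F 0F) (upper lt 0F 1F (s≤s z≤n)))))
      (form-≅ 0F 1F)))
      where
      e : ∀ a b c → a - (b - c) ≡ a + c - b - + 0
      e = solve-∀

-- The determinant of g - 1 modulo ℓ².

det₃-formula : ∀ (M : Mat 3) → det 3 M ≡
  M 0F 0F * (M 1F 1F * M 2F 2F - M 1F 2F * M 2F 1F) - M 0F 1F * (M 1F 0F * M 2F 2F - M 1F 2F * M 2F 0F)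
  + M 0F 2F * (M 1F 0F * M 2F 1F - M 1F 1F * M 2F 0F)
det₃-formula M = e (M 0F 0F) (M 0F 1F) (M 0F 2F) (M 1F 0F) (M 1F 1F) (M 1F 2F) (M 2F 0F) (M 2F 1F) (M 2F 2F)
  where
  e : ∀ a b c d f g h i j
    → + 1 * a * (+ 1 * f * (+ 1 * j * + 1 + + 0) + (-[1+ 0 ] * g * (+ 1 * i * + 1 + + 0) + + 0))
    + (-[1+ 0 ] * b * (+ 1 * d * (+ 1 * j * + 1 + + 0) + (-[1+ 0 ] * g * (+ 1 * h * + 1 + + 0) + + 0))
    + (+ 1 * c * (+ 1 * d * (+ 1 * i * + 1 + + 0) + (-[1+ 0 ] * f * (+ 1 * h * + 1 + + 0) + + 0)) + + 0))
    ≡ a * (f * j - g * i) - b * (d * j - g * h) + c * (d * i - f * h)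
  e = solve-∀

module _ {m : ℤ} {M : Mat 3} where

  det₃-last-column-zero : (∀ i → M i 2F ≅ + 0 ⟦ m ⟧) → det 3 M ≅ + 0 ⟦ m ⟧
  det₃-last-column-zero p = ≅-trans (≡⇒≅ (det₃-formula M))
    (≅-trans (≅-+ (≅-minus (≅-* (≅-refl {a = M 0F 0F}) (≅-minus (≅0-*ˡ (M 1F 1F) (p 2F)) (≅0-*ʳ (M 2F 1F) (p 1F))))
                           (≅-* (≅-refl {a = M 0F 1F}) (≅-minus (≅0-*ˡ (M 1F 0F) (p 2F)) (≅0-*ʳ (M 2F 0F) (p 1F)))))
                  (≅0-*ʳ (M 1F 0F * M 2F 1F - M 1F 1F * M 2F 0F) (p 0F)))
             (≡⇒≅ (e (M 0F 0F) (M 0F 1F))))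
    where
    e : ∀ a b → a * (+ 0 - + 0) - b * (+ 0 - + 0) + + 0 ≡ + 0
    e = solve-∀

  det₃-lower : M 0F 1F ≅ + 0 ⟦ m ⟧ → M 0F 2F ≅ + 0 ⟦ m ⟧ → M 1F 2F ≅ + 0 ⟦ m ⟧
             → det 3 M ≅ M 0F 0F * (M 1F 1F * M 2F 2F) ⟦ m ⟧
  det₃-lower p q r = ≅-trans (≡⇒≅ (det₃-formula M))
    (≅-trans (≅-+ (≅-minus (≅-* (≅-refl {a = M 0F 0F}) (≅-minus (≅-refl {a = M 1F 1F * M 2F 2F}) (≅0-*ʳ (M 2F 1F) r)))
                           (≅0-*ʳ (M 1F 0F * M 2F 2F - M 1F 2F * M 2F 0F) p))
                  (≅0-*ʳ (M 1F 0F * M 2F 1F - M 1F 1F * M 2F 0F) q))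
             (≡⇒≅ (e (M 0F 0F) (M 1F 1F * M 2F 2F))))
    where
    e : ∀ a b → a * (b - + 0) - + 0 + + 0 ≡ a * b
    e = solve-∀

module _ {ℓ : ℕ} {A : Mat4} (lt : LowerUnitriangular ℓ A) (sp : form A ≊ J ⟦ + ℓ ⟧) where

  private
    N : Mat4
    N i j = A i j - I4 i j

    minor : Fin 4 → Mat 3
    minor j a b = N (suc a) (punchIn j b)

    N00 : N 0F 0F ≅ + 0 ⟦ + ℓ ⟧
    N00 = ≅⇒minus≅0 (diagonal lt 0F)
    N11 : N 1F 1F ≅ + 0 ⟦ + ℓ ⟧
    N11 = ≅⇒minus≅0 (diagonal lt 1F)
    N22 : N 2F 2F ≅ + 0 ⟦ + ℓ ⟧
    N22 = ≅⇒minus≅0 (diagonal lt 2F)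
    N33 : N 3F 3F ≅ + 0 ⟦ + ℓ ⟧
    N33 = ≅⇒minus≅0 (diagonal lt 3F)
    N01 : N 0F 1F ≅ + 0 ⟦ + ℓ ⟧
    N01 = ≅⇒minus≅0 (upper lt 0F 1F (s≤s z≤n))
    N02 : N 0F 2F ≅ + 0 ⟦ + ℓ ⟧
    N02 = ≅⇒minus≅0 (upper lt 0F 2F (s≤s z≤n))
    N03 : N 0F 3F ≅ + 0 ⟦ + ℓ ⟧
    N03 = ≅⇒minus≅0 (upper lt 0F 3F (s≤s z≤n))
    N12 : N 1F 2F ≅ + 0 ⟦ + ℓ ⟧
    N12 = ≅⇒minus≅0 (upper lt 1F 2F (s≤s (s≤s z≤n)))
    N13 : N 1F 3F ≅ + 0 ⟦ + ℓ ⟧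
    N13 = ≅⇒minus≅0 (upper lt 1F 3F (s≤s (s≤s z≤n)))
    N23 : N 2F 3F ≅ + 0 ⟦ + ℓ ⟧
    N23 = ≅⇒minus≅0 (upper lt 2F 3F (s≤s (s≤s (s≤s z≤n))))

    last-column : Fin 3 → ℤ
    last-column a = N (suc a) 3F

    last-column-zero : ∀ a → last-column a ≅ + 0 ⟦ + ℓ ⟧
    last-column-zero 0F = N13
    last-column-zero 1F = N23
    last-column-zero 2F = N33

    term : ∀ c {a b} → a ≅ + 0 ⟦ + ℓ ⟧ → b ≅ + 0 ⟦ + ℓ ⟧ → c * a * b ≅ + 0 ⟦ + ℓ * + ℓ ⟧
    term c p q = ≅0-*-* (≅0-*ˡ c p) q

    -- Only the cofactor of the (1,4) entry survives: the other minors of the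
    -- first row contain the last column, which vanishes mod ℓ.
    minor-3 : det 3 (minor 3F) ≅ A 1F 0F * (A 2F 1F * - A 1F 0F) ⟦ + ℓ ⟧
    minor-3 = ≅-trans (det₃-lower {M = minor 3F} N11 N12 N22)
      (≅-* (≡⇒≅ (e (A 1F 0F))) (≅-* (≡⇒≅ (e (A 2F 1F))) (≅-trans (≡⇒≅ (e (A 3F 2F))) (entry-32 lt sp))))
      where
      e : ∀ a → a - + 0 ≡ a
      e = solve-∀

    expansion : det 4 N ≡ + 1 * N 0F 0F * det 3 (minor 0F) + (-[1+ 0 ] * N 0F 1F * det 3 (minor 1F)
                        + (+ 1 * N 0F 2F * det 3 (minor 2F) + (-[1+ 0 ] * N 0F 3F * det 3 (minor 3F) + + 0)))
    expansion = refl

  -- The first row of g - 1 is divisible by ℓ, so its minors matter only modulo ℓ. The sign of the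
  -- (1,4) cofactor cancels the sign in `entry-32`.
  det-≅ : det 4 (λ i j → A i j - I4 i j) ≅ A 0F 3F * (A 1F 0F * A 2F 1F * A 1F 0F) ⟦ + ℓ * + ℓ ⟧
  det-≅ = ≅-trans (≡⇒≅ expansion) (≅-trans
    (sum₄-≅ (term (+ 1) N00 (det₃-last-column-zero {M = minor 0F} last-column-zero))
            (term -[1+ 0 ] N01 (det₃-last-column-zero {M = minor 1F} last-column-zero))
            (term (+ 1) N02 (det₃-last-column-zero {M = minor 2F} last-column-zero))
            last-term)
    (≡⇒≅ (e₂ (A 0F 3F) (A 1F 0F) (A 2F 1F))))
    where
    e₁ : ∀ a b c → -[1+ 0 ] * (a - + 0) * b - -[1+ 0 ] * (a - + 0) * c ≡ -[1+ 0 ] * (a - + 0) * (b - c)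
    e₁ = solve-∀
    e₂ : ∀ f a c → + 0 + (+ 0 + (+ 0 + (-[1+ 0 ] * (f - + 0) * (a * (c * - a)) + + 0))) ≡ f * (a * c * a)
    e₂ = solve-∀
    last-term : -[1+ 0 ] * N 0F 3F * det 3 (minor 3F)
              ≅ -[1+ 0 ] * N 0F 3F * (A 1F 0F * (A 2F 1F * - A 1F 0F)) ⟦ + ℓ * + ℓ ⟧
    last-term = minus≅0⇒≅ (≅-trans (≡⇒≅ (e₁ (A 0F 3F) (det 3 (minor 3F)) (A 1F 0F * (A 2F 1F * - A 1F 0F))))
                                   (term -[1+ 0 ] N03 (≅⇒minus≅0 minor-3)))

-- From matrices to ℓ-adic sequences of matrices.

1≤2 : 1 ≤ 2
1≤2 = s≤s z≤n

mod-pw-1 : ∀ {a b} ℓ → a ≅ b ⟦ pw ℓ 1 ⟧ → a ≅ b ⟦ + ℓ ⟧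
mod-pw-1 {a} {b} ℓ = subst (a ≅ b ⟦_⟧) (pw-1 ℓ)

from-mod-1 : ∀ {a b} ℓ → a ≅ b ⟦ + ℓ ⟧ → a ≅ b ⟦ pw ℓ 1 ⟧
from-mod-1 {a} {b} ℓ = subst (a ≅ b ⟦_⟧) (sym (pw-1 ℓ))

pw-2 : ∀ ℓ → pw ℓ 2 ≡ + ℓ * + ℓ
pw-2 ℓ = trans (pw-suc ℓ 1) (cong (+ ℓ *_) (pw-1 ℓ))

-- Read at level 2, alongside `f` and the determinant; `level-1-2` compares them with the level 1
-- entries of the statement.
αₛ γₛ : MSeq → ℤ
αₛ g = g 2 1F 0F
γₛ g = g 2 2F 1F

module _ {ℓ : ℕ} where

  compat-entry : ∀ {g} → CompatM ℓ g → ∀ i j → CompatZ ℓ (λ n → g n i j)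
  compat-entry c i j n = c n i j

  CompatM-≤ : ∀ {g} → CompatM ℓ g → ∀ {m n} → m ≤ n → g n ≊ g m ⟦ pw ℓ m ⟧
  CompatM-≤ {g} c m≤n = entries λ i j → compat-≤ {ℓ} {λ n → g n i j} (compat-entry {g} c i j) m≤n

  CompatM-step : ∀ g → CompatM ℓ g → ∀ n → g (suc n) ≊ g n ⟦ pw ℓ n ⟧
  CompatM-step g c n = CompatM-≤ {g} c (ℕₚ.n≤1+n n)

  to-CompatM : ∀ {g : MSeq} → (∀ n → g (suc n) ≊ g n ⟦ pw ℓ n ⟧) → CompatM ℓ g
  to-CompatM p n i j = to-mod (entry (p n) i j)

  from-≈M : ∀ g h → _≈M_ ℓ g h → ∀ n → g n ≊ h n ⟦ pw ℓ n ⟧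
  from-≈M g h p n = entries λ i j → from-mod (p n i j)

  to-≈M : ∀ g h → (∀ n → g n ≊ h n ⟦ pw ℓ n ⟧) → _≈M_ ℓ g h
  to-≈M g h p n i j = to-mod (entry (p n) i j)

  IsSp-form : ∀ g → IsSp ℓ g → ∀ n → form (g n) ≊ J ⟦ pw ℓ n ⟧
  IsSp-form g s n = entries λ i j → from-mod (proj₂ s n i j)

  to-IsSp : ∀ g → (∀ n → g (suc n) ≊ g n ⟦ pw ℓ n ⟧) → (∀ n → form (g n) ≊ J ⟦ pw ℓ n ⟧) → IsSp ℓ g
  to-IsSp g c p = to-CompatM c , λ n i j → to-mod (entry (p n) i j)

  ≊-mod-ℓ : ∀ {A B n} → 1 ≤ n → A ≊ B ⟦ pw ℓ n ⟧ → A ≊ B ⟦ + ℓ ⟧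
  ≊-mod-ℓ 1≤n p = entries λ i j → mod-pw-1 ℓ (≅-pw-≤ {ℓ} 1≤n (entry p i j))

  LowerUnitriangular-≊ : ∀ {A B} → A ≊ B ⟦ + ℓ ⟧ → LowerUnitriangular ℓ B → LowerUnitriangular ℓ A
  LowerUnitriangular-≊ p lt = record
    { upper = λ i j i<j → ≅-trans (entry p i j) (upper lt i j i<j)
    ; diagonal = λ i → ≅-trans (entry p i i) (diagonal lt i) }

  InS-lower : ∀ g → InS ℓ g → ∀ {n} → 1 ≤ n → LowerUnitriangular ℓ (g n)
  InS-lower g (sp , up , di) 1≤n = LowerUnitriangular-≊
    (≊-mod-ℓ {n = 1} (s≤s z≤n) (CompatM-≤ {g} (proj₁ sp) 1≤n))
    (record { upper = λ i j i<j → mod-pw-1 ℓ (from-mod (up i j i<j))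
            ; diagonal = λ i → mod-pw-1 ℓ (from-mod (di i)) })

  to-InS : ∀ g → IsSp ℓ g → LowerUnitriangular ℓ (g 1) → InS ℓ g
  to-InS g sp lt = sp , (λ i j i<j → to-mod (from-mod-1 ℓ (upper lt i j i<j)))
                    , (λ i → to-mod (from-mod-1 ℓ (diagonal lt i)))

  IsSp-⊗S : ∀ g h → IsSp ℓ g → IsSp ℓ h → IsSp ℓ (_⊗S_ ℓ g h)
  IsSp-⊗S g h s t = to-IsSp (_⊗S_ ℓ g h) (λ n → ⊗-cong (CompatM-step g (proj₁ s) n) (CompatM-step h (proj₁ t) n))
                                (λ n → form-⊗ (g n) (h n) (IsSp-form g s n) (IsSp-form h t n))

  IsSp-idS : IsSp ℓ (idS ℓ)
  IsSp-idS = to-IsSp (idS ℓ) (λ n → ≊-refl {A = I4}) (λ n → form-I4)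

  InS-⊗S : ∀ g h → InS ℓ g → InS ℓ h → InS ℓ (_⊗S_ ℓ g h)
  InS-⊗S g h s t = to-InS (_⊗S_ ℓ g h) (IsSp-⊗S g h (proj₁ s) (proj₁ t))
                      (LowerUnitriangular-⊗ (InS-lower g s ℕₚ.≤-refl) (InS-lower h t ℕₚ.≤-refl))

  InS-≈M : ∀ g h → InS ℓ g → IsSp ℓ h → _≈M_ ℓ g h → InS ℓ h
  InS-≈M g h s sp e = to-InS h sp (LowerUnitriangular-≊ (≊-mod-ℓ {n = 1} ℕₚ.≤-refl (≊-sym (from-≈M g h e 1)))
                                                  (InS-lower g s ℕₚ.≤-refl))

  InS-form : ∀ g → InS ℓ g → form (g 2) ≊ J ⟦ + ℓ ⟧
  InS-form g s = ≊-mod-ℓ {n = 2} 1≤2 (IsSp-form g (proj₁ s) 2)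

  inverseS : MSeq → MSeq
  inverseS g n = adjoint (g n)

  module _ .{{_ : ℕ.NonZero ℓ}} g (s : InS ℓ g) where

    inverseS-right : ∀ n → g n ⊗ adjoint (g n) ≊ I4 ⟦ pw ℓ n ⟧
    inverseS-right zero    = entries λ i j → ≅-pw-0 {ℓ}
    inverseS-right (suc n) = adjoint-inverseʳ (InS-lower g s (s≤s z≤n)) (suc n) (IsSp-form g (proj₁ s) (suc n))

    IsSp-inverseS : IsSp ℓ (inverseS g)
    IsSp-inverseS = to-IsSp (inverseS g) (λ n → adjoint-cong (CompatM-step g (proj₁ (proj₁ s)) n))
                            (λ n → form-adjoint (g n) (inverseS-right n))

    InS-inverseS : InS ℓ (inverseS g)
    InS-inverseS = to-InS (inverseS g) IsSp-inverseS
      (LowerUnitriangular-inverse (InS-lower g s ℕₚ.≤-refl) (≊-mod-ℓ {n = 1} ℕₚ.≤-refl (inverseS-right 1)))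

    inverseS-≈M : _≈M_ ℓ (_⊗S_ ℓ g (inverseS g)) (idS ℓ)
    inverseS-≈M = to-≈M (_⊗S_ ℓ g (inverseS g)) (idS ℓ) inverseS-right

    inverseS-unique : ∀ {h} → _≈M_ ℓ (_⊗S_ ℓ g h) (idS ℓ) → _≈M_ ℓ (inverseS g) h
    inverseS-unique {h} e = to-≈M (inverseS g) h λ n → ≊-sym
      (inverse-unique {A = g n} {adjoint (g n)} {h n} (adjoint-inverseˡ (g n) (IsSp-form g (proj₁ s) n)) (from-≈M (_⊗S_ ℓ g h) (idS ℓ) e n))

  abstract
    -- The integer g₁₄/ℓ at level 2, of which only the class modulo ℓ is meaningful. Its definition
    -- is sealed, and everything about it goes through `fₛ-entry`.
    fₛ : ∀ g → InS ℓ g → ℤ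
    fₛ g s = quot (upper (InS-lower g s 1≤2) 0F 3F (s≤s z≤n))

    fₛ-entry : ∀ g (s : InS ℓ g) → g 2 0F 3F ≡ + ℓ * fₛ g s
    fₛ-entry g s = trans (≅0-quot (upper (InS-lower g s 1≤2) 0F 3F (s≤s z≤n))) (ℤₚ.*-comm (fₛ g s) (+ ℓ))

  module _ g (s : InS ℓ g) where

    level-1-2 : ∀ i j → g 1 i j ≅ g 2 i j ⟦ + ℓ ⟧
    level-1-2 i j = mod-pw-1 ℓ (≅-sym (entry (CompatM-≤ {g} (proj₁ (proj₁ s)) 1≤2) i j))

    fₛ-trivial : fₛ g s ≅ + 0 ⟦ + ℓ ⟧ → g 2 0F 3F ≡ + 0 [mod pw ℓ 2 ]
    fₛ-trivial p = to-mod (subst (g 2 0F 3F ≅ + 0 ⟦_⟧) (sym (pw-2 ℓ))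
      (≅-trans (≡⇒≅ (fₛ-entry g s)) (≅-trans (≅-scale (+ ℓ) p) (≡⇒≅ (ℤₚ.*-zeroʳ (+ ℓ))))))

    module _ .{{_ : ℕ.NonZero ℓ}} where

      -- With g₁₄ = ℓ f, `det-≅` shows ℓ times this product to vanish modulo ℓ², and one factor ℓ is
      -- cancelled.
      fixed-product : pw ℓ 2 ℤ∣.∣ det 4 (λ i j → g 2 i j - I4 i j)
                    → fₛ g s * (αₛ g * γₛ g * αₛ g) ≅ + 0 ⟦ + ℓ ⟧
      fixed-product d = ≅-cancel (+ ℓ) (≅-trans (≡⇒≅ (trans (sym (ℤₚ.*-assoc (+ ℓ) (fₛ g s) _))
          (cong (_* (αₛ g * γₛ g * αₛ g)) (sym (fₛ-entry g s)))))
        (≅-trans (≅-sym (det-≅ (InS-lower g s 1≤2) (InS-form g s)))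
        (≅-trans (subst (det 4 (λ i j → g 2 i j - I4 i j) ≅ + 0 ⟦_⟧) (pw-2 ℓ) (from-∣ d))
                 (≡⇒≅ (sym (ℤₚ.*-zeroʳ (+ ℓ)))))))

  fₛ-⊗ : .{{_ : ℕ.NonZero ℓ}} → ∀ g h (s : InS ℓ g) (t : InS ℓ h) (st : InS ℓ (_⊗S_ ℓ g h))
       → fₛ (_⊗S_ ℓ g h) st ≅ fₛ g s + fₛ h t ⟦ + ℓ ⟧
  fₛ-⊗ g h s t st = ≅-cancel (+ ℓ)
    (≅-trans (≡⇒≅ (sym (fₛ-entry (_⊗S_ ℓ g h) st)))
    (≅-trans (f-⊗ (InS-lower g s 1≤2) (InS-lower h t 1≤2))
             (≡⇒≅ (trans (cong₂ _+_ (fₛ-entry g s) (fₛ-entry h t)) (sym (ℤₚ.*-distribˡ-+ (+ ℓ) (fₛ g s) (fₛ h t)))))))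

-- Three characters with vanishing product.

≅0? : ∀ ℓ a → Dec (a ≅ + 0 ⟦ + ℓ ⟧)
≅0? ℓ a = map′ from-∣ to-∣ (ℓ ℕ∣.∣? ∣ a ∣)

-- A vector space over a field with at least three elements is not the union of
-- three hyperplanes: if α, γ ≠ 0 = f at g and f ≠ 0 at h then each of α, γ
-- vanishes at no more than one of h, gh, gh².
module ThreeCharacters {X : Set} (_∙_ : X → X → X) {ℓ : ℕ} (ℓ-prime : Prime ℓ)
  (α γ f : X → ℤ)
  (α-hom : ∀ x y → α (x ∙ y) ≅ α x + α y ⟦ + ℓ ⟧)
  (γ-hom : ∀ x y → γ (x ∙ y) ≅ γ x + γ y ⟦ + ℓ ⟧)
  (f-hom : ∀ x y → f (x ∙ y) ≅ f x + f y ⟦ + ℓ ⟧)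
  (product : ∀ x → f x * (α x * γ x * α x) ≅ + 0 ⟦ + ℓ ⟧) where

  Vanishes : ℤ → Set
  Vanishes a = a ≅ + 0 ⟦ + ℓ ⟧

  zero-divisor : ∀ a b → Vanishes (a * b) → Vanishes a ⊎ Vanishes b
  zero-divisor a b p with euclidsLemma ∣ a ∣ ∣ b ∣ ℓ-prime (subst (ℓ ℕ∣.∣_) (ℤₚ.abs-* a b) (to-∣ p))
  ... | inj₁ d = inj₁ (from-∣ d)
  ... | inj₂ d = inj₂ (from-∣ d)

  some-vanishes : ∀ x → Vanishes (f x) ⊎ Vanishes (α x) ⊎ Vanishes (γ x)
  some-vanishes x with zero-divisor (f x) _ (product x)
  ... | inj₁ p = inj₁ p
  ... | inj₂ p with zero-divisor (α x * γ x) (α x) p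
  ...   | inj₂ q = inj₂ (inj₁ q)
  ...   | inj₁ q with zero-divisor (α x) (γ x) q
  ...     | inj₁ r = inj₂ (inj₁ r)
  ...     | inj₂ r = inj₂ (inj₂ r)

  sum-vanishesˡ : ∀ {a b c} → c ≅ a + b ⟦ + ℓ ⟧ → Vanishes c → Vanishes b → Vanishes a
  sum-vanishesˡ {a} {b} {c} e p q = ≅-trans (≡⇒≅ (eq a b)) (≅-minus (≅-trans (≅-sym e) p) q)
    where
    eq : ∀ a b → a ≡ a + b - b
    eq = solve-∀

  sum-vanishesʳ : ∀ {a b c} → c ≅ a + b ⟦ + ℓ ⟧ → Vanishes c → Vanishes a → Vanishes b
  sum-vanishesʳ {a} {b} {c} e p q =
    sum-vanishesˡ {b} {a} {c} (≅-trans e (≡⇒≅ (ℤₚ.+-comm a b))) p q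

  -- If γ vanishes at `x` and α at `y`, then neither vanishes at the product, where they take the
  -- values α(x) and γ(y).
  common-nonzero : (∃ λ x → ¬ Vanishes (α x)) → (∃ λ x → ¬ Vanishes (γ x))
                 → ∃ λ x → ¬ Vanishes (α x) × ¬ Vanishes (γ x)
  common-nonzero (x , αx) (y , γy) with ≅0? ℓ (γ x) | ≅0? ℓ (α y)
  ... | no γx  | _      = x , αx , γx
  ... | yes _  | no αy  = y , αy , γy
  ... | yes γx | yes αy = x ∙ y , (λ p → αx (sum-vanishesˡ (α-hom x y) p αy))
                                , (λ p → γy (sum-vanishesʳ (γ-hom x y) p γx))

  module _ (χ : X → ℤ) (χ-hom : ∀ x y → χ (x ∙ y) ≅ χ x + χ y ⟦ + ℓ ⟧) {g} (χg : ¬ Vanishes (χ g)) (h : X) where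

    not-h-gh : Vanishes (χ h) → Vanishes (χ (g ∙ h)) → ⊥
    not-h-gh p q = χg (sum-vanishesˡ (χ-hom g h) q p)

    not-h-ghh : Vanishes (χ h) → Vanishes (χ ((g ∙ h) ∙ h)) → ⊥
    not-h-ghh p q = not-h-gh p (sum-vanishesˡ (χ-hom (g ∙ h) h) q p)

    not-gh-ghh : Vanishes (χ (g ∙ h)) → Vanishes (χ ((g ∙ h) ∙ h)) → ⊥
    not-gh-ghh p q = not-h-gh (sum-vanishesʳ (χ-hom (g ∙ h) h) q p) p

  one-trivial : 3 ≤ ℓ → (∃ λ x → ¬ Vanishes (α x)) → (∃ λ x → ¬ Vanishes (γ x)) → (∃ λ x → ¬ Vanishes (f x)) → ⊥
  one-trivial 3≤ℓ αx γx (h , fh) with common-nonzero αx γx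
  ... | g , αg , γg = cases (remaining (some-vanishes h) fh) (remaining (some-vanishes (g ∙ h)) fgh)
                            (remaining (some-vanishes ((g ∙ h) ∙ h)) fghh)
    where
    remaining : ∀ {A B C : Set} → A ⊎ B ⊎ C → ¬ A → B ⊎ C
    remaining (inj₁ a) n = ⊥-elim (n a)
    remaining (inj₂ p) _ = p

    fg : Vanishes (f g)
    fg = [ (λ p → p) , [ (λ p → ⊥-elim (αg p)) , (λ p → ⊥-elim (γg p)) ]′ ]′ (some-vanishes g)

    fgh : ¬ Vanishes (f (g ∙ h))
    fgh p = fh (sum-vanishesʳ (f-hom g h) p fg)

    -- Since f vanishes at `g`, the value at gh² is 2f(h). Here ℓ ≥ 3 enters: ℓ does not divide 2.
    fghh : ¬ Vanishes (f ((g ∙ h) ∙ h))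
    fghh p = [ (λ d → ℕₚ.<⇒≱ 3≤ℓ (ℕ∣.∣⇒≤ (to-∣ d))) , fh ]′ (zero-divisor (+ 2) (f h)
      (≅-trans (≅-sym (≅-trans (f-hom (g ∙ h) h) (≅-trans (≅-+ (f-hom g h) (≅-refl {a = f h}))
        (≅-trans (≅-+ (≅-+ fg (≅-refl {a = f h})) (≅-refl {a = f h})) (≡⇒≅ (e (f h))))))) p))
      where
      e : ∀ a → + 0 + a + a ≡ + 2 * a
      e = solve-∀

    cases : Vanishes (α h) ⊎ Vanishes (γ h) → Vanishes (α (g ∙ h)) ⊎ Vanishes (γ (g ∙ h))
          → Vanishes (α ((g ∙ h) ∙ h)) ⊎ Vanishes (γ ((g ∙ h) ∙ h)) → ⊥
    cases (inj₁ p) (inj₁ q) _        = not-h-gh α α-hom αg h p q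
    cases (inj₂ p) (inj₂ q) _        = not-h-gh γ γ-hom γg h p q
    cases (inj₁ p) (inj₂ _) (inj₁ r) = not-h-ghh α α-hom αg h p r
    cases (inj₁ _) (inj₂ q) (inj₂ r) = not-gh-ghh γ γ-hom γg h q r
    cases (inj₂ _) (inj₁ q) (inj₁ r) = not-gh-ghh α α-hom αg h q r
    cases (inj₂ p) (inj₁ _) (inj₂ r) = not-h-ghh γ γ-hom γg h p r

-- A plane in F₂³ that lies in no coordinate plane and misses (1,1,1) is the
-- plane of vectors of even weight.
module ThreeBooleanCharacters {X : Set} (_∙_ : X → X → X) (a c f : X → Bool)
  (a-hom : ∀ x y → a (x ∙ y) ≡ a x xor a y)
  (c-hom : ∀ x y → c (x ∙ y) ≡ c x xor c y)
  (f-hom : ∀ x y → f (x ∙ y) ≡ f x xor f y)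
  (product : ∀ x → f x ∧ (a x ∧ c x) ≡ false)
  (sa : ∃ λ x → a x ≡ true) (sc : ∃ λ x → c x ≡ true) (sf : ∃ λ x → f x ≡ true) where

  Value : Bool → Bool → Bool → Set
  Value u v w = ∃ λ x → a x ≡ u × c x ≡ v × f x ≡ w

  infixl 6 _∙ᵥ_

  _∙ᵥ_ : ∀ {u v w u' v' w'} → Value u v w → Value u' v' w' → Value (u xor u') (v xor v') (w xor w')
  (x , p , q , r) ∙ᵥ (y , p' , q' , r') =
    x ∙ y , trans (a-hom x y) (cong₂ _xor_ p p') , trans (c-hom x y) (cong₂ _xor_ q q')
          , trans (f-hom x y) (cong₂ _xor_ r r')

  no-111 : ¬ Value true true true
  no-111 (x , p , q , r) with trans (sym (product x)) (cong₂ _∧_ r (cong₂ _∧_ p q))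
  ... | ()

  value-a : ∃ λ v → ∃ λ w → Value true v w
  value-a = _ , _ , proj₁ sa , proj₂ sa , refl , refl

  value-c : ∃ λ u → ∃ λ w → Value u true w
  value-c = _ , _ , proj₁ sc , refl , proj₂ sc , refl

  value-f : ∃ λ u → ∃ λ v → Value u v true
  value-f = _ , _ , proj₁ sf , refl , refl , proj₂ sf

  -- Adding the value (1,0,0) changes the first coordinate alone, so any (u,1,1) could be moved to
  -- the excluded (1,1,1).
  no-011 : ∀ {u} → Value true false false → ¬ Value u true true
  no-011 {false} x y = no-111 (x ∙ᵥ y)
  no-011 {true}  x y = no-111 y

  no-101 : ∀ {v} → Value false true false → ¬ Value true v true
  no-101 {false} x y = no-111 (x ∙ᵥ y)
  no-101 {true}  x y = no-111 y

  no-110 : ∀ {w} → Value false false true → ¬ Value true true w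
  no-110 {false} x y = no-111 (x ∙ᵥ y)
  no-110 {true}  x y = no-111 y

  -- By `no-011` it is enough to find an element with c = f = 1. One with c = 1 or one with f = 1
  -- already has both, or else their product does. The next two lemmas permute the roles.
  no-100 : ¬ Value true false false
  no-100 x with value-c | value-f
  ... | _ , true  , y | _             = no-011 x y
  ... | _ , false , _ | _ , true  , z = no-011 x z
  ... | _ , false , y | _ , false , z = no-011 x (y ∙ᵥ z)

  no-010 : ¬ Value false true false
  no-010 x with value-a | value-f
  ... | _ , true  , y | _             = no-101 x y
  ... | _ , false , _ | true  , _ , z = no-101 x z
  ... | _ , false , y | false , _ , z = no-101 x (y ∙ᵥ z)

  no-001 : ¬ Value false false true
  no-001 x with value-a | value-c
  ... | true  , _ , y | _             = no-110 x y
  ... | false , _ , _ | true  , _ , z = no-110 x z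
  ... | false , _ , y | false , _ , z = no-110 x (y ∙ᵥ z)

  f≡a+c : ∀ x → f x ≡ a x xor c x
  f≡a+c x = go (a x) (c x) (f x) (x , refl , refl , refl)
    where
    go : ∀ u v w → Value u v w → w ≡ u xor v
    go false false false _ = refl
    go false true  true  _ = refl
    go true  false true  _ = refl
    go true  true  false _ = refl
    go false false true  x = ⊥-elim (no-001 x)
    go false true  false x = ⊥-elim (no-010 x)
    go true  false false x = ⊥-elim (no-100 x)
    go true  true  true  x = ⊥-elim (no-111 x)

  -- Together with `value-01` this makes (a, c) surjective onto F₂². The elements over (1,0) and
  -- (0,1) become the generators of a dihedral group.
  value-10 : ∃ λ x → a x ≡ true × c x ≡ false
  value-10 with value-a | value-f
  ... | false , _ , x , p , q , _ | _ = x , p , q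
  ... | true  , _     , _ | true  , false , y , p , q , _ = y , p , q
  ... | true  , false , x | false , true , y = proj₁ (x ∙ᵥ y) , proj₁ (proj₂ (x ∙ᵥ y)) , proj₁ (proj₂ (proj₂ (x ∙ᵥ y)))
  ... | true  , false , _ | true  , true , y = ⊥-elim (no-111 y)
  ... | true  , true  , x | _ = ⊥-elim (no-111 x)
  ... | true  , false , _ | false , false , y = ⊥-elim (no-001 y)

  value-01 : ∃ λ x → a x ≡ false × c x ≡ true
  value-01 with value-10 | value-c
  ... | _             | false , _ , y , p , q , _ = y , p , q
  ... | x , p , q     | true  , _ , y , p' , q' , _ =
    x ∙ y , trans (a-hom x y) (cong₂ _xor_ p p') , trans (c-hom x y) (cong₂ _xor_ q q')

-- Diagonal lattices and the pairs for a trivial character.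

<-≅⇒≡ : ∀ {ℓ u v} → u ℕ.< ℓ → v ℕ.< ℓ → + u ≅ + v ⟦ + ℓ ⟧ → u ≡ v
<-≅⇒≡ {ℓ} {u} {v} u<ℓ v<ℓ p = [ (λ u≤v → sym (ordered u≤v v<ℓ (≅-sym p))) , (λ v≤u → ordered v≤u u<ℓ p) ]′ (ℕₚ.≤-total u v)
  where
  multiple-< : ∀ d → d ℕ.< ℓ → ℓ ℕ∣.∣ d → d ≡ 0
  multiple-< zero    _   _   = refl
  multiple-< (suc d) d<ℓ ℓ∣d = ⊥-elim (ℕₚ.<⇒≱ d<ℓ (ℕ∣.∣⇒≤ ℓ∣d))
  ordered : ∀ {u v} → u ≤ v → v ℕ.< ℓ → + v ≅ + u ⟦ + ℓ ⟧ → v ≡ u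
  ordered {u} {v} u≤v v<ℓ p =
    ℕₚ.≤-antisym (ℕₚ.m∸n≡0⇒m≤n (multiple-< (v ℕ.∸ u) (ℕₚ.≤-<-trans (ℕₚ.m∸n≤m v u) v<ℓ)
      (subst (λ d → ℓ ℕ∣.∣ ∣ d ∣) (trans (ℤₚ.m-n≡m⊖n v u) (ℤₚ.⊖-≥ u≤v)) (to-mod p)))) u≤v

module _ (ℓ : ℕ) where

  -- Divisibility by ℓ^(a i) is decided by the term at level `a i`, so one congruence for each
  -- coordinate describes the lattice ⊕ ℓ^(a i) Z_ℓ e_i.
  record Diagonal (a : Fin 4 → ℕ) (x : VSeq) : Set where
    constructor diag
    field
      compatible : CompatV ℓ x
      divisible  : ∀ i → x (a i) i ≅ + 0 ⟦ pw ℓ (a i) ⟧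

  open Diagonal public

  compat-coordinate : ∀ x → CompatV ℓ x → ∀ i {m n} → m ≤ n → x n i ≅ x m i ⟦ pw ℓ m ⟧
  compat-coordinate x c i m≤n = compat-≤ {ℓ} {λ n → x n i} (λ n → c n i) m≤n

  CompatV-add : ∀ x y → CompatV ℓ x → CompatV ℓ y → CompatV ℓ (λ n i → x n i + y n i)
  CompatV-add x y c d n i =
    to-mod (≅-+ {m = pw ℓ n} (compat-coordinate x c i (ℕₚ.n≤1+n n)) (compat-coordinate y d i (ℕₚ.n≤1+n n)))

  CompatV-minus : ∀ x y → CompatV ℓ x → CompatV ℓ y → CompatV ℓ (λ n i → x n i - y n i)
  CompatV-minus x y c d n i =
    to-mod (≅-minus {m = pw ℓ n} (compat-coordinate x c i (ℕₚ.n≤1+n n)) (compat-coordinate y d i (ℕₚ.n≤1+n n)))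

  CompatV-scale : ∀ a x → CompatZ ℓ a → CompatV ℓ x → CompatV ℓ (λ n i → a n * x n i)
  CompatV-scale a x c d n i =
    to-mod (≅-* {m = pw ℓ n} (compat-≤ {ℓ} {a} c (ℕₚ.n≤1+n n)) (compat-coordinate x d i (ℕₚ.n≤1+n n)))

  CompatZ-constant : ∀ c → CompatZ ℓ (λ _ → c)
  CompatZ-constant c n = to-mod (≅-refl {pw ℓ n} {c})

  CompatV-constant : ∀ (v : Vec4) → CompatV ℓ (λ _ → v)
  CompatV-constant v n i = to-mod (≅-refl {pw ℓ n} {v i})

  CompatV-act : ∀ g x → CompatM ℓ g → CompatV ℓ x → CompatV ℓ (λ n → g n ·v x n)
  CompatV-act g x c d n i = to-mod (sumFin-≅ 4 {λ k → g (suc n) i k * x (suc n) k} {λ k → g n i k * x n k}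
    (λ k → ≅-* {m = pw ℓ n} (entry (CompatM-step g c n) i k) (compat-coordinate x d k (ℕₚ.n≤1+n n))))

  module _ (a : Fin 4 → ℕ) (a≤2 : ∀ i → a i ≤ 2) where

    -- Exponents up to 2 allow every membership to be tested at level 2, where `f` is read.
    divisible-2 : ∀ {x} → Diagonal a x → ∀ i → x 2 i ≅ + 0 ⟦ pw ℓ (a i) ⟧
    divisible-2 {x} d i = ≅-trans (compat-coordinate x (compatible d) i (a≤2 i)) (divisible d i)

    to-Diagonal : ∀ x → CompatV ℓ x → (∀ i → x 2 i ≅ + 0 ⟦ pw ℓ (a i) ⟧) → Diagonal a x
    to-Diagonal x c d = diag c λ i → ≅-trans (≅-sym (compat-coordinate x c i (a≤2 i))) (d i)

    Diagonal-lattice : Lattice ℓ (Diagonal a)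
    Diagonal-lattice = record
      { compat = λ x d → compatible d
      ; resp = λ x y d c e → diag c λ i → ≅-trans (≅-sym (from-mod (e (a i) i))) (divisible d i)
      ; zero∈ = diag (CompatV-constant (λ _ → + 0)) (λ i → ≅-refl)
      ; add = λ x y d e → diag (CompatV-add x y (compatible d) (compatible e)) (λ i → ≅-+ (divisible d i) (divisible e i))
      ; smul = λ c x p d → diag (CompatV-scale c x p (compatible d)) (λ i → ≅0-*ˡ (c (a i)) (divisible d i))
      ; finiteIndex = 2 , λ x c → diag (CompatV-scale (λ _ → pw ℓ 2) x (CompatZ-constant (pw ℓ 2)) c)
          (λ i → ≅0-*ʳ (x (a i) i) (≅-pw-≤ {ℓ} (a≤2 i) (by (+ 1) (e (pw ℓ 2)))))
      }
      where
      e : ∀ m → m ≡ + 0 + + 1 * m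
      e = solve-∀

    -- The vector (g - 1) ℓ^(a j) e_j has its i-th coordinate divisible by ℓ^(v i j + a j), so the
    -- inequality is the numerical criterion for g - 1 to map one diagonal lattice into the other.
    Diagonal-act-minus : (b : Fin 4 → ℕ) (v : Fin 4 → Fin 4 → ℕ) → (∀ i j → b i ≤ v i j ℕ.+ a j)
      → (g : MSeq) (x : VSeq) → (∀ i j → g 2 i j - I4 i j ≅ + 0 ⟦ pw ℓ (v i j) ⟧)
      → Diagonal a x → ∀ i → (g 2 ·v x 2) i - x 2 i ≅ + 0 ⟦ pw ℓ (b i) ⟧
    Diagonal-act-minus b v bound g x val d i =
      ≅-trans (≡⇒≅ (rewrite-sum i)) (sumFin-≅0 4 {λ j → (g 2 i j - I4 i j) * x 2 j} (λ j → ≅-pw-≤ {ℓ} {(g 2 i j - I4 i j) * x 2 j} {+ 0} {b i} {v i j ℕ.+ a j} (bound i j)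
        (subst ((g 2 i j - I4 i j) * x 2 j ≅ + 0 ⟦_⟧) (sym (pw-+ ℓ (v i j) (a j))) (≅0-*-* (val i j) (divisible-2 d j)))))
      where
      distrib : ∀ a b x → (a - b) * x ≡ a * x + - (+ 1) * (b * x)
      distrib = solve-∀
      identity : ∀ i → (I4 ·v x 2) i ≡ x 2 i
      identity 0F = e (x 2 0F) (x 2 1F) (x 2 2F) (x 2 3F)
        where
        e : ∀ a b c d → + 1 * a + (+ 0 * b + (+ 0 * c + (+ 0 * d + + 0))) ≡ a
        e = solve-∀
      identity 1F = e (x 2 0F) (x 2 1F) (x 2 2F) (x 2 3F)
        where
        e : ∀ a b c d → + 0 * a + (+ 1 * b + (+ 0 * c + (+ 0 * d + + 0))) ≡ b
        e = solve-∀
      identity 2F = e (x 2 0F) (x 2 1F) (x 2 2F) (x 2 3F)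
        where
        e : ∀ a b c d → + 0 * a + (+ 0 * b + (+ 1 * c + (+ 0 * d + + 0))) ≡ c
        e = solve-∀
      identity 3F = e (x 2 0F) (x 2 1F) (x 2 2F) (x 2 3F)
        where
        e : ∀ a b c d → + 0 * a + (+ 0 * b + (+ 0 * c + (+ 1 * d + + 0))) ≡ d
        e = solve-∀
      negate : ∀ a b → a + - (+ 1) * b ≡ a - b
      negate = solve-∀
      rewrite-sum : ∀ i → (g 2 ·v x 2) i - x 2 i ≡ sumFin 4 (λ j → (g 2 i j - I4 i j) * x 2 j)
      rewrite-sum i = sym
        (trans (sumFin-≡ 4 {λ j → (g 2 i j - I4 i j) * x 2 j} {λ j → g 2 i j * x 2 j + - (+ 1) * (I4 i j * x 2 j)}
                 (λ j → distrib (g 2 i j) (I4 i j) (x 2 j)))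
        (trans (sumFin-+ 4 (λ j → g 2 i j * x 2 j) (λ j → - (+ 1) * (I4 i j * x 2 j)))
        (trans (cong (λ z → (g 2 ·v x 2) i + z) (sym (sumFin-*ˡ 4 (- (+ 1)) (λ j → I4 i j * x 2 j))))
        (trans (negate ((g 2 ·v x 2) i) ((I4 ·v x 2) i)) (cong (λ z → (g 2 ·v x 2) i - z) (identity i))))))

  module _ .{{_ : ℕ.NonZero ℓ}} (a b : Fin 4 → ℕ) (p q : Fin 4) (q≢p : q ≢ p)
           (bp : b p ≡ suc (a p)) (bq : b q ≡ suc (a q))
           (rest : ∀ k → k ≡ p ⊎ k ≡ q ⊎ b k ≡ a k) where

    private
      -- All coordinates other than `p` receive `w`. Outside `q` this is harmless, because there
      -- `b k ≡ a k` and every multiple of ℓ^(a k) vanishes in the quotient.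
      digit : ℕ → ℕ → Fin 4 → ℕ
      digit u w k with k ≟ᶠ p
      ... | yes _ = u
      ... | no  _ = w

      digit-p : ∀ u w → digit u w p ≡ u
      digit-p u w with p ≟ᶠ p
      ... | yes _ = refl
      ... | no  n = ⊥-elim (n refl)

      digit-q : ∀ u w → digit u w q ≡ w
      digit-q u w with q ≟ᶠ p
      ... | yes e = ⊥-elim (q≢p e)
      ... | no  _ = refl

      representative : ℕ → ℕ → VSeq
      representative u w _ k = + digit u w k * pw ℓ (a k)

      ℓ*1≡ℓ : ℓ ℕ.* 1 ≡ ℓ
      ℓ*1≡ℓ = ℕₚ.*-identityʳ ℓ

      factor : ∀ u v m → u * m - v * m ≡ m * (u - v)
      factor = solve-∀

      digit-equal : ∀ {k u v} → b k ≡ suc (a k) → u ℕ.< ℓ → v ℕ.< ℓ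
        → + u * pw ℓ (a k) - + v * pw ℓ (a k) ≅ + 0 ⟦ pw ℓ (b k) ⟧ → u ≡ v
      digit-equal {k} {u} {v} bk u<ℓ v<ℓ e = <-≅⇒≡ u<ℓ v<ℓ (minus≅0⇒≅ (≅-cancel (pw ℓ (a k)) {{pw-nonZero ℓ (a k)}}
        (≅-trans (≡⇒≅ (sym (factor (+ u) (+ v) (pw ℓ (a k)))))
        (≅-trans (subst (+ u * pw ℓ (a k) - + v * pw ℓ (a k) ≅ + 0 ⟦_⟧)
                        (trans (cong (pw ℓ) bk) (trans (pw-suc ℓ (a k)) (ℤₚ.*-comm (+ ℓ) (pw ℓ (a k))))) e)
                 (≡⇒≅ (sym (ℤₚ.*-zeroʳ (pw ℓ (a k)))))))))

      digit-exists : ∀ {k} → b k ≡ suc (a k) → (z : ℤ) → z ≅ + 0 ⟦ pw ℓ (a k) ⟧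
        → ∃ λ u → u ℕ.< ℓ × z - + u * pw ℓ (a k) ≅ + 0 ⟦ pw ℓ (b k) ⟧
      digit-exists {k} bk z p = u , ℤ/.n%ℕd<d y ℓ ,
        ≅-trans (≡⇒≅ (trans (cong (_- + u * pw ℓ (a k)) (≅0-quot p)) (factor y (+ u) (pw ℓ (a k)))))
        (≅-trans (subst (pw ℓ (a k) * (y - + u) ≅ pw ℓ (a k) * + 0 ⟦_⟧)
                   (sym (trans (cong (pw ℓ) bk) (trans (pw-suc ℓ (a k)) (ℤₚ.*-comm (+ ℓ) (pw ℓ (a k))))))
                   (≅-scale (pw ℓ (a k)) (≅⇒minus≅0 (by (y ℤ/./ℕ ℓ) (ℤ/.a≡a%ℕn+[a/ℕn]*n y ℓ)))))
                 (≡⇒≅ (ℤₚ.*-zeroʳ (pw ℓ (a k)))))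
        where
        y = quot p
        u = y ℤ/.%ℕ ℓ

      -- `ℓ ^ 2` unfolds to `ℓ * (ℓ * 1)`, whence the second factor `ℓ * 1`.
      digits : Fin (ℓ ℕ.^ 2) → ℕ × ℕ
      digits s = toℕ (proj₁ (remQuot {ℓ} (ℓ ℕ.* 1) s)) , toℕ (proj₂ (remQuot {ℓ} (ℓ ℕ.* 1) s))

      digits-injective : ∀ s t → digits s ≡ digits t → s ≡ t
      digits-injective s t e =
        trans (sym (combine-remQuot {ℓ} (ℓ ℕ.* 1) s))
        (trans (cong₂ combine (toℕ-injective (cong proj₁ e)) (toℕ-injective (cong proj₂ e)))
               (combine-remQuot {ℓ} (ℓ ℕ.* 1) t))

      digits-surjective : ∀ u w → u ℕ.< ℓ → w ℕ.< ℓ → ∃ λ s → digits s ≡ (u , w)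
      digits-surjective u w u<ℓ w<ℓ = combine u' w' ,
        trans (cong (λ z → toℕ (proj₁ z) , toℕ (proj₂ z)) (remQuot-combine u' w'))
              (cong₂ _,_ (toℕ-fromℕ< u<ℓ) (toℕ-fromℕ< w<ℓ*1))
        where
        w<ℓ*1 = subst (w ℕ.<_) (sym ℓ*1≡ℓ) w<ℓ
        u' = fromℕ< u<ℓ
        w' = fromℕ< w<ℓ*1

      digit₁< : ∀ s → proj₁ (digits s) ℕ.< ℓ
      digit₁< s = toℕ<n (proj₁ (remQuot {ℓ} (ℓ ℕ.* 1) s))

      digit₂< : ∀ s → proj₂ (digits s) ℕ.< ℓ
      digit₂< s = subst (proj₂ (digits s) ℕ.<_) ℓ*1≡ℓ (toℕ<n (proj₂ (remQuot {ℓ} (ℓ ℕ.* 1) s)))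

      rep : Fin (ℓ ℕ.^ 2) → VSeq
      rep s = representative (proj₁ (digits s)) (proj₂ (digits s))

    Diagonal-index : Index ℓ (Diagonal a) (Diagonal b) (ℓ ℕ.^ 2)
    Diagonal-index = rep
      , (λ s → diag (CompatV-constant (rep s 0)) (λ i → multiple≅0 (+ digit (proj₁ (digits s)) (proj₂ (digits s)) i)))
      , (λ s t d → digits-injective s t (cong₂ _,_
          (digit-equal bp (digit₁< s) (digit₁< t)
            (subst₂ (λ u v → + u * pw ℓ (a p) - + v * pw ℓ (a p) ≅ + 0 ⟦ pw ℓ (b p) ⟧)
              (digit-p (proj₁ (digits s)) (proj₂ (digits s))) (digit-p (proj₁ (digits t)) (proj₂ (digits t))) (divisible d p)))
          (digit-equal bq (digit₂< s) (digit₂< t)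
            (subst₂ (λ u v → + u * pw ℓ (a q) - + v * pw ℓ (a q) ≅ + 0 ⟦ pw ℓ (b q) ⟧)
              (digit-q (proj₁ (digits s)) (proj₂ (digits s))) (digit-q (proj₁ (digits t)) (proj₂ (digits t))) (divisible d q)))))
      , covered
      where
      covered : ∀ x → Diagonal a x → ∃ λ s → Diagonal b (λ n k → x n k - rep s n k)
      covered x d =
        let a≤b = λ k (e : b k ≡ suc (a k)) → subst (a k ≤_) (sym e) (ℕₚ.n≤1+n (a k))
            at = λ k e → ≅-trans (compat-coordinate x (compatible d) k (a≤b k e)) (divisible d k)
            u , u<ℓ , eu = digit-exists bp (x (b p) p) (at p bp)
            w , w<ℓ , ew = digit-exists bq (x (b q) q) (at q bq)
            s , es = digits-surjective u w u<ℓ w<ℓ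
        in s , subst (λ z → Diagonal b (λ n k → x n k - representative (proj₁ z) (proj₂ z) n k)) (sym es)
             (diag (CompatV-minus x (representative u w) (compatible d) (CompatV-constant (representative u w 0)))
               (λ k → [ (λ { refl → subst (λ z → x (b p) p - + z * pw ℓ (a p) ≅ + 0 ⟦ pw ℓ (b p) ⟧) (sym (digit-p u w)) eu })
                      , [ (λ { refl → subst (λ z → x (b q) q - + z * pw ℓ (a q) ≅ + 0 ⟦ pw ℓ (b q) ⟧) (sym (digit-q u w)) ew })
                        , (λ e → subst (λ m → x m k - + digit u w k * pw ℓ (a k) ≅ + 0 ⟦ pw ℓ m ⟧) (sym e)
                                   (≅-minus (divisible d k) (multiple≅0 (+ digit u w k)))) ]′ ]′ (rest k)))

    module _ (a≤2 : ∀ i → a i ≤ 2) (b≤2 : ∀ i → b i ≤ 2) (a≤b : ∀ i → a i ≤ b i)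
             (v : Fin 4 → Fin 4 → ℕ) (bound : ∀ i j → b i ≤ v i j ℕ.+ a j)
             (G : MSeq → Set) (compat : ∀ g → G g → CompatM ℓ g)
             (valuation : ∀ g → G g → ∀ i j → g 2 i j - I4 i j ≅ + 0 ⟦ pw ℓ (v i j) ⟧) where

      private
        b⊆a : ∀ x → Diagonal b x → Diagonal a x
        b⊆a x d = to-Diagonal a a≤2 x (compatible d)
          (λ i → ≅-pw-≤ {ℓ} (a≤b i) (divisible-2 b b≤2 d i))

        trivial : TrivialOnQuot ℓ G (Diagonal a) (Diagonal b)
        trivial g x g∈G d = to-Diagonal b b≤2 (λ n k → (g n ·v x n) k - x n k)
          (CompatV-minus (λ n → g n ·v x n) x (CompatV-act g x (compat g g∈G) (compatible d)) (compatible d))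
          (Diagonal-act-minus a a≤2 b v bound g x (valuation g g∈G) d)

        -- As gx = (g - 1)x + x and (g - 1)x already lies in the smaller lattice, every lattice
        -- between the two is stable.
        stable : ∀ c → (c≤2 : ∀ i → c i ≤ 2) → (∀ x → Diagonal c x → Diagonal a x)
               → (∀ x → Diagonal b x → Diagonal c x) → Stable ℓ G (Diagonal c)
        stable c c≤2 c⊆a b⊆c g x g∈G d = to-Diagonal c c≤2 (λ n → g n ·v x n)
          (CompatV-act g x (compat g g∈G) (compatible d))
          (λ i → ≅-trans (≡⇒≅ (e ((g 2 ·v x 2) i) (x 2 i)))
            (≅-+ (divisible-2 c c≤2 (b⊆c _ (trivial g x g∈G (c⊆a x d))) i) (divisible-2 c c≤2 d i)))
          where
          e : ∀ a b → a ≡ a - b + b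
          e = solve-∀

      diagonal-GoodPair : GoodPair ℓ G
      diagonal-GoodPair = Diagonal a , Diagonal b , Diagonal-lattice a a≤2 , Diagonal-lattice b b≤2 , b⊆a
        , stable a a≤2 (λ x d → d) b⊆a , stable b b≤2 b⊆a (λ x d → d) , Diagonal-index , trivial

-- Lower bounds for the ℓ-adic valuations of the entries of g - 1.
valuations : (fᵥ αᵥ γᵥ : ℕ) → Fin 4 → Fin 4 → ℕ
valuations fᵥ αᵥ γᵥ 0F 3F = fᵥ
valuations fᵥ αᵥ γᵥ 1F 0F = αᵥ
valuations fᵥ αᵥ γᵥ 2F 1F = γᵥ
valuations fᵥ αᵥ γᵥ 3F 2F = αᵥ
valuations fᵥ αᵥ γᵥ 2F 0F = 0
valuations fᵥ αᵥ γᵥ 3F 0F = 0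
valuations fᵥ αᵥ γᵥ 3F 1F = 0
valuations fᵥ αᵥ γᵥ _  _  = 1

module _ (ℓ : ℕ) where

  valuations-hold : ∀ g → InS ℓ g → ∀ fᵥ αᵥ γᵥ
    → g 2 0F 3F ≅ + 0 ⟦ pw ℓ fᵥ ⟧ → g 2 1F 0F ≅ + 0 ⟦ pw ℓ αᵥ ⟧
    → g 2 3F 2F ≅ + 0 ⟦ pw ℓ αᵥ ⟧ → g 2 2F 1F ≅ + 0 ⟦ pw ℓ γᵥ ⟧
    → ∀ i j → g 2 i j - I4 i j ≅ + 0 ⟦ pw ℓ (valuations fᵥ αᵥ γᵥ i j) ⟧
  valuations-hold g s fᵥ αᵥ γᵥ f α α' γ = hold
    where
    lt = InS-lower g s 1≤2
    di : ∀ i → g 2 i i ≅ + 1 ⟦ pw ℓ 1 ⟧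
    di i = from-mod-1 ℓ (diagonal lt i)
    up : ∀ i j → toℕ i ℕ.< toℕ j → g 2 i j ≅ + 0 ⟦ pw ℓ 1 ⟧
    up i j i<j = from-mod-1 ℓ (upper lt i j i<j)
    hold : ∀ i j → g 2 i j - I4 i j ≅ + 0 ⟦ pw ℓ (valuations fᵥ αᵥ γᵥ i j) ⟧
    hold 0F 0F = ≅⇒minus≅0 (di 0F)
    hold 0F 1F = ≅⇒minus≅0 (up 0F 1F (s≤s z≤n))
    hold 0F 2F = ≅⇒minus≅0 (up 0F 2F (s≤s z≤n))
    hold 0F 3F = ≅⇒minus≅0 f
    hold 1F 0F = ≅⇒minus≅0 α
    hold 1F 1F = ≅⇒minus≅0 (di 1F)
    hold 1F 2F = ≅⇒minus≅0 (up 1F 2F (s≤s (s≤s z≤n)))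
    hold 1F 3F = ≅⇒minus≅0 (up 1F 3F (s≤s (s≤s z≤n)))
    hold 2F 0F = ≅-pw-0 {ℓ}
    hold 2F 1F = ≅⇒minus≅0 γ
    hold 2F 2F = ≅⇒minus≅0 (di 2F)
    hold 2F 3F = ≅⇒minus≅0 (up 2F 3F (s≤s (s≤s (s≤s z≤n))))
    hold 3F 0F = ≅-pw-0 {ℓ}
    hold 3F 1F = ≅-pw-0 {ℓ}
    hold 3F 2F = ≅⇒minus≅0 α'
    hold 3F 3F = ≅⇒minus≅0 (di 3F)

exponents : ℕ → ℕ → ℕ → ℕ → Fin 4 → ℕ
exponents a b c d 0F = a
exponents a b c d 1F = b
exponents a b c d 2F = c
exponents a b c d 3F = d

module _ (ℓ : ℕ) .{{_ : ℕ.NonZero ℓ}} (G : MSeq → Set) (G⊆S : ∀ g → G g → InS ℓ g) where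

  private
    compat : ∀ g → G g → CompatM ℓ g
    compat g g∈G = proj₁ (proj₁ (G⊆S g g∈G))

    f-divisible : ∀ g → G g → g 2 0F 3F ≅ + 0 ⟦ pw ℓ 1 ⟧
    f-divisible g g∈G = from-mod-1 ℓ (upper (InS-lower g (G⊆S g g∈G) 1≤2) 0F 3F (s≤s z≤n))

  -- This pair and the next two are ρ^i T ⊃ ρ^(i+2) T for i = 3, 0, 1, with ℓ in place of 2. The
  -- quotients are spanned by e₄, ℓe₁, by e₁, e₂ and by e₂, e₃, and the only obstruction to a
  -- trivial action is the entry f, α or γ that takes the first vector to the second.
  f-trivial-GoodPair : fTrivial ℓ G → GoodPair ℓ G
  f-trivial-GoodPair t = diagonal-GoodPair ℓ a b 0F 3F (λ ()) refl refl
    (λ { 0F → inj₁ refl ; 1F → inj₂ (inj₂ refl) ; 2F → inj₂ (inj₂ refl) ; 3F → inj₂ (inj₁ refl) })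
    (toWitness {a? = all? λ i → a i ℕ.≤? 2} tt) (toWitness {a? = all? λ i → b i ℕ.≤? 2} tt)
    (toWitness {a? = all? λ i → a i ℕ.≤? b i} tt) v (toWitness {a? = all? λ i → all? λ j → b i ℕ.≤? v i j ℕ.+ a j} tt)
    G compat (λ g g∈G → valuations-hold ℓ g (G⊆S g g∈G) 2 0 0 (from-mod (t g g∈G))
      (≅-pw-0 {ℓ}) (≅-pw-0 {ℓ}) (≅-pw-0 {ℓ}))
    where
    a = exponents 1 1 1 0
    b = exponents 2 1 1 1
    v = valuations 2 0 0

  α-trivial-GoodPair : (∀ g → G g → αₛ g ≅ + 0 ⟦ + ℓ ⟧) → GoodPair ℓ G
  α-trivial-GoodPair t = diagonal-GoodPair ℓ a b 0F 1F (λ ()) refl refl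
    (λ { 0F → inj₁ refl ; 1F → inj₂ (inj₁ refl) ; 2F → inj₂ (inj₂ refl) ; 3F → inj₂ (inj₂ refl) })
    (toWitness {a? = all? λ i → a i ℕ.≤? 2} tt) (toWitness {a? = all? λ i → b i ℕ.≤? 2} tt)
    (toWitness {a? = all? λ i → a i ℕ.≤? b i} tt) v (toWitness {a? = all? λ i → all? λ j → b i ℕ.≤? v i j ℕ.+ a j} tt)
    G compat (λ g g∈G → valuations-hold ℓ g (G⊆S g g∈G) 1 1 0 (f-divisible g g∈G)
      (from-mod-1 ℓ (t g g∈G))
      (from-mod-1 ℓ (≅-trans (entry-32 (InS-lower g (G⊆S g g∈G) 1≤2) (InS-form g (G⊆S g g∈G))) (≅-neg (t g g∈G))))
      (≅-pw-0 {ℓ}))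
    where
    a = exponents 0 0 0 0
    b = exponents 1 1 0 0
    v = valuations 1 1 0

  γ-trivial-GoodPair : (∀ g → G g → γₛ g ≅ + 0 ⟦ + ℓ ⟧) → GoodPair ℓ G
  γ-trivial-GoodPair t = diagonal-GoodPair ℓ a b 1F 2F (λ ()) refl refl
    (λ { 0F → inj₂ (inj₂ refl) ; 1F → inj₁ refl ; 2F → inj₂ (inj₁ refl) ; 3F → inj₂ (inj₂ refl) })
    (toWitness {a? = all? λ i → a i ℕ.≤? 2} tt) (toWitness {a? = all? λ i → b i ℕ.≤? 2} tt)
    (toWitness {a? = all? λ i → a i ℕ.≤? b i} tt) v (toWitness {a? = all? λ i → all? λ j → b i ℕ.≤? v i j ℕ.+ a j} tt)
    G compat (λ g g∈G → valuations-hold ℓ g (G⊆S g g∈G) 1 0 1 (f-divisible g g∈G)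
      (≅-pw-0 {ℓ}) (≅-pw-0 {ℓ}) (from-mod-1 ℓ (t g g∈G)))
    where
    a = exponents 1 0 0 0
    b = exponents 1 1 1 0
    v = valuations 1 0 1

-- From 2-adic lattices to integer vectors.

coordinates : ℤ⁴ → Vec4
coordinates v 0F = x₁ v
coordinates v 1F = x₂ v
coordinates v 2F = x₃ v
coordinates v 3F = x₄ v

from-coordinates : Vec4 → ℤ⁴
from-coordinates v = ⟨ v 0F , v 1F , v 2F , v 3F ⟩

coordinates-from : ∀ v i → coordinates (from-coordinates v) i ≡ v i
coordinates-from v 0F = refl
coordinates-from v 1F = refl
coordinates-from v 2F = refl
coordinates-from v 3F = refl

coordinates-⊞ : ∀ u v i → coordinates (u ⊞ v) i ≡ coordinates u i + coordinates v i
coordinates-⊞ u v 0F = refl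
coordinates-⊞ u v 1F = refl
coordinates-⊞ u v 2F = refl
coordinates-⊞ u v 3F = refl

coordinates-⊡ : ∀ k v i → coordinates (k ⊡ v) i ≡ k * coordinates v i
coordinates-⊡ k v 0F = refl
coordinates-⊡ k v 1F = refl
coordinates-⊡ k v 2F = refl
coordinates-⊡ k v 3F = refl

-- An integer vector seen as an ℓ-adic one. As a lattice contains some ℓ^k T, each of its cosets
-- contains such vectors.
constant : ℤ⁴ → VSeq
constant v _ = coordinates v

module _ (ℓ : ℕ) .{{_ : ℕ.NonZero ℓ}} {L : VSeq → Set} (lattice : Lattice ℓ L) where

  open Lattice lattice

  private
    k = proj₁ finiteIndex

  -- `finiteIndex` supplies only vectors displayed as multiples of ℓ^k, so `z` has to be divided by
  -- ℓ^k as a compatible sequence.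
  lattice-contains-multiples : ∀ z → CompatV ℓ z → (∀ i → z k i ≅ + 0 ⟦ pw ℓ k ⟧) → L z
  lattice-contains-multiples z c p =
    resp (λ n i → pw ℓ k * y n i) z (proj₂ finiteIndex y y-compat) c
      (λ n i → to-mod {m = pw ℓ n} (≅-trans (≡⇒≅ (sym (z≡ n i))) (compat-coordinate ℓ z c i (ℕₚ.m≤n+m n k))))
    where
    z≅0 : ∀ n i → z (k ℕ.+ n) i ≅ + 0 ⟦ pw ℓ k ⟧
    z≅0 n i = ≅-trans (compat-coordinate ℓ z c i (ℕₚ.m≤m+n k n)) (p i)
    y : VSeq
    -- The quotient is taken from level k + n, because division by ℓ^k costs k digits of precision.
    y n i = quot (z≅0 n i)
    z≡ : ∀ n i → z (k ℕ.+ n) i ≡ pw ℓ k * y n i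
    z≡ n i = trans (≅0-quot (z≅0 n i)) (ℤₚ.*-comm (y n i) (pw ℓ k))
    y-compat : CompatV ℓ y
    y-compat n i = to-mod (≅-cancel (pw ℓ k) {{pw-nonZero ℓ k}}
      (subst₂ (λ a b → a ≅ b ⟦ pw ℓ k * pw ℓ n ⟧) (z≡ (suc n) i) (z≡ n i)
        (subst (z (k ℕ.+ suc n) i ≅ z (k ℕ.+ n) i ⟦_⟧) (pw-+ ℓ k n)
          (compat-coordinate ℓ z c i (ℕₚ.+-monoʳ-≤ k (ℕₚ.n≤1+n n))))))

  lattice-approximation : ∀ N → k ≤ N → ∀ z → CompatV ℓ z → (∀ i → z N i ≅ + 0 ⟦ pw ℓ N ⟧) → L z
  lattice-approximation N k≤N z c p = lattice-contains-multiples z c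
    (λ i → ≅-trans (≅-sym (compat-coordinate ℓ z c i k≤N)) (≅-pw-≤ {ℓ} k≤N (p i)))

module _ {A : Mat4} (lt : LowerUnitriangular 2 A) where

  -- The parameters of g - 1 as an element of the radical of the Iwahori order.
  parameters : Mat4
  parameters 0F 0F = quot (diagonal lt 0F)
  parameters 1F 1F = quot (diagonal lt 1F)
  parameters 2F 2F = quot (diagonal lt 2F)
  parameters 3F 3F = quot (diagonal lt 3F)
  parameters 0F 1F = quot (upper lt 0F 1F (s≤s z≤n))
  parameters 0F 2F = quot (upper lt 0F 2F (s≤s z≤n))
  parameters 0F 3F = quot (upper lt 0F 3F (s≤s z≤n))
  parameters 1F 2F = quot (upper lt 1F 2F (s≤s (s≤s z≤n)))
  parameters 1F 3F = quot (upper lt 1F 3F (s≤s (s≤s z≤n)))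
  parameters 2F 3F = quot (upper lt 2F 3F (s≤s (s≤s (s≤s z≤n))))
  parameters 1F 0F = A 1F 0F
  parameters 2F 0F = A 2F 0F
  parameters 2F 1F = A 2F 1F
  parameters 3F 0F = A 3F 0F
  parameters 3F 1F = A 3F 1F
  parameters 3F 2F = A 3F 2F

  private
    row : ∀ {a a' b b' c c' d d'} x y z w s {r} → a ≡ a' → b ≡ b' → c ≡ c' → d ≡ d'
        → a' * x + (b' * y + (c' * z + (d' * w + + 0))) - s ≡ r
        → a * x + (b * y + (c * z + (d * w + + 0))) - s ≡ r
    row x y z w s refl refl refl refl e = e

  act-parameters : ∀ v i → (A ·v coordinates v) i - coordinates v i ≡ coordinates (act parameters v) i
  act-parameters v 0F = row (x₁ v) (x₂ v) (x₃ v) (x₄ v) (x₁ v)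
    (equal (diagonal lt 0F)) (equal (upper lt 0F 1F (s≤s z≤n))) (equal (upper lt 0F 2F (s≤s z≤n))) (equal (upper lt 0F 3F (s≤s z≤n)))
    (e (parameters 0F 0F) (parameters 0F 1F) (parameters 0F 2F) (parameters 0F 3F) (x₁ v) (x₂ v) (x₃ v) (x₄ v))
    where
    e : ∀ p q r s x y z w → (+ 1 + p * + 2) * x + ((+ 0 + q * + 2) * y + ((+ 0 + r * + 2) * z + ((+ 0 + s * + 2) * w + + 0))) - x
      ≡ + 2 * (p * x + q * y + r * z + s * w)
    e = solve-∀
  act-parameters v 1F = row (x₁ v) (x₂ v) (x₃ v) (x₄ v) (x₂ v)
    (refl {x = A 1F 0F}) (equal (diagonal lt 1F)) (equal (upper lt 1F 2F (s≤s (s≤s z≤n)))) (equal (upper lt 1F 3F (s≤s (s≤s z≤n))))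
    (e (parameters 1F 0F) (parameters 1F 1F) (parameters 1F 2F) (parameters 1F 3F) (x₁ v) (x₂ v) (x₃ v) (x₄ v))
    where
    e : ∀ p q r s x y z w → p * x + ((+ 1 + q * + 2) * y + ((+ 0 + r * + 2) * z + ((+ 0 + s * + 2) * w + + 0))) - y
      ≡ p * x + + 2 * (q * y + r * z + s * w)
    e = solve-∀
  act-parameters v 2F = row (x₁ v) (x₂ v) (x₃ v) (x₄ v) (x₃ v)
    (refl {x = A 2F 0F}) (refl {x = A 2F 1F}) (equal (diagonal lt 2F)) (equal (upper lt 2F 3F (s≤s (s≤s (s≤s z≤n)))))
    (e (parameters 2F 0F) (parameters 2F 1F) (parameters 2F 2F) (parameters 2F 3F) (x₁ v) (x₂ v) (x₃ v) (x₄ v))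
    where
    e : ∀ p q r s x y z w → p * x + (q * y + ((+ 1 + r * + 2) * z + ((+ 0 + s * + 2) * w + + 0))) - z
      ≡ p * x + q * y + + 2 * (r * z + s * w)
    e = solve-∀
  act-parameters v 3F = row (x₁ v) (x₂ v) (x₃ v) (x₄ v) (x₄ v)
    (refl {x = A 3F 0F}) (refl {x = A 3F 1F}) (refl {x = A 3F 2F}) (equal (diagonal lt 3F))
    (e (parameters 3F 0F) (parameters 3F 1F) (parameters 3F 2F) (parameters 3F 3F) (x₁ v) (x₂ v) (x₃ v) (x₄ v))
    where
    e : ∀ p q r s x y z w → p * x + (q * y + (r * z + ((+ 1 + s * + 2) * w + + 0))) - w
      ≡ p * x + q * y + r * z + + 2 * (s * w)
    e = solve-∀

-I : MSeq
-I n i j = - I4 i j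

-I-act : ∀ v i → ((λ i j → - I4 i j) ·v coordinates v) i - coordinates v i ≡ coordinates (- (+ 2) ⊡ v) i
-I-act v 0F = e (x₁ v) (x₂ v) (x₃ v) (x₄ v)
  where
  e : ∀ x y z w → -[1+ 0 ] * x + (+ 0 * y + (+ 0 * z + (+ 0 * w + + 0))) - x ≡ - (+ 2) * x
  e = solve-∀
-I-act v 1F = e (x₁ v) (x₂ v) (x₃ v) (x₄ v)
  where
  e : ∀ x y z w → + 0 * x + (-[1+ 0 ] * y + (+ 0 * z + (+ 0 * w + + 0))) - y ≡ - (+ 2) * y
  e = solve-∀
-I-act v 2F = e (x₁ v) (x₂ v) (x₃ v) (x₄ v)
  where
  e : ∀ x y z w → + 0 * x + (+ 0 * y + (-[1+ 0 ] * z + (+ 0 * w + + 0))) - z ≡ - (+ 2) * z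
  e = solve-∀
-I-act v 3F = e (x₁ v) (x₂ v) (x₃ v) (x₄ v)
  where
  e : ∀ x y z w → + 0 * x + (+ 0 * y + (+ 0 * z + (-[1+ 0 ] * w + + 0))) - w ≡ - (+ 2) * w
  e = solve-∀

module _ (lem : (P : Set) → Dec P) (G : MSeq → Set) (G⊆S : ∀ g → G g → InS 2 g) (-I∈G : G -I)
  (A C F : MSeq) (A∈G : G A) (C∈G : G C) (F∈G : G F)
  (α-odd : Odd (αₛ A)) (γ-odd : Odd (γₛ C)) (f-odd : Odd (fₛ F (G⊆S F F∈G))) where

  private
    module _ {L L' : VSeq → Set} (lattice : Lattice 2 L) (lattice' : Lattice 2 L') (L'⊆L : ∀ x → L' x → L x)
      (trivial : TrivialOnQuot 2 G L L') where

      module L  = Lattice lattice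
      module L' = Lattice lattice'

      -- Large enough for 2^N T to lie in L', and at least 2 so that the truncation at level `N`
      -- still shows `f`, which is read modulo 4.
      N : ℕ
      N = suc (suc (proj₁ L'.finiteIndex))

      k≤N : proj₁ L'.finiteIndex ≤ N
      k≤N = ℕₚ.m≤n+m _ 2

      2≤N : 2 ≤ N
      2≤N = s≤s (s≤s z≤n)

      1≤N : 1 ≤ N
      1≤N = s≤s z≤n

      difference∈L' : ∀ z w → CompatV 2 z → CompatV 2 w → (∀ i → z N i ≅ w N i ⟦ pw 2 N ⟧)
                    → L' (λ n i → z n i - w n i)
      difference∈L' z w cz cw p = lattice-approximation 2 lattice' N k≤N (λ n i → z n i - w n i)
        (CompatV-minus 2 z w cz cw) (λ i → ≅⇒minus≅0 (p i))

      cancel : ∀ z w → z - w + w ≡ z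
      cancel = solve-∀

      -- Vectors that agree at level `N` differ by an element of 2^N T, hence of L'. This lets a
      -- vector that varies with the level be exchanged for a constant one.
      approximate' : ∀ z w → CompatV 2 z → L' w → (∀ i → z N i ≅ w N i ⟦ pw 2 N ⟧) → L' z
      approximate' z w cz w∈ p =
        L'.resp (λ n i → z n i - w n i + w n i) z
          (L'.add (λ n i → z n i - w n i) w (difference∈L' z w cz (L'.compat w w∈) p) w∈) cz
          (λ n i → to-mod {m = pw 2 n} (≡⇒≅ (cancel (z n i) (w n i))))

      approximate : ∀ z w → CompatV 2 z → L w → (∀ i → z N i ≅ w N i ⟦ pw 2 N ⟧) → L z
      approximate z w cz w∈ p =
        L.resp (λ n i → z n i - w n i + w n i) z
          (L.add (λ n i → z n i - w n i) w (L'⊆L _ (difference∈L' z w cz (L.compat w w∈) p)) w∈) cz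
          (λ n i → to-mod {m = pw 2 n} (≡⇒≅ (cancel (z n i) (w n i))))

      Λ Λ' : ℤ⁴ → Set
      Λ  v = L (constant v)
      Λ' v = L' (constant v)

      constant-compat : ∀ v → CompatV 2 (constant v)
      constant-compat v = CompatV-constant 2 (coordinates v)

      Λ'-submodule : IsSubmodule Λ'
      Λ'-submodule = record
        { add = λ {u} {v} p q → approximate' (constant (u ⊞ v)) (λ n i → constant u n i + constant v n i)
            (constant-compat (u ⊞ v)) (L'.add _ _ p q) (λ i → ≡⇒≅ (coordinates-⊞ u v i))
        ; smul = λ k {v} p → approximate' (constant (k ⊡ v)) (λ n i → k * constant v n i)
            (constant-compat (k ⊡ v)) (L'.smul (λ _ → k) _ (CompatZ-constant 2 k) p) (λ i → ≡⇒≅ (coordinates-⊡ k v i))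
        }

      lowerN : ∀ g → G g → LowerUnitriangular 2 (g N)
      lowerN g g∈G = InS-lower g (G⊆S g g∈G) 1≤N

      -- The vector (g - 1)v varies with the level; at level `N` it is the integer vector obtained
      -- from the parameters of `g N`, and agreement there is enough.
      act∈ : ∀ g (g∈G : G g) {v} → Λ v → Λ' (act (parameters (lowerN g g∈G)) v)
      act∈ g g∈G {v} v∈ = approximate' (constant (act (parameters (lowerN g g∈G)) v))
        (λ n i → (g n ·v coordinates v) i - coordinates v i)
        (constant-compat (act (parameters (lowerN g g∈G)) v)) (trivial g (constant v) g∈G v∈)
        (λ i → ≡⇒≅ (sym (act-parameters (lowerN g g∈G) v i)))

      double∈Λ' : ∀ {v} → Λ v → Λ' (+ 2 ⊡ v)
      double∈Λ' {v} v∈ = subst Λ' (⟨⟩-cong (e (x₁ v)) (e (x₂ v)) (e (x₃ v)) (e (x₄ v)))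
        (IsSubmodule.smul Λ'-submodule (- (+ 1)) { - (+ 2) ⊡ v}
          (approximate' (constant (- (+ 2) ⊡ v)) (λ n i → ((λ i j → - I4 i j) ·v coordinates v) i - coordinates v i)
            (constant-compat (- (+ 2) ⊡ v)) (trivial -I (constant v) -I∈G v∈) (λ i → ≡⇒≅ (sym (-I-act v i)))))
        where
        e : ∀ x → - (+ 1) * (- (+ 2) * x) ≡ + 2 * x
        e = solve-∀

      level-N-mod-4 : ∀ g → G g → g N ≊ g 2 ⟦ pw 2 2 ⟧
      level-N-mod-4 g g∈G = CompatM-≤ {2} {g} (proj₁ (proj₁ (G⊆S g g∈G))) 2≤N

      level-N-mod-2 : ∀ g → G g → g N ≊ g 2 ⟦ + 2 ⟧
      level-N-mod-2 g g∈G = ≊-mod-ℓ {2} {n = 2} 1≤2 (level-N-mod-4 g g∈G)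

      AN-odd : Odd (A N 1F 0F)
      AN-odd = ≅-trans (entry (level-N-mod-2 A A∈G) 1F 0F) α-odd

      f-parameter : Odd (parameters (lowerN F F∈G) 0F 3F)
      f-parameter = ≅-trans (≅-cancel (+ 2) (≅-trans (≡⇒≅ (sym (≡quot F-upper)))
        (≅-trans (entry (level-N-mod-4 F F∈G) 0F 3F) (≡⇒≅ (fₛ-entry F (G⊆S F F∈G)))))) f-odd
        where
        F-upper : F N 0F 3F ≅ + 0 ⟦ + 2 ⟧
        F-upper = upper (lowerN F F∈G) 0F 3F (s≤s z≤n)
        ≡quot : ∀ {a} (p : a ≅ + 0 ⟦ + 2 ⟧) → a ≡ + 2 * quot p
        ≡quot p = trans (≅0-quot p) (ℤₚ.*-comm (quot p) (+ 2))

      acts-trivially : ActsTrivially Λ Λ' (parameters (lowerN A A∈G)) (parameters (lowerN C C∈G))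
                                          (parameters (lowerN A A∈G)) (parameters (lowerN F F∈G))
      acts-trivially = record
        { submodule = Λ'-submodule
        ; inclusion = L'⊆L _
        ; act-A₁ = act∈ A A∈G
        ; act-A₂ = act∈ C C∈G
        ; act-A₃ = act∈ A A∈G
        ; act-A₀ = act∈ F F∈G
        ; double = double∈Λ'
        ; s₁-odd = AN-odd
        ; s₂-odd = ≅-trans (entry (level-N-mod-2 C C∈G) 2F 1F) γ-odd
        ; s₃-odd = ≅-trans (entry-32 (lowerN A A∈G) (≊-mod-ℓ {2} {n = N} 1≤N (IsSp-form A (proj₁ (G⊆S A A∈G)) N)))
                           (≅-trans (≅-neg AN-odd) (by -[1+ 0 ] refl))
        ; s₀-odd = f-parameter
        }

      pwN∈Λ' : ∀ v → Λ' (pw 2 N ⊡ v)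
      pwN∈Λ' v = lattice-approximation 2 lattice' N k≤N (constant (pw 2 N ⊡ v)) (constant-compat (pw 2 N ⊡ v))
        (λ i → ≅-trans (≡⇒≅ (trans (coordinates-⊡ (pw 2 N) v i) (ℤₚ.*-comm (pw 2 N) (coordinates v i))))
                       (multiple≅0 (coordinates v i)))

      module _ (r : Fin 4 → VSeq) (r∈L : ∀ i → L (r i))
               (separated : ∀ i j → L' (λ n k → r i n k - r j n k) → i ≡ j) where

        u : Fin 4 → ℤ⁴
        u i = from-coordinates (r i N)

        u∈Λ : ∀ i → Λ (u i)
        u∈Λ i = approximate (constant (u i)) (r i) (constant-compat (u i)) (r∈L i)
          (λ j → ≡⇒≅ (coordinates-from (r i N) j))

        u-separated : ∀ i j → Λ' (u i ⊞ - (+ 1) ⊡ u j) → i ≡ j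
        u-separated i j p = separated i j (approximate' (λ n k → r i n k - r j n k) (constant (u i ⊞ - (+ 1) ⊡ u j))
          (CompatV-minus 2 (r i) (r j) (L.compat (r i) (r∈L i)) (L.compat (r j) (r∈L j))) p
          (λ k → ≡⇒≅ (sym (trans (coordinates-⊞ (u i) (- (+ 1) ⊡ u j) k)
            (trans (cong₂ _+_ (coordinates-from (r i N) k)
                     (trans (coordinates-⊡ (- (+ 1)) (u j) k) (cong (- (+ 1) *_) (coordinates-from (r j N) k))))
                   (e (r i N k) (r j N k)))))))
          where
          e : ∀ a b → a + - (+ 1) * b ≡ a - b
          e = solve-∀

        not-separated : ⊥
        not-separated =
          [ (λ p → 0≢1 (u-separated 0F 1F p)) , [ (λ p → 0≢2 (u-separated 0F 2F p)) , (λ p → 1≢2 (u-separated 1F 2F p)) ]′ ]′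
          -- The chain is cut off at ρ^(4N), which is multiplication by 2^N. Three of the four
          -- representatives already collide.
          (no-three-classes lem acts-trivially N pwN∈Λ' (N ℕ.* 4) (λ v → subst Λ' (sym (ρ^-pw N v)) (pwN∈Λ' v))
            (u 0F) (u 1F) (u 2F) (u∈Λ 0F) (u∈Λ 1F) (u∈Λ 2F))
          where
          0≢1 : _≢_ {A = Fin 4} 0F 1F
          0≢1 ()
          0≢2 : _≢_ {A = Fin 4} 0F 2F
          0≢2 ()
          1≢2 : _≢_ {A = Fin 4} 1F 2F
          1≢2 ()

  no-GoodPair : ¬ GoodPair 2 G
  no-GoodPair (L , L' , lattice , lattice' , L'⊆L , _ , _ , (r , r∈L , separated , _) , trivial) =
    not-separated lattice lattice' L'⊆L trivial r r∈L separated

-- The finite group S̄₂, by exhaustion over four bits.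

∀Bool? : {P : Bool → Set} → (∀ b → Dec (P b)) → Dec (∀ b → P b)
∀Bool? {P} d = map′ (λ { (f , t) false → f ; (f , t) true → t }) (λ h → h false , h true) (d false ×-dec d true)

∃Bool? : {P : Bool → Set} → (∀ b → Dec (P b)) → Dec (∃ P)
∃Bool? d = map′ [ (λ f → false , f) , (λ t → true , t) ]′ (λ { (false , f) → inj₁ f ; (true , t) → inj₂ t })
                (d false ⊎-dec d true)

∀×? : {A B : Set} → (∀ {P : A → Set} → (∀ a → Dec (P a)) → Dec (∀ a → P a))
    → (∀ {P : B → Set} → (∀ b → Dec (P b)) → Dec (∀ b → P b))
    → ∀ {P : A × B → Set} → (∀ x → Dec (P x)) → Dec (∀ x → P x)
∀×? ∀A ∀B d = map′ (λ { h (a , b) → h a b }) (λ h a b → h (a , b)) (∀A (λ a → ∀B (λ b → d (a , b))))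

∃×? : {A B : Set} → (∀ {P : A → Set} → (∀ a → Dec (P a)) → Dec (∃ P))
    → (∀ {P : B → Set} → (∀ b → Dec (P b)) → Dec (∃ P))
    → ∀ {P : A × B → Set} → (∀ x → Dec (P x)) → Dec (∃ P)
∃×? ∃A ∃B d = map′ (λ { (a , b , p) → (a , b) , p }) (λ { ((a , b) , p) → a , b , p }) (∃A (λ a → ∃B (λ b → d (a , b))))

∀D4? : {P : D4 → Set} → (∀ x → Dec (P x)) → Dec (∀ x → P x)
∀D4? = ∀×? all? ∀Bool?

∃D4? : {P : D4 → Set} → (∀ x → Dec (P x)) → Dec (∃ P)
∃D4? = ∃×? any? ∃Bool?

_≟D4_ : (x y : D4) → Dec (x ≡ y)
_≟D4_ = ≡-dec _≟ᶠ_ Boolₚ._≟_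

-- The entries (2,1), (3,2), (3,1), (4,1) of a lower unitriangular symplectic
-- matrix over F₂; the symplectic condition determines the other two.
Bits : Set
Bits = Bool × Bool × Bool × Bool

aᵇ cᵇ : Bits → Bool
aᵇ (a , _) = a
cᵇ (_ , c , _) = c

unipotent : Bits → M2
unipotent _                   0F 0F = true
unipotent _                   0F 1F = false
unipotent _                   0F 2F = false
unipotent _                   0F 3F = false
unipotent (a , c , p , q)     1F 0F = a
unipotent _                   1F 1F = true
unipotent _                   1F 2F = false
unipotent _                   1F 3F = false
unipotent (a , c , p , q)     2F 0F = p
unipotent (a , c , p , q)     2F 1F = c
unipotent _                   2F 2F = true
unipotent _                   2F 3F = false
unipotent (a , c , p , q)     3F 0F = q
unipotent (a , c , p , q)     3F 1F = p xor (a ∧ c)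
unipotent (a , c , p , q)     3F 2F = a
unipotent _                   3F 3F = true

bits : M2 → Bits
bits m = m 1F 0F , m 2F 1F , m 2F 0F , m 3F 0F

bits-cong : ∀ {m m'} → m ≗₂ m' → bits m ≡ bits m'
bits-cong e = cong₂ _,_ (e 1F 0F) (cong₂ _,_ (e 2F 1F) (cong₂ _,_ (e 2F 0F) (e 3F 0F)))

unipotent-injective : ∀ {x y} → unipotent x ≗₂ unipotent y → x ≡ y
unipotent-injective = bits-cong

infixl 7 _·_

_·_ : Bits → Bits → Bits
(a , c , p , q) · (a' , c' , p' , q') =
  a xor a' , c xor c' , p xor (p' xor (c ∧ a')) , q xor (q' xor (((p xor (a ∧ c)) ∧ a') xor (a ∧ p')))

∀Bits? : {P : Bits → Set} → (∀ x → Dec (P x)) → Dec (∀ x → P x)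
∀Bits? = ∀×? ∀Bool? (∀×? ∀Bool? (∀×? ∀Bool? ∀Bool?))

_≟ᵇ_ : (x y : Bits) → Dec (x ≡ y)
_≟ᵇ_ = ≡-dec Boolₚ._≟_ (≡-dec Boolₚ._≟_ (≡-dec Boolₚ._≟_ Boolₚ._≟_))

abstract
  unipotent-· : ∀ x y → unipotent (x · y) ≗₂ (unipotent x ⊗₂ unipotent y)
  unipotent-· = toWitness {a? = ∀Bits? λ x → ∀Bits? λ y → all? λ i → all? λ j →
    unipotent (x · y) i j Boolₚ.≟ (unipotent x ⊗₂ unipotent y) i j} tt

-- `ω` is the central transvection that spans the factor C₂; `ζ` is the nontrivial commutator.
ε ω ζ : Bits
ε = false , false , false , false
ω = false , false , false , true
ζ = false , false , true , true

σ τ : Bool → Bits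
σ i = true , false , false , i
τ j = false , true , false , j

infixr 8 _^ᵇ_

_^ᵇ_ : Bits → ℕ → Bits
x ^ᵇ zero  = ε
x ^ᵇ suc n = x · x ^ᵇ n

-- σ i and τ j generate a dihedral group of order 8 in which σ i · τ j has order 4.
dihedral : Bool → Bool → D4 → Bits
dihedral i j (k , false) = (σ i · τ j) ^ᵇ toℕ k
dihedral i j (k , true)  = (σ i · τ j) ^ᵇ toℕ k · σ i

abstract
  dihedral-· : ∀ i j x y → dihedral i j (x ·D4 y) ≡ dihedral i j x · dihedral i j y
  dihedral-· = toWitness {a? = ∀Bool? λ i → ∀Bool? λ j → ∀D4? λ x → ∀D4? λ y →
    dihedral i j (x ·D4 y) ≟ᵇ (dihedral i j x · dihedral i j y)} tt

abstract
  dihedral-injective : ∀ i j x y → dihedral i j x ≡ dihedral i j y → x ≡ y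
  dihedral-injective = toWitness {a? = ∀Bool? λ i → ∀Bool? λ j → ∀D4? λ x → ∀D4? λ y →
    (dihedral i j x ≟ᵇ dihedral i j y) →-dec (x ≟D4 y)} tt

abstract
  dihedral-index-2 : ∀ i j m → ∃ λ x → (m ≡ dihedral i j x) ⊎ (m ≡ dihedral i j x · ω)
  dihedral-index-2 = toWitness {a? = ∀Bool? λ i → ∀Bool? λ j → ∀Bits? λ m → ∃D4? λ x →
    (m ≟ᵇ dihedral i j x) ⊎-dec (m ≟ᵇ (dihedral i j x · ω))} tt

abstract
  -- The group has exponent 4, so a cube serves as inverse.
  cube-inverse : ∀ x y → x ^ᵇ 3 · (x · y) ≡ y
  cube-inverse = toWitness {a? = ∀Bits? λ x → ∀Bits? λ y → (x ^ᵇ 3 · (x · y)) ≟ᵇ y} tt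

abstract
  -- Cubes being inverses, the left side is sts⁻¹t⁻¹. It is independent of the last two bits because
  -- elements with a = c = 0 are central.
  commutator : ∀ p q p' q' → let s = true , false , p , q ; t = false , true , p' , q' in (s · t) · (t · s) ^ᵇ 3 ≡ ζ
  commutator = toWitness {a? = ∀Bool? λ p → ∀Bool? λ q → ∀Bool? λ p' → ∀Bool? λ q' →
    (((true , false , p , q) · (false , true , p' , q')) · ((false , true , p' , q') · (true , false , p , q)) ^ᵇ 3) ≟ᵇ ζ} tt

abstract
  -- Commutators are governed by the determinant of the two vectors (a, c), an alternating form on
  -- the quotient F₂² by the centre.
  commute : ∀ x y → aᵇ x ∧ cᵇ y ≡ cᵇ x ∧ aᵇ y → x · y ≡ y · x
  commute = toWitness {a? = ∀Bits? λ x → ∀Bits? λ y →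
    ((aᵇ x ∧ cᵇ y) Boolₚ.≟ (cᵇ x ∧ aᵇ y)) →-dec ((x · y) ≟ᵇ (y · x))} tt

product-C2D4 : C2×D4 → Bits
product-C2D4 (false , x) = dihedral false false x
product-C2D4 (true  , x) = dihedral false false x · ω

∀C2D4? : {P : C2×D4 → Set} → (∀ x → Dec (P x)) → Dec (∀ x → P x)
∀C2D4? = ∀×? ∀Bool? ∀D4?

abstract
  product-C2D4-· : ∀ x y → product-C2D4 (x ·C2D4 y) ≡ product-C2D4 x · product-C2D4 y
  product-C2D4-· = toWitness {a? = ∀C2D4? λ x → ∀C2D4? λ y → product-C2D4 (x ·C2D4 y) ≟ᵇ (product-C2D4 x · product-C2D4 y)} tt

abstract
  product-C2D4-injective : ∀ x y → product-C2D4 x ≡ product-C2D4 y → x ≡ y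
  product-C2D4-injective = toWitness {a? = ∀C2D4? λ x → ∀C2D4? λ y →
    (product-C2D4 x ≟ᵇ product-C2D4 y) →-dec (≡-dec Boolₚ._≟_ _≟D4_ x y)} tt

product-C2D4-surjective : ∀ m → ∃ λ x → product-C2D4 x ≡ m
product-C2D4-surjective m with dihedral-index-2 false false m
... | x , inj₁ e = (false , x) , sym e
... | x , inj₂ e = (true  , x) , sym e

-- A subgroup meeting the fibres of (a , c) over (1 , 0) and (0 , 1) contains the
-- commutator ζ, and multiplication by ζ leads to some σ i and τ j in it.
module Generated (H : Bits → Set) (H-· : ∀ x y → H x → H y → H (x · y)) (H-ε : H ε) where

  H-^ : ∀ x n → H x → H (x ^ᵇ n)
  H-^ x zero    h = H-ε
  H-^ x (suc n) h = H-· x (x ^ᵇ n) h (H-^ x n h)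

  ζ∈ : ∀ {p q p' q'} → H (true , false , p , q) → H (false , true , p' , q') → H ζ
  ζ∈ {p} {q} {p'} {q'} s t = subst H (commutator p q p' q')
    (H-· _ _ (H-· _ _ s t) (H-^ _ 3 (H-· _ _ t s)))

  σ∈ : H ζ → ∀ p q → H (true , false , p , q) → ∃ λ i → H (σ i)
  σ∈ z false q     s = q , s
  σ∈ z true  false s = false , H-· _ _ s z
  σ∈ z true  true  s = true , H-· _ _ s z

  τ∈ : H ζ → ∀ p q → H (false , true , p , q) → ∃ λ j → H (τ j)
  τ∈ z false q     t = q , t
  τ∈ z true  false t = true , H-· _ _ t z
  τ∈ z true  true  t = false , H-· _ _ t z

  dihedral∈ : ∀ i j → H (σ i) → H (τ j) → ∀ x → H (dihedral i j x)
  dihedral∈ i j s t (k , false) = H-^ _ (toℕ k) (H-· _ _ s t)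
  dihedral∈ i j s t (k , true)  = H-· _ _ (H-^ _ (toℕ k) (H-· _ _ s t)) s

  -- `H` contains the dihedral group, whose translates by 1 and `ω` cover everything. If `H`
  -- contains some d · ω with d dihedral, it also contains ω = d³(dω).
  dichotomy : Dec (H ω) → ∀ i j → H (σ i) → H (τ j)
            → (∀ x → H x) ⊎ (∀ x → H x → ∃ λ y → dihedral i j y ≡ x)
  dichotomy (yes w) i j s t = inj₁ all
    where
    all : ∀ x → H x
    all x with dihedral-index-2 i j x
    ... | y , inj₁ e = subst H (sym e) (dihedral∈ i j s t y)
    ... | y , inj₂ e = subst H (sym e) (H-· _ _ (dihedral∈ i j s t y) w)
  dichotomy (no ¬w) i j s t = inj₂ only
    where
    only : ∀ x → H x → ∃ λ y → dihedral i j y ≡ x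
    only x h with dihedral-index-2 i j x
    ... | y , inj₁ e = y , sym e
    ... | y , inj₂ e = ⊥-elim (¬w (subst H (cube-inverse (dihedral i j y) ω)
                         (H-· _ _ (H-^ _ 3 (dihedral∈ i j s t y)) (subst H e h))))

-- Reduction modulo 2.

lift₂ : M2 → Mat4
lift₂ m i j = b2z (m i j)

lift₂-⊗ : ∀ m m' → lift₂ (m ⊗₂ m') ≊ lift₂ m ⊗ lift₂ m' ⟦ + 2 ⟧
lift₂-⊗ m m' = entries λ i j → lift₂-xor4 (λ k → m i k) (λ k → m' k j)
  where
  step : ∀ x y b {s} → b2z b ≅ s ⟦ + 2 ⟧ → b2z ((x ∧ y) xor b) ≅ b2z x * b2z y + s ⟦ + 2 ⟧
  step x y b p = ≅-trans (≅-sym (b2z-+ (x ∧ y) b)) (≅-+ (≡⇒≅ (sym (b2z-* x y))) p)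
  lift₂-xor4 : (u v : Fin 4 → Bool) → b2z (xor4 (λ k → u k ∧ v k)) ≅ sumFin 4 (λ k → b2z (u k) * b2z (v k)) ⟦ + 2 ⟧
  lift₂-xor4 u v = step (u 0F) (v 0F) _ (step (u 1F) (v 1F) _ (step (u 2F) (v 2F) _
    (≡⇒≅ (trans (sym (b2z-* (u 3F) (v 3F))) (sym (ℤₚ.+-identityʳ _))))))

lift₂-I₂ : lift₂ I₂ ≊ I4 ⟦ + 2 ⟧
lift₂-I₂ = ≡⇒≊ (toWitness {a? = all? λ i → all? λ j → lift₂ I₂ i j ℤ.≟ I4 i j} tt)

from-Reduces : ∀ g m → Reduces g m → g 1 ≊ lift₂ m ⟦ + 2 ⟧
from-Reduces g m r = entries λ i j → from-mod (r i j)

to-Reduces : ∀ g m → g 1 ≊ lift₂ m ⟦ + 2 ⟧ → Reduces g m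
to-Reduces g m r i j = to-mod {m = + 2} (entry r i j)

Reduces-resp : ∀ g {m m'} → Reduces g m → m ≗₂ m' → Reduces g m'
Reduces-resp g {m} r e i j = subst (λ b → g 1 i j ≡ b2z b [mod + 2 ]) (e i j) (r i j)

Reduces-unique : ∀ g {m m'} → Reduces g m → Reduces g m' → m ≗₂ m'
Reduces-unique g {m} {m'} r r' i j = b2z-injective (m i j) (m' i j)
  (≅-trans (≅-sym (entry (from-Reduces g m r) i j)) (entry (from-Reduces g m' r') i j))

Reduces-⊗ : ∀ g h {m m'} → Reduces g m → Reduces h m' → Reduces (_⊗S_ 2 g h) (m ⊗₂ m')
Reduces-⊗ g h {m} {m'} r r' = to-Reduces (_⊗S_ 2 g h) (m ⊗₂ m')
  (≊-trans (⊗-cong (from-Reduces g m r) (from-Reduces h m' r')) (≊-sym (lift₂-⊗ m m')))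

reduction : MSeq → M2
reduction g i j = par (g 1 i j)

Reduces-reduction : ∀ g → Reduces g (reduction g)
Reduces-reduction g i j = to-mod {m = + 2} (≅-par (g 1 i j))

Gbar-resp : ∀ {G m m'} → Gbar G m → m ≗₂ m' → Gbar G m'
Gbar-resp (g , g∈G , r) e = g , g∈G , Reduces-resp g r e

par-minus : ∀ a b → par (a - b) ≡ par a xor par b
par-minus a b = trans (par-cong {a - b} {a + b} (by (- b) (e a b))) (par-+ a b)
  where
  e : ∀ a b → a - b ≡ a + b + - b * + 2
  e = solve-∀

-- The symplectic condition modulo 2, through `entry-31` and `entry-32`, recovers the entries (4,2)
-- and (4,3) from the four recorded bits.
reduction-unipotent : ∀ g → InS 2 g → reduction g ≗₂ unipotent (bits (reduction g))
reduction-unipotent g s = go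
  where
  lt = InS-lower g s ℕₚ.≤-refl
  sp : form (g 1) ≊ J ⟦ + 2 ⟧
  sp = ≊-mod-ℓ {2} {n = 1} ℕₚ.≤-refl (IsSp-form g (proj₁ s) 1)
  up : ∀ i j → toℕ i ℕ.< toℕ j → par (g 1 i j) ≡ false
  up i j i<j = par-unique false (upper lt i j i<j)
  di : ∀ i → par (g 1 i i) ≡ true
  di i = par-unique true (diagonal lt i)
  go : reduction g ≗₂ unipotent (bits (reduction g))
  go 0F 0F = di 0F
  go 0F 1F = up 0F 1F (s≤s z≤n)
  go 0F 2F = up 0F 2F (s≤s z≤n)
  go 0F 3F = up 0F 3F (s≤s z≤n)
  go 1F 0F = refl
  go 1F 1F = di 1F
  go 1F 2F = up 1F 2F (s≤s (s≤s z≤n))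
  go 1F 3F = up 1F 3F (s≤s (s≤s z≤n))
  go 2F 0F = refl
  go 2F 1F = refl
  go 2F 2F = di 2F
  go 2F 3F = up 2F 3F (s≤s (s≤s (s≤s z≤n)))
  go 3F 0F = refl
  go 3F 1F = trans (par-cong (entry-31 lt sp)) (trans (par-minus (g 1 2F 0F) (g 1 1F 0F * g 1 2F 1F))
                   (cong (par (g 1 2F 0F) xor_) (par-* (g 1 1F 0F) (g 1 2F 1F))))
  go 3F 2F = trans (par-cong (entry-32 lt sp)) (par-cong { - g 1 1F 0F} {g 1 1F 0F} (by (- g 1 1F 0F) (e (g 1 1F 0F))))
    where
    e : ∀ a → - a ≡ a + - a * + 2
    e = solve-∀
  go 3F 3F = di 3F

Sbar2-unipotent : ∀ {m} → Sbar2 m → m ≗₂ unipotent (bits m)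
Sbar2-unipotent {m} (g , s , r) i j =
  trans (m≗ i j) (trans (reduction-unipotent g s i j)
        (cong (λ x → unipotent x i j) (bits-cong (λ k l → sym (m≗ k l)))))
  where
  m≗ : m ≗₂ reduction g
  m≗ = Reduces-unique g r (Reduces-reduction g)

-- The group ker(α + γ + f) for ℓ = 2.

-- On this subgroup of S₂ one has f = α + γ.
record EvenWeight (g : MSeq) : Set where
  constructor even-weight
  field
    inS      : InS 2 g
    relation : g 2 0F 3F ≅ + 2 * (αₛ g + γₛ g) ⟦ + 4 ⟧

open EvenWeight

module _ (g : MSeq) (k : EvenWeight g) where

  private
    lower₂ : LowerUnitriangular 2 (g 2)
    lower₂ = InS-lower g (inS k) 1≤2

  -- By `det-≅` with g₁₄ = 2(α + γ), it is enough that (α + γ)α²γ is even, which holds for all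
  -- integers.
  even-weight-fixed : pw 2 2 ℤ∣.∣ det 4 (λ i j → g 2 i j - I4 i j)
  even-weight-fixed = to-∣ {m = + 4} (≅-trans (det-≅ lower₂ (InS-form g (inS k)))
    (≅-trans (≅-* (relation k) (≅-refl {a = αₛ g * γₛ g * αₛ g}))
    (≅-trans (≡⇒≅ (ℤₚ.*-assoc (+ 2) (αₛ g + γₛ g) (αₛ g * γₛ g * αₛ g)))
             (≅-scale (+ 2) (par-injective {b = + 0} product-even)))))
    where
    boolean : ∀ a c → (a xor c) ∧ ((a ∧ c) ∧ a) ≡ false
    boolean false false = refl
    boolean false true  = refl
    boolean true  false = refl
    boolean true  true  = refl
    product-even : par ((αₛ g + γₛ g) * (αₛ g * γₛ g * αₛ g)) ≡ false
    product-even = trans (par-* (αₛ g + γₛ g) (αₛ g * γₛ g * αₛ g))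
      (trans (cong₂ _∧_ (par-+ (αₛ g) (γₛ g))
               (trans (par-* (αₛ g * γₛ g) (αₛ g)) (cong (_∧ par (αₛ g)) (par-* (αₛ g) (γₛ g)))))
             (boolean (par (αₛ g)) (par (γₛ g))))

  even-weight-f : fₛ g (inS k) ≅ αₛ g + γₛ g ⟦ + 2 ⟧
  even-weight-f = ≅-cancel (+ 2) (≅-trans (≡⇒≅ (sym (fₛ-entry g (inS k)))) (relation k))

  even-weight-≈ : ∀ h → IsSp 2 h → _≈M_ 2 g h → EvenWeight h
  even-weight-≈ h sp e = even-weight (InS-≈M g h (inS k) sp e)
    (≅-trans (≅-sym (entry level-2 0F 3F)) (≅-trans (relation k)
      (≅-scale {m = + 2} (+ 2) (≅-+ (entry (≊-mod-ℓ {2} {n = 2} 1≤2 level-2) 1F 0F)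
                                    (entry (≊-mod-ℓ {2} {n = 2} 1≤2 level-2) 2F 1F)))))
    where
    level-2 : g 2 ≊ h 2 ⟦ pw 2 2 ⟧
    level-2 = from-≈M g h e 2

  even-weight-⊗ : ∀ h → EvenWeight h → EvenWeight (_⊗S_ 2 g h)
  even-weight-⊗ h k' = even-weight (InS-⊗S g h (inS k) (inS k'))
    (≅-trans (f-⊗ lower₂ lower₂')
    (≅-trans (≅-+ (relation k) (relation k'))
    (≅-trans (≡⇒≅ (e (αₛ g) (γₛ g) (αₛ h) (γₛ h)))
             (≅-scale {m = + 2} (+ 2) (≅-sym (≅-+ (α-⊗ lower₂ lower₂') (γ-⊗ lower₂ lower₂')))))))
    where
    lower₂' : LowerUnitriangular 2 (h 2)
    lower₂' = InS-lower h (inS k') 1≤2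
    e : ∀ a c a' c' → + 2 * (a + c) + + 2 * (a' + c') ≡ + 2 * ((a + a') + (c + c'))
    e = solve-∀

  even-weight-inverse : EvenWeight (inverseS {2} g)
  even-weight-inverse = even-weight (InS-inverseS g (inS k))
    (≅-trans (negative (g 2 0F 3F) (h 2 0F 3F) (≅-trans (≅-sym (f-⊗ lower₂ lower₂')) (entry level-2 0F 3F)))
    (≅-trans (≅-neg (relation k))
    (≅-trans (≡⇒≅ (e (αₛ g) (γₛ g)))
      (≅-scale {m = + 2} (+ 2) (≅-sym (≅-+
        (negative (αₛ g) (αₛ h) (≅-trans (≅-sym (α-⊗ lower₂ lower₂')) (entry (≊-mod-ℓ {2} {n = 2} 1≤2 level-2) 1F 0F)))
        (negative (γₛ g) (γₛ h) (≅-trans (≅-sym (γ-⊗ lower₂ lower₂')) (entry (≊-mod-ℓ {2} {n = 2} 1≤2 level-2) 2F 1F)))))))))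
    where
    h = inverseS {2} g
    lower₂' : LowerUnitriangular 2 (h 2)
    lower₂' = InS-lower h (InS-inverseS g (inS k)) 1≤2
    level-2 : g 2 ⊗ h 2 ≊ I4 ⟦ pw 2 2 ⟧
    level-2 = inverseS-right g (inS k) 2
    e : ∀ a c → - (+ 2 * (a + c)) ≡ + 2 * (- a + - c)
    e = solve-∀
    negative : ∀ {m} a b → a + b ≅ + 0 ⟦ m ⟧ → b ≅ - a ⟦ m ⟧
    negative {m} a b p = ≅-trans (≡⇒≅ (e₁ a b)) (≅-trans (≅-minus p (≅-refl {a = a})) (≡⇒≅ (ℤₚ.+-identityˡ (- a))))
      where
      e₁ : ∀ a b → b ≡ a + b - a
      e₁ = solve-∀

I4-lower : LowerUnitriangular 2 I4
I4-lower = record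
  { upper = λ i j i<j → ≡⇒≅ (I4-upper i j i<j)
  ; diagonal = λ i → ≡⇒≅ (toWitness {a? = all? λ i → I4 i i ℤ.≟ + 1} tt i) }
  where
  I4-upper : ∀ i j → toℕ i ℕ.< toℕ j → I4 i j ≡ + 0
  I4-upper = toWitness {a? = all? λ i → all? λ j → (toℕ i ℕ.<? toℕ j) →-dec (I4 i j ℤ.≟ + 0)} tt

even-weight-idS : EvenWeight (idS 2)
even-weight-idS = even-weight (to-InS (idS 2) IsSp-idS I4-lower) (≅-refl {+ 4} {+ 0})

-- On Γ(2) both α and γ vanish, so there f = 0 and f = α + γ are the same condition.
even-weight-Γ2kerf : ∀ g → Γ2kerf g → EvenWeight g
even-weight-Γ2kerf g ((sp , p) , q) = even-weight s (≅-trans (from-mod q)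
    (≅-sym (≅-scale {m = + 2} (+ 2) (≅-+ (zero-at 1F 0F refl) (zero-at 2F 1F refl)))))
  where
  level-1 : g 1 ≊ I4 ⟦ + 2 ⟧
  level-1 = entries λ i j → from-mod (p i j)
  s : InS 2 g
  s = to-InS g sp (LowerUnitriangular-≊ level-1 I4-lower)
  zero-at : ∀ i j → I4 i j ≡ + 0 → g 2 i j ≅ + 0 ⟦ + 2 ⟧
  zero-at i j e = ≅-trans (≅-sym (level-1-2 g s i j)) (≅-trans (entry level-1 i j) (≡⇒≅ e))

Γ2-even-weight-kerf : ∀ g → EvenWeight g → Γ2 g → Γ2kerf g
Γ2-even-weight-kerf g k (sp , p) = (sp , p) , to-mod {m = + 4} (≅-trans (relation k)
    (≅-scale {m = + 2} (+ 2) (≅-+ (zero-at 1F 0F refl) (zero-at 2F 1F refl))))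
  where
  zero-at : ∀ i j → I4 i j ≡ + 0 → g 2 i j ≅ + 0 ⟦ + 2 ⟧
  zero-at i j e = ≅-trans (≅-sym (level-1-2 g (inS k) i j)) (≅-trans (from-mod (p i j)) (≡⇒≅ e))

-- An integral symplectic lift of unipotent (a , c , p , q), multiplied on the
-- right by the transvection 1 + 2(a xor c)E₁₄ so that f = α + γ.
lift-matrix : Bits → Mat4
lift-matrix (a , c , p , q) = go
  where
  e = + 2 * b2z (a xor c)
  go : Mat4
  go 0F 0F = + 1
  go 0F 3F = e
  go 1F 0F = b2z a
  go 1F 1F = + 1
  go 1F 3F = e * b2z a
  go 2F 0F = b2z p
  go 2F 1F = b2z c
  go 2F 2F = + 1
  go 2F 3F = e * b2z p
  go 3F 0F = b2z q
  go 3F 1F = b2z p - b2z a * b2z c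
  go 3F 2F = - b2z a
  go 3F 3F = + 1 + e * b2z q
  go _  _  = + 0

abstract
  lift-matrix-form : ∀ x i j → form (lift-matrix x) i j ≡ J i j
  lift-matrix-form = toWitness {a? = ∀Bits? λ x → all? λ i → all? λ j → form (lift-matrix x) i j ℤ.≟ J i j} tt

  lift-matrix-parity : ∀ x i j → par (lift-matrix x i j) ≡ unipotent x i j
  lift-matrix-parity = toWitness {a? = ∀Bits? λ x → all? λ i → all? λ j →
    par (lift-matrix x i j) Boolₚ.≟ unipotent x i j} tt

lift-sequence : Bits → MSeq
lift-sequence x _ = lift-matrix x

lift-reduces : ∀ x → Reduces (lift-sequence x) (unipotent x)
lift-reduces x i j = to-mod {m = + 2} (≅-trans (≅-par (lift-matrix x i j)) (≡⇒≅ (cong b2z (lift-matrix-parity x i j))))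

unipotent-lower : ∀ x → LowerUnitriangular 2 (lift₂ (unipotent x))
unipotent-lower x = record { upper = λ i j i<j → ≡⇒≅ (cong b2z (up i j i<j)) ; diagonal = λ i → ≡⇒≅ (cong b2z (di i)) }
  where
  up : ∀ i j → toℕ i ℕ.< toℕ j → unipotent x i j ≡ false
  up 0F 1F _ = refl
  up 0F 2F _ = refl
  up 0F 3F _ = refl
  up 1F 1F (s≤s ())
  up 1F 2F _ = refl
  up 1F 3F _ = refl
  up 2F 1F (s≤s ())
  up 2F 2F (s≤s (s≤s ()))
  up 2F 3F _ = refl
  up 3F 1F (s≤s ())
  up 3F 2F (s≤s (s≤s ()))
  up 3F 3F (s≤s (s≤s (s≤s ())))
  di : ∀ i → unipotent x i i ≡ true
  di 0F = refl
  di 1F = refl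
  di 2F = refl
  di 3F = refl

lift-even-weight : ∀ x → EvenWeight (lift-sequence x)
lift-even-weight x = even-weight
  (to-InS (lift-sequence x) (to-IsSp (lift-sequence x) (λ n → ≊-refl) (λ n → ≡⇒≊ (lift-matrix-form x)))
    (LowerUnitriangular-≊ (from-Reduces (lift-sequence x) (unipotent x) (lift-reduces x)) (unipotent-lower x)))
  (≅-scale {m = + 2} (+ 2) (≅-sym (b2z-+ (aᵇ x) (cᵇ x))))

Sbar2-of-unipotent : ∀ x → Sbar2 (unipotent x)
Sbar2-of-unipotent x = lift-sequence x , inS (lift-even-weight x) , lift-reduces x

-- Counterexamples as preimages of subgroups of S̄₂.

Preimage : (M2 → Set) → MSeq → Set
Preimage D g = EvenWeight g × ∃ λ m → D m × Reduces g m

module _ {D : M2 → Set} (sub : Subgroup₂ D) where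

  module D = Subgroup₂ sub

  Preimage-subgroup : Subgroup 2 (Preimage D)
  Preimage-subgroup = record
    { sp = λ g p → proj₁ (inS (proj₁ p))
    ; resp = λ { g h (k , m , d , r) sp e → even-weight-≈ g k h sp e , m , d ,
        to-Reduces h m (≊-trans (≊-mod-ℓ {2} {n = 1} ℕₚ.≤-refl (≊-sym (from-≈M g h e 1))) (from-Reduces g m r)) }
    ; one = even-weight-idS , I₂ , D.one , to-Reduces (idS 2) I₂ (≊-sym lift₂-I₂)
    ; mul = λ { g h (k , m , d , r) (k' , m' , d' , r') →
        even-weight-⊗ g k h k' , m ⊗₂ m' , D.mul m m' d d' , Reduces-⊗ g h r r' }
    ; inv = inverse
    }
    where
    inverse : ∀ g → Preimage D g → ∃ λ h → Preimage D h × _≈M_ 2 (_⊗S_ 2 g h) (idS 2)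
    inverse g (k , m , d , r) with D.inv m d
    ... | m' , d' , e = inverseS {2} g
      , (even-weight-inverse g k , m' , d' , to-Reduces (inverseS {2} g) m' (≊-sym
          (inverse-unique {A = g 1} {adjoint (g 1)} {lift₂ m'}
            (adjoint-inverseˡ (g 1) (≊-mod-ℓ {2} {n = 1} ℕₚ.≤-refl (IsSp-form g (proj₁ (inS k)) 1)))
            (≊-trans (⊗-congʳ (lift₂ m') (from-Reduces g m r))
            (≊-trans (≊-sym (lift₂-⊗ m m'))
            (≊-trans (≡⇒≊ (λ i j → cong b2z (e i j))) lift₂-I₂))))))
      , inverseS-≈M g (inS k)

  Preimage-image : (∀ m → D m → Sbar2 m) → Gbar (Preimage D) ≐ D
  Preimage-image D⊆S m =
    (λ { (g , (k , m' , d , r) , r') → D.resp m' m d (Reduces-unique g r r') }) ,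
    (λ d → let e = Sbar2-unipotent (D⊆S m d)
               e' = λ i j → sym (e i j)
           in lift-sequence (bits m) ,
              (lift-even-weight (bits m) , m , d , Reduces-resp (lift-sequence (bits m)) (lift-reduces (bits m)) e') ,
              Reduces-resp (lift-sequence (bits m)) (lift-reduces (bits m)) e')

  -I∈Preimage : Preimage D -I
  -I∈Preimage = even-weight (to-InS -I (to-IsSp -I (λ n → ≊-refl) (λ n → ≡⇒≊ -I-form))
      (LowerUnitriangular-≊ -I≊I4 I4-lower)) (by (+ 0) refl)
    , I₂ , D.one , to-Reduces -I I₂ (≊-trans -I≊I4 (≊-sym lift₂-I₂))
    where
    -I-form : ∀ i j → form (λ i j → - I4 i j) i j ≡ J i j
    -I-form = toWitness {a? = all? λ i → all? λ j → form (λ i j → - I4 i j) i j ℤ.≟ J i j} tt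
    -I≊I4 : (λ i j → - I4 i j) ≊ I4 ⟦ + 2 ⟧
    -I≊I4 = entries λ i j → by (- I4 i j) (e (I4 i j))
      where
      e : ∀ a → - a ≡ a + - a * + 2
      e = solve-∀

  module _ (lem : (P : Set) → Dec P)
    (wa : ∃ λ x → D (unipotent x) × aᵇ x ≡ true)
    (wc : ∃ λ x → D (unipotent x) × cᵇ x ≡ true)
    (wf : ∃ λ x → D (unipotent x) × aᵇ x xor cᵇ x ≡ true) where

    -- On `EvenWeight` elements f equals α + γ, so the third witness provides the element at which f
    -- is odd.
    Preimage-counterexample : Counterexample 2 (Preimage D)
    Preimage-counterexample = Preimage-subgroup , (λ g p → even-weight-fixed g (proj₁ p)) ,
      no-GoodPair lem (Preimage D) (λ g p → inS (proj₁ p)) -I∈Preimage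
        (lift-sequence xa) (lift-sequence xc) (lift-sequence xf) (member xa da) (member xc dc) (member xf df)
        (α-odd xa ea) (γ-odd xc ec) f-odd
      where
      xa = proj₁ wa ; da = proj₁ (proj₂ wa) ; ea = proj₂ (proj₂ wa)
      xc = proj₁ wc ; dc = proj₁ (proj₂ wc) ; ec = proj₂ (proj₂ wc)
      xf = proj₁ wf ; df = proj₁ (proj₂ wf) ; ef = proj₂ (proj₂ wf)
      member : ∀ x → D (unipotent x) → Preimage D (lift-sequence x)
      member x d = lift-even-weight x , unipotent x , d , lift-reduces x
      α-odd : ∀ x → aᵇ x ≡ true → Odd (αₛ (lift-sequence x))
      α-odd x e = ≡⇒≅ (cong b2z e)
      γ-odd : ∀ x → cᵇ x ≡ true → Odd (γₛ (lift-sequence x))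
      γ-odd x e = ≡⇒≅ (cong b2z e)
      f-odd : Odd (fₛ (lift-sequence xf) (inS (lift-even-weight xf)))
      f-odd = ≅-trans (even-weight-f (lift-sequence xf) (lift-even-weight xf))
        (≅-trans (b2z-+ (aᵇ xf) (cᵇ xf)) (≡⇒≅ (cong b2z ef)))

-- The three characters on a subgroup in Fix(ℓ²), and the case of odd ℓ.

module _ (lem : (P : Set) → Dec P) (ℓ : ℕ) .{{_ : ℕ.NonZero ℓ}} (G : MSeq → Set) (sub : Subgroup ℓ G)
         (G⊆S : ∀ g → G g → InS ℓ g) (fix : Fix2 ℓ G) where

  private
    X : Set
    X = Σ MSeq G

  infixl 7 _∙_

  _∙_ : X → X → X
  (g , p) ∙ (h , q) = _⊗S_ ℓ g h , Subgroup.mul sub g h p q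

  α-character γ-character f-character : X → ℤ
  α-character (g , _) = αₛ g
  γ-character (g , _) = γₛ g
  f-character (g , p) = fₛ g (G⊆S g p)

  α-character-∙ : ∀ x y → α-character (x ∙ y) ≅ α-character x + α-character y ⟦ + ℓ ⟧
  α-character-∙ (g , p) (h , q) = α-⊗ (InS-lower g (G⊆S g p) 1≤2) (InS-lower h (G⊆S h q) 1≤2)

  γ-character-∙ : ∀ x y → γ-character (x ∙ y) ≅ γ-character x + γ-character y ⟦ + ℓ ⟧
  γ-character-∙ (g , p) (h , q) = γ-⊗ (InS-lower g (G⊆S g p) 1≤2) (InS-lower h (G⊆S h q) 1≤2)

  f-character-∙ : ∀ x y → f-character (x ∙ y) ≅ f-character x + f-character y ⟦ + ℓ ⟧
  f-character-∙ (g , p) (h , q) = fₛ-⊗ g h (G⊆S g p) (G⊆S h q) (G⊆S (_⊗S_ ℓ g h) (Subgroup.mul sub g h p q))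

  character-product : ∀ x → f-character x * (α-character x * γ-character x * α-character x) ≅ + 0 ⟦ + ℓ ⟧
  character-product (g , p) = fixed-product g (G⊆S g p) (fix g p)

  Trivial Nontrivial : (X → ℤ) → Set
  Trivial    χ = ∀ x → χ x ≅ + 0 ⟦ + ℓ ⟧
  Nontrivial χ = ∃ λ x → ¬ (χ x ≅ + 0 ⟦ + ℓ ⟧)

  trivial-or-not : ∀ χ → Trivial χ ⊎ Nontrivial χ
  trivial-or-not χ with lem (Nontrivial χ)
  ... | yes w = inj₂ w
  ... | no ¬w = inj₁ λ x → decidable-stable (≅0? ℓ (χ x)) (λ n → ¬w (x , n))

  α-Trivial : Trivial α-character → αTrivial ℓ G
  α-Trivial t g p = to-mod (from-mod-1 ℓ (≅-trans (level-1-2 g (G⊆S g p) 1F 0F) (t (g , p))))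

  γ-Trivial : Trivial γ-character → γTrivial ℓ G
  γ-Trivial t g p = to-mod (from-mod-1 ℓ (≅-trans (level-1-2 g (G⊆S g p) 2F 1F) (t (g , p))))

  f-Trivial : Trivial f-character → fTrivial ℓ G
  f-Trivial t g p = fₛ-trivial g (G⊆S g p) (t (g , p))

  α-Trivial-GoodPair : Trivial α-character → GoodPair ℓ G
  α-Trivial-GoodPair t = α-trivial-GoodPair ℓ G G⊆S (λ g p → t (g , p))

  γ-Trivial-GoodPair : Trivial γ-character → GoodPair ℓ G
  γ-Trivial-GoodPair t = γ-trivial-GoodPair ℓ G G⊆S (λ g p → t (g , p))

  f-Trivial-GoodPair : Trivial f-character → GoodPair ℓ G
  f-Trivial-GoodPair t = f-trivial-GoodPair ℓ G G⊆S (f-Trivial t)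

  some-character-trivial : Prime ℓ → 3 ≤ ℓ → Trivial α-character ⊎ Trivial γ-character ⊎ Trivial f-character
  some-character-trivial ℓ-prime 3≤ℓ
    with trivial-or-not α-character | trivial-or-not γ-character | trivial-or-not f-character
  ... | inj₁ t | _      | _      = inj₁ t
  ... | inj₂ _ | inj₁ t | _      = inj₂ (inj₁ t)
  ... | inj₂ _ | inj₂ _ | inj₁ t = inj₂ (inj₂ t)
  ... | inj₂ a | inj₂ c | inj₂ f = ⊥-elim (ThreeCharacters.one-trivial _∙_ ℓ-prime α-character γ-character f-character
        α-character-∙ γ-character-∙ f-character-∙ character-product 3≤ℓ a c f)

  odd-prime-case : Prime ℓ → 3 ≤ ℓ → (αTrivial ℓ G ⊎ γTrivial ℓ G ⊎ fTrivial ℓ G) × ¬ Counterexample ℓ G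
  odd-prime-case ℓ-prime 3≤ℓ with some-character-trivial ℓ-prime 3≤ℓ
  ... | inj₁ t        = inj₁ (α-Trivial t) , λ c → proj₂ (proj₂ c) (α-Trivial-GoodPair t)
  ... | inj₂ (inj₁ t) = inj₂ (inj₁ (γ-Trivial t)) , λ c → proj₂ (proj₂ c) (γ-Trivial-GoodPair t)
  ... | inj₂ (inj₂ t) = inj₂ (inj₂ (f-Trivial t)) , λ c → proj₂ (proj₂ c) (f-Trivial-GoodPair t)

  nontrivial : ∀ χ → (Trivial χ → GoodPair ℓ G) → ¬ GoodPair ℓ G → Nontrivial χ
  nontrivial χ h n with trivial-or-not χ
  ... | inj₁ t = ⊥-elim (n (h t))
  ... | inj₂ w = w

GoodPair-restrict : ∀ {ℓ} {G G' : MSeq → Set} → (∀ g → G g → G' g) → GoodPair ℓ G' → GoodPair ℓ G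
GoodPair-restrict G⊆G' (L , L' , lat , lat' , inc , st , st' , ix , tr) =
  L , L' , lat , lat' , inc , (λ g x p → st g x (G⊆G' g p)) , (λ g x p → st' g x (G⊆G' g p)) , ix ,
  (λ g x p → tr g x (G⊆G' g p))

⊗₂-cong : ∀ {m m' n n'} → m ≗₂ m' → n ≗₂ n' → (m ⊗₂ n) ≗₂ (m' ⊗₂ n')
⊗₂-cong {m} {m'} {n} {n'} p q i j =
  cong₂ _xor_ (at 0F) (cong₂ _xor_ (at 1F) (cong₂ _xor_ (at 2F) (at 3F)))
  where
  at : ∀ k → m i k ∧ n k j ≡ m' i k ∧ n' k j
  at k = cong₂ _∧_ (p i k) (q k j)

IsoOnto-unipotent : ∀ {Y : Set} {_∘_ : Y → Y → Y} {S : M2 → Set} (φ : Y → Bits)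
  → (∀ x y → φ (x ∘ y) ≡ φ x · φ y) → (∀ x y → φ x ≡ φ y → x ≡ y)
  → (∀ x → S (unipotent (φ x))) → (∀ m → S m → Sbar2 m) → (∀ m → S m → ∃ λ x → φ x ≡ bits m)
  → IsoOnto _∘_ S
IsoOnto-unipotent φ hom inj φ∈S S⊆Sbar2 surj =
  (λ x → unipotent (φ x)) , φ∈S , (λ x y e → inj x y (unipotent-injective e)) ,
  (λ m s → let x , e = surj m s in x , λ i j → trans (cong (λ b → unipotent b i j) e) (sym (Sbar2-unipotent (S⊆Sbar2 m s) i j))) ,
  (λ x y i j → trans (cong (λ b → unipotent b i j) (hom x y)) (unipotent-· (φ x) (φ y) i j))

IsoOnto-≐ : ∀ {Y : Set} {_∘_ : Y → Y → Y} {P Q : M2 → Set} → P ≐ Q → IsoOnto _∘_ Q → IsoOnto _∘_ P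
IsoOnto-≐ e (φ , φ∈ , inj , surj , hom) =
  φ , (λ x → proj₂ (e (φ x)) (φ∈ x)) , inj , (λ m p → surj m (proj₁ (e m) p)) , hom

Sbar2-iso : IsoOnto _·C2D4_ Sbar2
Sbar2-iso = IsoOnto-unipotent product-C2D4 product-C2D4-· product-C2D4-injective
  (λ x → Sbar2-of-unipotent (product-C2D4 x)) (λ m s → s) (λ m _ → product-C2D4-surjective (bits m))

Gbar-⊗ : ∀ {G m m'} → Subgroup 2 G → Gbar G m → Gbar G m' → Gbar G (m ⊗₂ m')
Gbar-⊗ sub (g , p , r) (h , q , r') = _⊗S_ 2 g h , Subgroup.mul sub g h p q , Reduces-⊗ g h r r'

-- The structure of a counterexample for ℓ = 2.

module _ (lem : (P : Set) → Dec P) (G : MSeq → Set) (G⊆S : ∀ g → G g → InS 2 g) (counter : Counterexample 2 G) where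

  private
    sub    = proj₁ counter
    fix    = proj₁ (proj₂ counter)
    ¬good  = proj₂ (proj₂ counter)

    X : Set
    X = Σ MSeq G

    α γ f : X → ℤ
    α = α-character lem 2 G sub G⊆S fix
    γ = γ-character lem 2 G sub G⊆S fix
    f = f-character lem 2 G sub G⊆S fix

    par-hom : ∀ a b {c} → c ≅ a + b ⟦ + 2 ⟧ → par c ≡ par a xor par b
    par-hom a b e = trans (par-cong e) (par-+ a b)

    -- In F₂ the square of α is α, so the product of the three characters itself vanishes.
    par-product : ∀ f a c → f * (a * c * a) ≅ + 0 ⟦ + 2 ⟧ → par f ∧ (par a ∧ par c) ≡ false
    par-product f a c p = trans (cong (par f ∧_) (boolean (par a) (par c)))
      (trans (sym (trans (par-* f (a * c * a)) (cong (par f ∧_)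
        (trans (par-* (a * c) a) (cong (_∧ par a) (par-* a c)))))) (par-unique false p))
      where
      boolean : ∀ a c → a ∧ c ≡ (a ∧ c) ∧ a
      boolean false _     = refl
      boolean true  false = refl
      boolean true  true  = refl

    odd : ∀ {a} → ¬ (a ≅ + 0 ⟦ + 2 ⟧) → par a ≡ true
    odd {a} n = [ (λ e → ⊥-elim (n e)) , par-unique true ]′ (even-or-odd a)

    witness : ∀ χ → (Trivial lem 2 G sub G⊆S fix χ → GoodPair 2 G) → ∃ λ x → par (χ x) ≡ true
    witness χ h = let x , n = nontrivial lem 2 G sub G⊆S fix χ h ¬good in x , odd n

    module B = ThreeBooleanCharacters {X} (_∙_ lem 2 G sub G⊆S fix)
      (λ x → par (α x)) (λ x → par (γ x)) (λ x → par (f x))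
      (λ x y → par-hom (α x) (α y) (α-character-∙ lem 2 G sub G⊆S fix x y))
      (λ x y → par-hom (γ x) (γ y) (γ-character-∙ lem 2 G sub G⊆S fix x y))
      (λ x y → par-hom (f x) (f y) (f-character-∙ lem 2 G sub G⊆S fix x y))
      (λ x → par-product (f x) (α x) (γ x) (character-product lem 2 G sub G⊆S fix x))
      (witness α (α-Trivial-GoodPair lem 2 G sub G⊆S fix))
      (witness γ (γ-Trivial-GoodPair lem 2 G sub G⊆S fix))
      (witness f (f-Trivial-GoodPair lem 2 G sub G⊆S fix))

  -- A trivial character would yield a pair of diagonal lattices, so all three are nontrivial and
  -- `f≡a+c` applies. Every counterexample inside S₂ thus lies in one fixed group.
  counterexample-even-weight : ∀ g → G g → EvenWeight g
  counterexample-even-weight g p = even-weight (G⊆S g p)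
    (≅-trans (≡⇒≅ (fₛ-entry g (G⊆S g p)))
             (≅-scale {m = + 2} (+ 2) (par-injective {fₛ g (G⊆S g p)} {αₛ g + γₛ g}
               (trans (B.f≡a+c (g , p)) (sym (par-+ (αₛ g) (γₛ g)))))))

  private
    H : Bits → Set
    H x = Gbar G (unipotent x)

    H-· : ∀ x y → H x → H y → H (x · y)
    H-· x y p q = Gbar-resp (Gbar-⊗ sub p q) (λ i j → sym (unipotent-· x y i j))

    H-ε : H ε
    H-ε = idS 2 , Subgroup.one sub , to-Reduces (idS 2) (unipotent ε) (≡⇒≊ I4≡)
      where
      I4≡ : ∀ i j → I4 i j ≡ lift₂ (unipotent ε) i j
      I4≡ = toWitness {a? = all? λ i → all? λ j → I4 i j ℤ.≟ lift₂ (unipotent ε) i j} tt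

    G⊆Sbar2 : ∀ m → Gbar G m → Sbar2 m
    G⊆Sbar2 m (g , p , r) = g , G⊆S g p , r

    H-of-Gbar : ∀ m → Gbar G m → H (bits m)
    H-of-Gbar m p = Gbar-resp p (Sbar2-unipotent (G⊆Sbar2 m p))

    over : ∀ a c → (∃ λ x → par (α x) ≡ a × par (γ x) ≡ c) → ∃ λ p → ∃ λ q → H (a , c , p , q)
    over a c ((g , p) , ea , ec) = par (g 1 2F 0F) , par (g 1 3F 0F) , subst₂ (λ a c → H (a , c , par (g 1 2F 0F) , par (g 1 3F 0F)))
      (trans (par-cong (level-1-2 g (G⊆S g p) 1F 0F)) ea) (trans (par-cong (level-1-2 g (G⊆S g p) 2F 1F)) ec)
      (H-of-Gbar (reduction g) (g , p , Reduces-reduction g))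

    open Generated H H-· H-ε

  counterexample-image : (Gbar G ≐ Sbar2) ⊎ IsoOnto _·D4_ (Gbar G)
  counterexample-image =
    let p , q , s = over true false B.value-10
        p' , q' , t = over false true B.value-01
        z = ζ∈ s t
        i , σ = σ∈ z p q s
        j , τ = τ∈ z p' q' t
    in [ (λ all → inj₁ (λ m → G⊆Sbar2 m , λ m∈S → Gbar-resp (all (bits m)) (λ k l → sym (Sbar2-unipotent m∈S k l))))
       , (λ only → inj₂ (IsoOnto-unipotent (dihedral i j) (dihedral-· i j) (dihedral-injective i j)
           (dihedral∈ i j σ τ) G⊆Sbar2 (λ m p → only (bits m) (H-of-Gbar m p)))) ]′
       (dichotomy (lem (H ω)) i j σ τ)

  module _ (K : MSeq → Set) (K⊆Γ : ∀ h → K h → Γ2kerf h) where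

    Gen-even-weight : ∀ {g} → Gen 2 G K g → EvenWeight g
    Gen-even-weight (gen-inG p) = counterexample-even-weight _ p
    Gen-even-weight (gen-inH p) = even-weight-Γ2kerf _ (K⊆Γ _ p)
    Gen-even-weight gen-one = even-weight-idS
    Gen-even-weight (gen-mul {g} {h} p q) = even-weight-⊗ g (Gen-even-weight p) h (Gen-even-weight q)
    -- `h` is known only through gh = 1; uniqueness of inverses identifies it with `inverseS g`.
    Gen-even-weight (gen-inv {g} {h} p sp e) = even-weight-≈ (inverseS {2} g)
      (even-weight-inverse g (Gen-even-weight p)) h sp (inverseS-unique g (inS (Gen-even-weight p)) {h} e)
    Gen-even-weight (gen-resp {g} {h} p sp e) = even-weight-≈ g (Gen-even-weight p) h sp e

    Gen-subgroup : Subgroup 2 (Gen 2 G K)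
    Gen-subgroup = record
      { sp = λ g p → proj₁ (inS (Gen-even-weight p))
      ; resp = λ g h p sp e → gen-resp p sp e
      ; one = gen-one
      ; mul = λ g h p q → gen-mul p q
      ; inv = λ g p → let s = inS (Gen-even-weight p) in
          inverseS {2} g , gen-inv p (IsSp-inverseS g s) (inverseS-≈M g s) , inverseS-≈M g s
      }

    Gen-counterexample : Counterexample 2 (Gen 2 G K)
    Gen-counterexample = Gen-subgroup , (λ g p → even-weight-fixed g (Gen-even-weight p)) ,
      λ good → ¬good (GoodPair-restrict (λ g → gen-inG) good)

-- Maximal counterexamples, and existence for each image.

Sbar2-subgroup : Subgroup₂ Sbar2
Sbar2-subgroup = record
  { resp = λ m m' → Gbar-resp
  ; one = idS 2 , inS even-weight-idS , to-Reduces (idS 2) I₂ (≊-sym lift₂-I₂)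
  ; mul = λ { m m' (g , s , r) (h , t , r') → _⊗S_ 2 g h , InS-⊗S g h s t , Reduces-⊗ g h r r' }
  ; inv = inverse
  }
  where
  inverse : ∀ m → Sbar2 m → ∃ λ m' → Sbar2 m' × ((m ⊗₂ m') ≗₂ I₂)
  inverse m (g , s , r) = reduction h , (h , InS-inverseS g s , Reduces-reduction h) ,
    λ i j → b2z-injective _ _ (≅-trans (≅-sym (entry (from-Reduces (_⊗S_ 2 g h) (m ⊗₂ reduction h)
                (Reduces-⊗ g h r (Reduces-reduction h))) i j))
              (≅-trans (entry (≊-mod-ℓ {2} {n = 1} ℕₚ.≤-refl (inverseS-right g s 1)) i j)
                       (≅-sym (entry (lift₂-I₂) i j))))
    where
    h = inverseS {2} g

module _ (lem : (P : Set) → Dec P) where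

  -- All `EvenWeight` elements belong to this preimage, hence so does every counterexample contained
  -- in S₂. One element with a = 1 and c = 0 serves for both α and α + γ.
  largest-counterexample : Counterexample 2 (Preimage Sbar2)
  largest-counterexample = Preimage-counterexample Sbar2-subgroup lem
    ((true , false , false , false) , Sbar2-of-unipotent _ , refl)
    ((false , true , false , false) , Sbar2-of-unipotent _ , refl)
    ((true , false , false , false) , Sbar2-of-unipotent _ , refl)

  even-weight-Preimage : ∀ g → EvenWeight g → Preimage Sbar2 g
  even-weight-Preimage g k = k , reduction g , (g , inS k , Reduces-reduction g) , Reduces-reduction g

  -- Maximality, tested against `largest-counterexample`, forces `G` to contain every `EvenWeight`
  -- element. Both claims are then read off from that group.
  maximal-counterexample : ∀ G → (∀ g → G g → InS 2 g) → MaximalCounterexample 2 G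
    → IsoOnto _·C2D4_ (Gbar G) × (∀ g → ((G g × Γ2 g) → Γ2kerf g) × (Γ2kerf g → (G g × Γ2 g)))
  maximal-counterexample G G⊆S (counter , maximal) =
    IsoOnto-≐ image Sbar2-iso ,
    λ g → (λ { (p , q) → Γ2-even-weight-kerf g (counterexample-even-weight lem G G⊆S counter g p) q }) ,
          (λ q → even-weight-in-G g (even-weight-Γ2kerf g q) , proj₁ q)
    where
    even-weight-in-G : ∀ g → EvenWeight g → G g
    even-weight-in-G g k = maximal (Preimage Sbar2) largest-counterexample
      (λ h p → even-weight-Preimage h (counterexample-even-weight lem G G⊆S counter h p)) g (even-weight-Preimage g k)
    image : Gbar G ≐ Sbar2
    image m = (λ { (g , p , r) → g , G⊆S g p , r }) ,
      λ s → lift-sequence (bits m) , even-weight-in-G _ (lift-even-weight (bits m)) ,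
            Reduces-resp (lift-sequence (bits m)) (lift-reduces (bits m)) (λ i j → sym (Sbar2-unipotent s i j))

  module _ (D : M2 → Set) (sub : Subgroup₂ D) (D⊆S : ∀ m → D m → Sbar2 m) (iso : IsoOnto _·D4_ D) where

    private
      φ = proj₁ iso
      φ∈D = proj₁ (proj₂ iso)
      φ-injective = proj₁ (proj₂ (proj₂ iso))
      φ-hom = proj₂ (proj₂ (proj₂ (proj₂ iso)))

      r s : D4
      r = 1F , false
      s = 0F , true

      xᵣ xₛ : Bits
      xᵣ = bits (φ r)
      xₛ = bits (φ s)

      φ-unipotent : ∀ x → φ x ≗₂ unipotent (bits (φ x))
      φ-unipotent x = Sbar2-unipotent (D⊆S (φ x) (φ∈D x))

      φ-product : ∀ x y → φ (x ·D4 y) ≗₂ unipotent (bits (φ x) · bits (φ y))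
      φ-product x y i j = trans (φ-hom x y i j) (trans (⊗₂-cong (φ-unipotent x) (φ-unipotent y) i j)
        (sym (unipotent-· (bits (φ x)) (bits (φ y)) i j)))

      rs≢sr : r ·D4 s ≢ s ·D4 r
      rs≢sr ()

      -- The generators of D₄ do not commute, so by `commute` their vectors (a, c) are linearly
      -- independent in F₂². Hence none of the nonzero linear forms a, c, a + c vanishes at both,
      -- which supplies the three witnesses.
      independent : aᵇ xᵣ ∧ cᵇ xₛ ≢ cᵇ xᵣ ∧ aᵇ xₛ
      independent e = rs≢sr (φ-injective (r ·D4 s) (s ·D4 r) λ i j →
        trans (φ-product r s i j) (trans (cong (λ x → unipotent x i j) (commute xᵣ xₛ e)) (sym (φ-product s r i j))))

      D-bits : ∀ x → D (unipotent (bits (φ x)))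
      D-bits x = Subgroup₂.resp sub (φ x) (unipotent (bits (φ x))) (φ∈D x) (φ-unipotent x)

      choose : (χ : Bits → Bool) → (χ xᵣ ≡ true) ⊎ (χ xₛ ≡ true) → ∃ λ x → D (unipotent x) × χ x ≡ true
      choose χ (inj₁ e) = xᵣ , D-bits r , e
      choose χ (inj₂ e) = xₛ , D-bits s , e

      a-some : ∀ a c a' c' → a ∧ c' ≢ c ∧ a' → (a ≡ true) ⊎ (a' ≡ true)
      a-some true  _     _     _ _ = inj₁ refl
      a-some false _     true  _ _ = inj₂ refl
      a-some false false false _ n = ⊥-elim (n refl)
      a-some false true  false _ n = ⊥-elim (n refl)

      c-some : ∀ a c a' c' → a ∧ c' ≢ c ∧ a' → (c ≡ true) ⊎ (c' ≡ true)
      c-some _     true  _ _     _ = inj₁ refl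
      c-some _     false _ true  _ = inj₂ refl
      c-some false false _ false n = ⊥-elim (n refl)
      c-some true  false _ false n = ⊥-elim (n refl)

      f-some : ∀ a c a' c' → a ∧ c' ≢ c ∧ a' → (a xor c ≡ true) ⊎ (a' xor c' ≡ true)
      f-some true  false _     _     _ = inj₁ refl
      f-some false true  _     _     _ = inj₁ refl
      f-some _     _     true  false _ = inj₂ refl
      f-some _     _     false true  _ = inj₂ refl
      f-some false false false false n = ⊥-elim (n refl)
      f-some false false true  true  n = ⊥-elim (n refl)
      f-some true  true  false false n = ⊥-elim (n refl)
      f-some true  true  true  true  n = ⊥-elim (n refl)

    dihedral-counterexample : Counterexample 2 (Preimage D)
    dihedral-counterexample = Preimage-counterexample sub lem
      (choose aᵇ (a-some (aᵇ xᵣ) (cᵇ xᵣ) (aᵇ xₛ) (cᵇ xₛ) independent))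
      (choose cᵇ (c-some (aᵇ xᵣ) (cᵇ xᵣ) (aᵇ xₛ) (cᵇ xₛ) independent))
      (choose (λ x → aᵇ x xor cᵇ x) (f-some (aᵇ xᵣ) (cᵇ xᵣ) (aᵇ xₛ) (cᵇ xₛ) independent))

theorem3p1 : ((P : Set₁) → Dec P) →
    ( (ℓ : ℕ) → Prime ℓ → 3 ≤ ℓ → (G : MSeq → Set) → Subgroup ℓ G
    → (∀ g → G g → InS ℓ g) → Fix2 ℓ G
    → (αTrivial ℓ G ⊎ γTrivial ℓ G ⊎ fTrivial ℓ G) × ¬ Counterexample ℓ G )
    × ( (G : MSeq → Set) → (∀ g → G g → InS 2 g) → Counterexample 2 G
    → ((Gbar G ≐ Sbar2) ⊎ IsoOnto _·D4_ (Gbar G))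
    × ((H : MSeq → Set) → Subgroup 2 H → (∀ h → H h → Γ2kerf h)
    → Counterexample 2 (Gen 2 G H))
    × (MaximalCounterexample 2 G
    → IsoOnto _·C2D4_ (Gbar G)
    × (∀ g → ((G g × Γ2 g) → Γ2kerf g) × (Γ2kerf g → (G g × Γ2 g)))) )
    × IsoOnto _·C2D4_ Sbar2
    × Σ (MSeq → Set) (λ G → (∀ g → G g → InS 2 g) × Counterexample 2 G × (Gbar G ≐ Sbar2))
    × ( (D : M2 → Set) → Subgroup₂ D → (∀ m → D m → Sbar2 m) → IsoOnto _·D4_ D
    → Σ (MSeq → Set) (λ G → (∀ g → G g → InS 2 g) × Counterexample 2 G × (Gbar G ≐ D)) )
theorem3p1 lem₁ =
    (λ ℓ ℓ-prime 3≤ℓ G sub G⊆S fix → odd-prime-case lem ℓ {{prime⇒nonZero ℓ-prime}} G sub G⊆S fix ℓ-prime 3≤ℓ)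
  , (λ G G⊆S counter → counterexample-image lem G G⊆S counter
      , (λ H _ H⊆Γ → Gen-counterexample lem G G⊆S counter H H⊆Γ)
      , maximal-counterexample lem G G⊆S)
  , Sbar2-iso
  , (Preimage Sbar2 , (λ g p → inS (proj₁ p)) , largest-counterexample lem
      , Preimage-image Sbar2-subgroup (λ m s → s))
  , λ D sub D⊆S iso → Preimage D , (λ g p → inS (proj₁ p)) , dihedral-counterexample lem D sub D⊆S iso
      , Preimage-image sub D⊆S
  where
  lem : (P : Set) → Dec P
  -- Excluded middle comes down from `Set₁` by `Lift`. It decides whether a lattice has an odd
  -- vector, whether a character is nontrivial, and whether `ω` lies in the image of a
  -- counterexample.
  lem P = map′ lower lift (lem₁ (Lift _ P))
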